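{- Let $\mathcal H$ be the decorated Connes–Kreimer Hopf algebra described below, let $T_0$ be a rooted tree in it on $n_0$ vertices whose non-root vertices carry pairwise distinct labels, and consider the Markov chains on $\mathcal B_{n_0}$ driven by $\mathrm{T2R}_{n_0}$ and by $\mathrm{BinT2R}_{n_0}(q_2)$ started at $T_0$. These chains remain in the set $\{\bullet^{n_0-n}\sqcup T: T \text{ a rooted subtree of } T_0 \text{ on } n \text{ vertices},\ 1\le n\le n_0\}$, and under the identification $\bullet^{n_0-n}\sqcup T\mapsto T$ the chain driven by $\mathrm{T2R}_{n_0}$ is the single model and the chain driven by $\mathrm{BinT2R}_{n_0}(q_2)$ is the binomial model (with parameter $q_2$) of the employee-firing chain started at $T_0$.
   Context: $\mathcal H$: basis $\mathcal B$ of rooted forests in which every non-root vertex carries a label from a fixed finite set (roots unlabelled), graded by number of vertices; $\bullet$ is the one-vertex forest. Product is disjoint union $\sqcup$ (labels preserved). For a forest $x$ on $m$ vertices, $\Delta_{1,m-1}(x)=\sum_v\bullet\otimes(x\setminus v)$ over all leaves $v$ of $x$ (vertices without children, including isolated roots), labels preserved; consequently $\Delta_{1^r,m-r}(x)=\sum\bullet^{\otimes r}\otimes x\setminus\{v_1,\dots,v_r\}$ over sequences with $v_i$ a leaf of $x\setminus\{v_1,\dots,v_{i-1}\}$, and $m\Delta_{1^r,m-r}$ is this followed by multiplication. $\mathrm{T2R}_m=\frac1m m\Delta_{1,m-1}$; $\mathrm{BinT2R}_m(q_2)=\sum_{r=0}^m\frac1{r!}(1-q_2)^rq_2^{m-r}m\Delta_{1^r,m-r}$.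 $\eta(x)$ is the number of increasing labellings of $x$ (bijections from vertices to $\{1,\dots,m\}$ with each parent's number smaller than its children's). The chain driven by $\mathrm T$ has transition matrix $\hat K(x,y)=\frac{\eta(y)}{\eta(x)}\cdot(\text{coefficient of } y\text{ in }\mathrm T(x))$. A rooted subtree of $T_0$ is a connected set of vertices containing the root, with induced labels. Employee-firing chain (states: rooted subtrees of $T_0$; vertices are positions, root = boss, each occupied by one employee). Promotion cascade after the employee at vertex $v$ of the current tree $T$ is fired: set $u:=v$; while $u$ has children, choose $w$ uniformly among strict descendants of $u$, promote the employee at $w$ to $u$, set $u:=w$; finally delete the leaf $u$, giving $T$ minus that leaf. No firing occurs when only the boss remains. Single model: from a state with $n$ vertices, with probability $n/n_0$ a uniformly chosen employee is fired (with cascade), otherwise no change. Binomial model: each employee is independently fired with probability $1-q_2$, the fired employees being fired one by one in uniformly random order, each with its cascade.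
   Formalization: The parameter q₂ of the binomial chain and the binomial model is taken to be a rational number in [0,1] rather than a real one. -}

module Defs where

open import Data.Bool using (Bool; true; false; _∧_; _∨_; not; if_then_else_)
open import Data.Nat as ℕ using (ℕ; zero; suc; _∸_; _≤ᵇ_)
open import Data.Nat using (_!)
open import Data.Integer using (+_)
open import Data.Fin using (Fin)
open import Data.Fin.Properties as FinP using ()
open import Data.List using (List; []; _∷_; _++_; map; concatMap; filterᵇ; length;
  replicate; foldr; concat)
open import Data.Bool.ListAction using (any; all)
open import Data.List.Properties using (≡-dec)
open import Data.Product using (_×_; _,_; proj₁; proj₂; ∃-syntax)
open import Data.Rational using (ℚ; 0ℚ; 1ℚ; _+_; _*_; _-_; _/_)
open import Relation.Nullary.Decidable using (⌊_⌋)
open import Relation.Binary.PropositionalEquality using (_≡_)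

-- Decorated rooted forests.
-- A labelled (non-root) vertex together with its descendants.
data LTree (k : ℕ) : Set where
  node : Fin k → List (LTree k) → LTree k

-- A rooted tree with unlabelled root: the list of the root's child subtrees.
RTree : ℕ → Set
RTree k = List (LTree k)

-- A rooted forest: a list of rooted trees (order immaterial, see isoF).
Forest : ℕ → Set
Forest k = List (RTree k)

bulletT : ∀ {k} → RTree k
bulletT = []

bullets : ∀ {k} → ℕ → Forest k
bullets r = replicate r bulletT

sizeL : ∀ {k} → List (LTree k) → ℕ
sizeL [] = 0
sizeL (node a cs ∷ ts) = suc (sizeL cs ℕ.+ sizeL ts)

sizeR : ∀ {k} → RTree k → ℕ
sizeR t = suc (sizeL t)

labelsL : ∀ {k} → List (LTree k) → List (Fin k)
labelsL [] = []
labelsL (node a cs ∷ ts) = a ∷ labelsL cs ++ labelsL ts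

-- Isomorphism of labelled rooted forests (labels preserved).
-- Two lists of trees are isomorphic iff the trees can be matched
-- bijectively into isomorphic pairs; 'picks' enumerates the choices of a
-- partner for the first tree.
picks : ∀ {A : Set} → List A → List (A × List A)
picks [] = []
picks (x ∷ xs) = (x , xs) ∷ map (λ p → proj₁ p , x ∷ proj₂ p) (picks xs)

mutual
  isoT : ∀ {k} → LTree k → LTree k → Bool
  isoT (node a cs) (node b ds) = ⌊ a FinP.≟ b ⌋ ∧ isoLs cs ds

  isoLs : ∀ {k} → List (LTree k) → List (LTree k) → Bool
  isoLs [] [] = true
  isoLs [] (_ ∷ _) = false
  isoLs (t ∷ ts) us = any (λ p → isoT t (proj₁ p) ∧ isoLs ts (proj₂ p)) (picks us)

isoF : ∀ {k} → Forest k → Forest k → Bool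
isoF [] [] = true
isoF [] (_ ∷ _) = false
isoF (t ∷ ts) us = any (λ p → isoLs t (proj₁ p) ∧ isoF ts (proj₂ p)) (picks us)

delL : ∀ {k} → List (LTree k) → List (List (LTree k))
delL [] = []
delL (node a [] ∷ ts) = ts ∷ map (node a [] ∷_) (delL ts)
delL (node a (c ∷ cs) ∷ ts) =
  map (λ cs' → node a cs' ∷ ts) (delL (c ∷ cs)) ++ map (node a (c ∷ cs) ∷_) (delL ts)

-- for forests; an isolated root is a leaf
delF : ∀ {k} → Forest k → List (Forest k)
delF [] = []
delF ([] ∷ rs) = rs ∷ map ([] ∷_) (delF rs)
delF ((c ∷ cs) ∷ rs) = map (_∷ rs) (delL (c ∷ cs)) ++ map ((c ∷ cs) ∷_) (delF rs)

seqDel : ∀ {k} → ℕ → Forest k → List (Forest k)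
seqDel zero x = x ∷ []
seqDel (suc r) x = concatMap (seqDel r) (delF x)

-- m Δ_{1^r, m-r}(x), as a list of basis terms (with multiplicity)
mΔ : ∀ {k} → ℕ → Forest k → List (Forest k)
mΔ r x = map (λ y → bullets r ++ y) (seqDel r x)

coeff : ∀ {k} → Forest k → List (Forest k) → ℕ
coeff y xs = length (filterᵇ (λ z → isoF y z) xs)

frac : ℕ → ℕ → ℚ
frac a zero = 0ℚ
frac a (suc b) = (+ a) / suc b

_^ℚ_ : ℚ → ℕ → ℚ
p ^ℚ zero = 1ℚ
p ^ℚ suc n = p * (p ^ℚ n)

sumℚ : List ℚ → ℚ
sumℚ = foldr _+_ 0ℚ

-- Vertex addresses.  An address is a list of child indices, read from
-- the vertex upwards (so the parent of  i ∷ p  is  p ).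
Addr : Set
Addr = List ℕ

_==ₐ_ : Addr → Addr → Bool
a ==ₐ b = ⌊ ≡-dec ℕ._≟_ a b ⌋

addrsL : ∀ {k} → Addr → ℕ → List (LTree k) → List Addr
addrsL p i [] = []
addrsL p i (node a cs ∷ ts) = (i ∷ p) ∷ addrsL (i ∷ p) 0 cs ++ addrsL p (suc i) ts

addrsR : ∀ {k} → RTree k → List Addr
addrsR t = [] ∷ addrsL [] 0 t

addrsFrom : ∀ {k} → ℕ → Forest k → List Addr
addrsFrom i [] = []
addrsFrom i (t ∷ ts) = ((i ∷ []) ∷ addrsL (i ∷ []) 0 t) ++ addrsFrom (suc i) ts

vertsF : ∀ {k} → Forest k → List Addr
vertsF = addrsFrom 0

-- η(x): number of increasing labellings.  A bijection from the vertices
-- to {1,…,m} is the same as the list of vertices ordered by their number;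
-- it is increasing iff every non-root vertex comes after its parent.
insertions : ∀ {A : Set} → A → List A → List (List A)
insertions x [] = (x ∷ []) ∷ []
insertions x (y ∷ ys) = (x ∷ y ∷ ys) ∷ map (y ∷_) (insertions x ys)

perms : ∀ {A : Set} → List A → List (List A)
perms [] = [] ∷ []
perms (x ∷ xs) = concatMap (insertions x) (perms xs)

-- in a forest, vertices i ∷ [] are roots; otherwise the parent is the tail
parentBefore : List Addr → Addr → Bool
parentBefore seen [] = true
parentBefore seen (i ∷ []) = true
parentBefore seen (i ∷ j ∷ p) = any (λ a → a ==ₐ (j ∷ p)) seen

increasing : List Addr → List Addr → Bool
increasing seen [] = true
increasing seen (v ∷ vs) = parentBefore seen v ∧ increasing (v ∷ seen) vs

η : ∀ {k} → Forest k → ℕ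
η x = length (filterᵇ (λ ℓ → increasing [] ℓ) (perms (vertsF x)))

coeffT2R : ∀ {k} → ℕ → Forest k → Forest k → ℚ
coeffT2R m x y = frac 1 m * frac (coeff y (mΔ 1 x)) 1

binSum : ∀ {k} → ℕ → ℚ → Forest k → Forest k → ℕ → ℚ
binSum m q x y zero = frac (coeff y (mΔ 0 x)) 1 * (q ^ℚ m)
binSum m q x y (suc r) =
  binSum m q x y r
  + frac 1 ((suc r) !) * ((1ℚ - q) ^ℚ suc r) * (q ^ℚ (m ∸ suc r))
    * frac (coeff y (mΔ (suc r) x)) 1

coeffBinT2R : ∀ {k} → ℕ → ℚ → Forest k → Forest k → ℚ
coeffBinT2R m q x y = binSum m q x y m

chainKernel : ∀ {k} → (Forest k → Forest k → ℚ) → Forest k → Forest k → ℚ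
chainKernel c x y = frac (η y) (η x) * c x y

K-T2R : ∀ {k} → ℕ → Forest k → Forest k → ℚ
K-T2R m = chainKernel (coeffT2R m)

K-BinT2R : ∀ {k} → ℕ → ℚ → Forest k → Forest k → ℚ
K-BinT2R m q = chainKernel (coeffBinT2R m q)

-- Rooted subtrees of T0, as sets of vertex addresses of T0.
VSet : Set
VSet = Addr → Bool

_∈ᵥ_ : Addr → List Addr → Bool
a ∈ᵥ V = any (λ b → a ==ₐ b) V

-- a set of vertices of T0 containing the root and connected, i.e. closed
-- under taking parents
record IsRootedSubtree {k} (T0 : RTree k) (S : VSet) : Set where
  field
    root∈   : S [] ≡ true
    ⊆T0     : ∀ a → S a ≡ true → a ∈ᵥ addrsR T0 ≡ true
    closed  : ∀ i a → S (i ∷ a) ≡ true → S a ≡ true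

induceL : ∀ {k} → VSet → Addr → ℕ → List (LTree k) → List (LTree k)
induceL S p i [] = []
induceL S p i (node a cs ∷ ts) =
  if S (i ∷ p)
  then node a (induceL S (i ∷ p) 0 cs) ∷ induceL S p (suc i) ts
  else induceL S p (suc i) ts

induce : ∀ {k} → RTree k → VSet → RTree k
induce T0 S = induceL S [] 0 T0

members : List Addr → VSet → List Addr
members V S = filterᵇ (λ a → S a) V

embed : ∀ {k} → RTree k → VSet → Forest k
embed T0 S = bullets (sizeR T0 ∸ length (members (addrsR T0) S)) ++ (induce T0 S ∷ [])

Dist : Set → Set
Dist A = List (ℚ × A)

bindD : ∀ {A B : Set} → Dist A → (A → Dist B) → Dist B
bindD d f = concatMap (λ p → map (λ q → proj₁ p * proj₁ q , proj₂ q) (f (proj₂ p))) d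

scaleD : ∀ {A : Set} → ℚ → Dist A → Dist A
scaleD c = map (λ p → c * proj₁ p , proj₂ p)

uniform : ∀ {A : Set} → List A → Dist A
uniform xs = map (λ x → frac 1 (length xs) , x) xs

-- Employee-firing chain.  V = vertices of T0.  A configuration is the
-- current set of positions together with the employee at each position
-- (employees named by their position at the start of the step).
Emp : Set
Emp = Addr → Addr

Config : Set
Config = VSet × Emp

strictAnc : Addr → Addr → Bool
strictAnc u [] = false
strictAnc u (i ∷ a) = (u ==ₐ a) ∨ strictAnc u a

strictDesc : List Addr → VSet → Addr → List Addr
strictDesc V S u = filterᵇ (λ a → S a ∧ strictAnc u a) V

removeV : VSet → Addr → VSet
removeV S u a = S a ∧ not (a ==ₐ u)

setEmp : Emp → Addr → Addr → Emp
setEmp e u x a = if a ==ₐ u then x else e a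

-- promotion cascade from the vacant position u (fuel bounds the depth;
-- fuel = |V| is never exhausted)
cascadeWith : List Addr → ℕ → Config → Addr → List Addr → Dist Config
cascadeWith V fuel (S , e) u [] = (1ℚ , (removeV S u , e)) ∷ []
cascadeWith V zero (S , e) u (_ ∷ _) = []
cascadeWith V (suc fuel) (S , e) u (w ∷ ws) =
  bindD (uniform (w ∷ ws))
    (λ w' → cascadeWith V fuel (S , setEmp e u (e w')) w' (strictDesc V S w'))

cascade : List Addr → Config → Addr → Dist Config
cascade V (S , e) u = cascadeWith V (length V) (S , e) u (strictDesc V S u)

fireAt : List Addr → Config → Addr → Dist Config
fireAt V (S , e) v =
  if length (members V S) ≤ᵇ 1 then (1ℚ , (S , e)) ∷ [] else cascade V (S , e) v

fireEmp : List Addr → Config → Addr → Dist Config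
fireEmp V (S , e) x with filterᵇ (λ a → S a ∧ (e a ==ₐ x)) V
... | [] = (1ℚ , (S , e)) ∷ []
... | v ∷ _ = fireAt V (S , e) v

fireSeq : List Addr → List Addr → Config → Dist Config
fireSeq V [] c = (1ℚ , c) ∷ []
fireSeq V (x ∷ xs) c = bindD (fireEmp V c x) (fireSeq V xs)

sublists : ∀ {A : Set} → List A → List (List A)
sublists [] = [] ∷ []
sublists (x ∷ xs) = map (x ∷_) (sublists xs) ++ sublists xs

sameSet : List Addr → VSet → VSet → Bool
sameSet V S S' = all (λ a → ⌊ Data.Bool._≟_ (S a) (S' a) ⌋) V
  where import Data.Bool

probTo : List Addr → Dist Config → VSet → ℚ
probTo V d S' = sumℚ (map proj₁ (filterᵇ (λ p → sameSet V (proj₁ (proj₂ p)) S') d))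

idEmp : Emp
idEmp a = a

singleStep : ∀ {k} → RTree k → VSet → Dist Config
singleStep T0 S =
  (frac (n0 ∸ n) n0 , (S , idEmp))
    ∷ scaleD (frac n n0) (bindD (uniform (members V S)) (fireAt V (S , idEmp)))
  where
  V = addrsR T0
  n0 = sizeR T0
  n = length (members V S)

binomialStep : ∀ {k} → RTree k → ℚ → VSet → Dist Config
binomialStep T0 q S =
  concatMap
    (λ F → scaleD (((1ℚ - q) ^ℚ length F) * (q ^ℚ (n ∸ length F)))
             (bindD (uniform (perms F)) (λ σ → fireSeq V σ (S , idEmp))))
    (sublists (members V S))
  where
  V = addrsR T0
  n = length (members V S)

singleModel : ∀ {k} → RTree k → VSet → VSet → ℚ
singleModel T0 S S' = probTo (addrsR T0) (singleStep T0 S) S'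

binomialModel : ∀ {k} → RTree k → ℚ → VSet → VSet → ℚ
binomialModel T0 q S S' = probTo (addrsR T0) (binomialStep T0 q S) S'

{-# OPTIONS --safe #-}
module Submission where

-- Write h_v for the number of descendants of v, including v.  Choosing the vertex numbered first
-- gives the hook length formula η(x) ∏ h_v = |x|!, so η(y)/η(x) is a quotient of hook products.
-- For a function b of the final tree, let C(u) be its expected value after a cascade started at u.
-- Then (h_u - 1) C(u) is the sum of C over the strict descendants of u, and by induction on the
-- tree the sum of C over all vertices is the sum over the leaves ℓ of b(T∖ℓ) ∏ h_v(T) / ∏ h_v(T∖ℓ).
-- The weights are the ratios η(• ⊔ T∖ℓ)/η(T) of the chain.  For several firings one inducts on
-- their number: after a cascade the remaining employees still fill the remaining positions
-- bijectively, so the order of firing of distinct employees is again uniform.  In the binomial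
-- chain the isolated roots only contribute (q + (1 - q))^(n0-n) = 1.  A forest reached from
-- embed T0 S is identified by its labels, which are distinct.
open import Defs
open import Data.Bool using (Bool; true; false; _∧_; _∨_; not)
import Data.Bool.Properties as BoolP
open import Data.Bool.ListAction using (any)
open import Data.Fin as Fin using (Fin)
open import Data.Integer as ℤ using (+_)
import Data.Integer.Properties as ℤP
open import Data.List using (List; []; _∷_; _++_; map; concatMap; filterᵇ; length; null)
import Data.List.Properties as ListP
open import Data.List.Membership.Propositional using (_∈_; _∉_)
open import Data.List.Membership.Propositional.Properties
  using (∈-map⁻; ∈-map⁺; ∈-++⁻; ∈-++⁺ˡ; ∈-++⁺ʳ; ∈-filter⁺; ∈-filter⁻)
open import Data.List.Relation.Binary.Permutation.Propositional
  using (_↭_; refl; prep; swap; trans; ↭-sym; ↭-refl; ↭-reflexive)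
import Data.List.Relation.Binary.Permutation.Propositional.Properties as ↭P
open import Data.List.Relation.Unary.All as All using ([]; _∷_)
open import Data.List.Relation.Unary.AllPairs using ([]; _∷_)
open import Data.List.Relation.Unary.Any using (here; there)
open import Data.List.Relation.Unary.Unique.Propositional using (Unique)
import Data.List.Relation.Unary.Unique.Propositional.Properties as UniqueP
open import Data.Nat as ℕ using (ℕ; zero; suc; _∸_; _!; z≤n; s≤s)
import Data.Nat.Properties as ℕP
open import Data.Product using (_×_; _,_; proj₁; proj₂; ∃-syntax)
open import Data.Rational using (ℚ; 0ℚ; 1ℚ; _+_; _*_; _-_; -_; _≤_; toℚᵘ)
import Data.Rational.Properties as ℚP
open import Data.Rational.Solver using (module +-*-Solver)
import Data.Rational.Unnormalised as ℚᵘ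
import Data.Rational.Unnormalised.Properties as ℚᵘP
open import Data.Sum using (_⊎_; inj₁; inj₂; [_,_])
open import Function using (_∘_)
open import Relation.Nullary using (¬_; yes; no; contradiction)
open import Relation.Binary.PropositionalEquality as ≡
  using (_≡_; _≢_; refl; sym; cong; cong₂; subst; module ≡-Reasoning)
open +-*-Solver using (solve; _:+_; _:*_; _:=_; con)
open ≡-Reasoning


-- The total of C over a branch is what closes under the induction on the tree. If v has n ≥ 1
-- strict descendants, then C(v) is their mean, so adding v to the total below it multiplies that
-- total by (n+1)/n. On the side of the leaves, the hook of v is n+1 in T and drops to n when a leaf
-- below v is deleted, which is the same quotient; for a leaf elsewhere the hook of v cancels.
-- Denominators are cleared, and the leaves carry free weights γ that absorb the hooks lying outside
-- the branch under consideration. Two mismatches shape the rest. The chain turns each deleted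
-- vertex into an isolated root, and it may delete the root of the tree, while the model forgets
-- deleted positions and never fires a lone boss. Hence deletions are counted in the tree part only,
-- with the number of isolated roots as a parameter, and a lone root is the same forest as an
-- isolated root. Moreover, the expected value of a cascade depends on positions alone, whereas the
-- list of the fired names employees; so the statement on several firings is proved for every
-- assignment of the employees to the positions.

-- Natural numbers in ℚ and the fractions `frac`

opaque
  -- Opaque, so that embedded numbers are handled through the homomorphism laws and do not unfold to
  -- the normalisation of fractions in `_/_`.
  ι : ℕ → ℚ
  ι n = frac n 1

opaque
  unfolding ι

  ι-def : ∀ n → ι n ≡ frac n 1
  ι-def n = refl

  ι-0 : ι 0 ≡ 0ℚ
  ι-0 = refl

  ι-1 : ι 1 ≡ 1ℚ
  ι-1 = refl

  ι≃ : ∀ n → toℚᵘ (ι n) ℚᵘ.≃ ℚᵘ.mkℚᵘ (+ n) 0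
  ι≃ n = ℚP.toℚᵘ-fromℚᵘ (ℚᵘ.mkℚᵘ (+ n) 0)

  ι-+ : ∀ a b → ι (a ℕ.+ b) ≡ ι a + ι b
  ι-+ a b = ℚP.toℚᵘ-injective (ℚᵘP.≃-trans (ι≃ (a ℕ.+ b)) (ℚᵘP.≃-trans lemma
    (ℚᵘP.≃-sym (ℚᵘP.≃-trans (ℚP.toℚᵘ-homo-+ (ι a) (ι b)) (ℚᵘP.+-cong (ι≃ a) (ι≃ b))))))
    where
    lemma : ℚᵘ.mkℚᵘ (+ (a ℕ.+ b)) 0 ℚᵘ.≃ ℚᵘ.mkℚᵘ (+ a) 0 ℚᵘ.+ ℚᵘ.mkℚᵘ (+ b) 0
    lemma = ℚᵘ.*≡* (cong (ℤ._* (+ 1))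
      (≡.trans (ℤP.pos-+ a b) (sym (cong₂ ℤ._+_ (ℤP.*-identityʳ (+ a)) (ℤP.*-identityʳ (+ b))))))

  ι-* : ∀ a b → ι (a ℕ.* b) ≡ ι a * ι b
  ι-* a b = ℚP.toℚᵘ-injective (ℚᵘP.≃-trans (ι≃ (a ℕ.* b)) (ℚᵘP.≃-trans lemma
    (ℚᵘP.≃-sym (ℚᵘP.≃-trans (ℚP.toℚᵘ-homo-* (ι a) (ι b)) (ℚᵘP.*-cong (ι≃ a) (ι≃ b))))))
    where
    lemma : ℚᵘ.mkℚᵘ (+ (a ℕ.* b)) 0 ℚᵘ.≃ ℚᵘ.mkℚᵘ (+ a) 0 ℚᵘ.* ℚᵘ.mkℚᵘ (+ b) 0
    lemma = ℚᵘ.*≡* (cong (ℤ._* (+ 1)) (ℤP.pos-* a b))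

  ι-injective : ∀ {a b} → ι a ≡ ι b → a ≡ b
  ι-injective {a} {b} eq with ℚᵘP.≃-trans (ℚᵘP.≃-sym (ι≃ a)) (ℚᵘP.≃-trans (ℚᵘP.≃-reflexive (cong toℚᵘ eq)) (ι≃ b))
  ... | ℚᵘ.*≡* e = ℤP.+-injective (≡.trans (sym (ℤP.*-identityʳ (+ a))) (≡.trans e (ℤP.*-identityʳ (+ b))))

  frac-*-ι : ∀ a b → frac a (suc b) * ι (suc b) ≡ ι a
  frac-*-ι a b = ℚP.toℚᵘ-injective (ℚᵘP.≃-trans (ℚP.toℚᵘ-homo-* (frac a (suc b)) (ι (suc b)))
    (ℚᵘP.≃-trans (ℚᵘP.*-cong (ℚP.toℚᵘ-fromℚᵘ (ℚᵘ.mkℚᵘ (+ a) b)) (ι≃ (suc b)))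
    (ℚᵘP.≃-trans lemma (ℚᵘP.≃-sym (ι≃ a)))))
    where
    lemma : ℚᵘ.mkℚᵘ (+ a) b ℚᵘ.* ℚᵘ.mkℚᵘ (+ suc b) 0 ℚᵘ.≃ ℚᵘ.mkℚᵘ (+ a) 0
    lemma = ℚᵘ.*≡* (≡.trans (ℤP.*-identityʳ ((+ a) ℤ.* (+ suc b))) (cong ((+ a) ℤ.*_) (cong +_ (sym (ℕP.*-identityʳ (suc b))))))

ι-suc : ∀ n → ι (suc n) ≡ 1ℚ + ι n
ι-suc n = ≡.trans (ι-+ 1 n) (cong (_+ ι n) ι-1)

frac-inverse : ∀ b → .{{ℕ.NonZero b}} → frac 1 b * ι b ≡ 1ℚ
frac-inverse (suc b) = ≡.trans (frac-*-ι 1 b) ι-1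

ι-cancelʳ : ∀ b → .{{ℕ.NonZero b}} → ∀ {p q} → p * ι b ≡ q * ι b → p ≡ q
ι-cancelʳ b {p} {q} eq = begin
  p                      ≡⟨ unit p ⟨
  p * ι b * frac 1 b     ≡⟨ cong (_* frac 1 b) eq ⟩
  q * ι b * frac 1 b     ≡⟨ unit q ⟩
  q                      ∎
  where
  unit : ∀ r → r * ι b * frac 1 b ≡ r
  unit r = begin
    r * ι b * frac 1 b   ≡⟨ ℚP.*-assoc r (ι b) (frac 1 b) ⟩
    r * (ι b * frac 1 b) ≡⟨ cong (r *_) (≡.trans (ℚP.*-comm (ι b) (frac 1 b)) (frac-inverse b)) ⟩
    r * 1ℚ               ≡⟨ ℚP.*-identityʳ r ⟩
    r                    ∎

frac-split : ∀ a b → frac a b ≡ ι a * frac 1 b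
-- With denominator 0 both sides vanish, by the default value of `frac`.
frac-split a zero    = sym (ℚP.*-zeroʳ (ι a))
frac-split a (suc b) = ι-cancelʳ (suc b) (begin
  frac a (suc b) * ι (suc b)         ≡⟨ frac-*-ι a b ⟩
  ι a                                ≡⟨ ℚP.*-identityʳ (ι a) ⟨
  ι a * 1ℚ                           ≡⟨ cong (ι a *_) (frac-inverse (suc b)) ⟨
  ι a * (frac 1 (suc b) * ι (suc b)) ≡⟨ ℚP.*-assoc (ι a) (frac 1 (suc b)) (ι (suc b)) ⟨
  ι a * frac 1 (suc b) * ι (suc b)   ∎)

-- Indicators and finite sums

𝟙 : Bool → ℚ
𝟙 true  = 1ℚ
𝟙 false = 0ℚ

𝟙-∧ : ∀ b c → 𝟙 (b ∧ c) ≡ 𝟙 b * 𝟙 c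
𝟙-∧ true  c = sym (ℚP.*-identityˡ (𝟙 c))
𝟙-∧ false c = sym (ℚP.*-zeroˡ (𝟙 c))

∑ : ∀ {A : Set} → List A → (A → ℚ) → ℚ
∑ []       f = 0ℚ
∑ (x ∷ xs) f = f x + ∑ xs f

syntax ∑ xs (λ x → e) = ∑[ x ∈ xs ] e

module _ {A : Set} where

  ∑-cong : ∀ (xs : List A) {f g : A → ℚ} → (∀ {x} → x ∈ xs → f x ≡ g x) → ∑ xs f ≡ ∑ xs g
  ∑-cong []       eq = refl
  ∑-cong (x ∷ xs) eq = cong₂ _+_ (eq (here refl)) (∑-cong xs (eq ∘ there))

  ∑-++ : ∀ (xs ys : List A) f → ∑ (xs ++ ys) f ≡ ∑ xs f + ∑ ys f
  ∑-++ []       ys f = sym (ℚP.+-identityˡ (∑ ys f))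
  ∑-++ (x ∷ xs) ys f = ≡.trans (cong (_+_ (f x)) (∑-++ xs ys f)) (sym (ℚP.+-assoc (f x) (∑ xs f) (∑ ys f)))

  ∑-zero : ∀ (xs : List A) → ∑ xs (λ _ → 0ℚ) ≡ 0ℚ
  ∑-zero []       = refl
  ∑-zero (x ∷ xs) = ≡.trans (ℚP.+-identityˡ _) (∑-zero xs)

  ∑-one : ∀ (xs : List A) → ∑ xs (λ _ → 1ℚ) ≡ ι (length xs)
  ∑-one []       = sym ι-0
  ∑-one (x ∷ xs) = ≡.trans (cong (_+_ 1ℚ) (∑-one xs)) (sym (ι-suc (length xs)))

  ∑-+ : ∀ (xs : List A) f g → ∑ xs (λ x → f x + g x) ≡ ∑ xs f + ∑ xs g
  ∑-+ []       f g = refl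
  ∑-+ (x ∷ xs) f g = ≡.trans (cong (_+_ (f x + g x)) (∑-+ xs f g))
    (solve 4 (λ a b c d → (a :+ b) :+ (c :+ d) := (a :+ c) :+ (b :+ d)) refl (f x) (g x) (∑ xs f) (∑ xs g))

  ∑-*ˡ : ∀ c (xs : List A) f → ∑ xs (λ x → c * f x) ≡ c * ∑ xs f
  ∑-*ˡ c []       f = sym (ℚP.*-zeroʳ c)
  ∑-*ˡ c (x ∷ xs) f = ≡.trans (cong (_+_ (c * f x)) (∑-*ˡ c xs f)) (sym (ℚP.*-distribˡ-+ c (f x) (∑ xs f)))

  ∑-*ʳ : ∀ c (xs : List A) f → ∑ xs (λ x → f x * c) ≡ ∑ xs f * c
  ∑-*ʳ c xs f = ≡.trans (∑-cong xs (λ {x} _ → ℚP.*-comm (f x) c)) (≡.trans (∑-*ˡ c xs f) (ℚP.*-comm c (∑ xs f)))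

  ∑-↭ : ∀ {xs ys : List A} → xs ↭ ys → ∀ f → ∑ xs f ≡ ∑ ys f
  ∑-↭ refl           f = refl
  ∑-↭ (prep x p)     f = cong (_+_ (f x)) (∑-↭ p f)
  ∑-↭ (swap {xs} {ys} x y p) f = ≡.trans (cong (λ s → f x + (f y + s)) (∑-↭ p f))
    (solve 3 (λ a b c → a :+ (b :+ c) := b :+ (a :+ c)) refl (f x) (f y) (∑ ys f))
  ∑-↭ (trans p q)    f = ≡.trans (∑-↭ p f) (∑-↭ q f)

  ∑-filterᵇ : ∀ (P : A → Bool) xs f → ∑ (filterᵇ P xs) f ≡ ∑[ x ∈ xs ] (𝟙 (P x) * f x)
  ∑-filterᵇ P []       f = refl
  ∑-filterᵇ P (x ∷ xs) f with P x
  ... | true  = cong₂ _+_ (sym (ℚP.*-identityˡ (f x))) (∑-filterᵇ P xs f)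
  ... | false = ≡.trans (∑-filterᵇ P xs f) (sym (≡.trans (cong (_+ _) (ℚP.*-zeroˡ (f x))) (ℚP.+-identityˡ _)))

  ι-length-filterᵇ : ∀ (P : A → Bool) xs → ι (length (filterᵇ P xs)) ≡ ∑[ x ∈ xs ] 𝟙 (P x)
  ι-length-filterᵇ P xs = ≡.trans (sym (∑-one (filterᵇ P xs))) (≡.trans (∑-filterᵇ P xs (λ _ → 1ℚ))
    (∑-cong xs (λ {x} _ → ℚP.*-identityʳ (𝟙 (P x)))))

∑-map : ∀ {A B : Set} (g : A → B) xs f → ∑ (map g xs) f ≡ ∑ xs (f ∘ g)
∑-map g []       f = refl
∑-map g (x ∷ xs) f = cong (_+_ (f (g x))) (∑-map g xs f)

∑-concatMap : ∀ {A B : Set} (g : A → List B) xs f → ∑ (concatMap g xs) f ≡ ∑[ x ∈ xs ] ∑ (g x) f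
∑-concatMap g []       f = refl
∑-concatMap g (x ∷ xs) f = ≡.trans (∑-++ (g x) (concatMap g xs) f) (cong (_+_ (∑ (g x) f)) (∑-concatMap g xs f))

∑-swap : ∀ {A B : Set} (xs : List A) (ys : List B) (f : A → B → ℚ) →
  ∑[ x ∈ xs ] ∑[ y ∈ ys ] f x y ≡ ∑[ y ∈ ys ] ∑[ x ∈ xs ] f x y
∑-swap []       ys f = sym (∑-zero ys)
∑-swap (x ∷ xs) ys f = ≡.trans (cong (_+_ (∑ ys (f x))) (∑-swap xs ys f)) (sym (∑-+ ys (f x) _))

-- Choosing one entry of a list; permutations by their first entry

picks-↭ : ∀ {A : Set} {xs : List A} {p} → p ∈ picks xs → xs ↭ proj₁ p ∷ proj₂ p
picks-↭ {xs = x ∷ xs} (here refl) = ↭-refl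
picks-↭ {xs = x ∷ xs} (there p∈) with ∈-map⁻ _ p∈
... | (y , r) , q∈ , refl = trans (prep x (picks-↭ q∈)) (swap x y ↭-refl)

∑-picks-proj₁ : ∀ {A : Set} (xs : List A) f → ∑[ p ∈ picks xs ] f (proj₁ p) ≡ ∑ xs f
∑-picks-proj₁ []       f = refl
∑-picks-proj₁ (x ∷ xs) f = cong (_+_ (f x)) (≡.trans (∑-map _ (picks xs) _) (∑-picks-proj₁ xs f))

-- afterHead sums the insertions of x other than the one at the front; as a function of the
-- permutation of the tail it falls under the induction hypothesis.
module _ {A : Set} where

  afterHead : A → (List A → ℚ) → List A → ℚ
  afterHead x G []       = 0ℚ
  afterHead x G (y ∷ ys) = ∑[ σ ∈ insertions x ys ] G (y ∷ σ)

  ∑-insertions : ∀ x ys (G : List A → ℚ) → ∑ (insertions x ys) G ≡ G (x ∷ ys) + afterHead x G ys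
  ∑-insertions x []       G = refl
  ∑-insertions x (y ∷ ys) G = cong (_+_ (G (x ∷ y ∷ ys))) (∑-map (y ∷_) (insertions x ys) G)

  ∑-perms-pick : ∀ x xs (G : List A → ℚ) →
    ∑ (perms (x ∷ xs)) G ≡ ∑[ p ∈ picks (x ∷ xs) ] ∑[ σ ∈ perms (proj₂ p) ] G (proj₁ p ∷ σ)
  ∑-afterHead : ∀ x xs (G : List A → ℚ) →
    ∑ (perms xs) (afterHead x G) ≡ ∑[ p ∈ picks xs ] ∑[ σ ∈ perms (x ∷ proj₂ p) ] G (proj₁ p ∷ σ)

  ∑-perms-pick x xs G = begin
    ∑ (perms (x ∷ xs)) G
      ≡⟨ ∑-concatMap (insertions x) (perms xs) G ⟩
    ∑[ τ ∈ perms xs ] ∑ (insertions x τ) G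
      ≡⟨ ∑-cong (perms xs) (λ {τ} _ → ∑-insertions x τ G) ⟩
    ∑[ τ ∈ perms xs ] (G (x ∷ τ) + afterHead x G τ)
      ≡⟨ ∑-+ (perms xs) _ _ ⟩
    ∑[ τ ∈ perms xs ] G (x ∷ τ) + ∑ (perms xs) (afterHead x G)
      ≡⟨ cong (_+_ (∑[ τ ∈ perms xs ] G (x ∷ τ))) (∑-afterHead x xs G) ⟩
    ∑[ τ ∈ perms xs ] G (x ∷ τ) + ∑[ p ∈ picks xs ] ∑[ σ ∈ perms (x ∷ proj₂ p) ] G (proj₁ p ∷ σ)
      ≡⟨ cong (_+_ (∑[ τ ∈ perms xs ] G (x ∷ τ))) (∑-map _ (picks xs) _) ⟨
    ∑[ p ∈ picks (x ∷ xs) ] ∑[ σ ∈ perms (proj₂ p) ] G (proj₁ p ∷ σ) ∎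

  ∑-afterHead x []       G = refl
  ∑-afterHead x (y ∷ ys) G = begin
    ∑ (perms (y ∷ ys)) (afterHead x G)
      ≡⟨ ∑-perms-pick y ys (afterHead x G) ⟩
    ∑[ p ∈ picks (y ∷ ys) ] ∑[ τ ∈ perms (proj₂ p) ] ∑[ σ ∈ insertions x τ ] G (proj₁ p ∷ σ)
      ≡⟨ ∑-cong (picks (y ∷ ys)) (λ {p} _ → sym (∑-concatMap (insertions x) (perms (proj₂ p)) _)) ⟩
    ∑[ p ∈ picks (y ∷ ys) ] ∑[ σ ∈ perms (x ∷ proj₂ p) ] G (proj₁ p ∷ σ) ∎

-- The empty list is an exception, since `perms []` has one entry and `picks []` none. Nonemptiness
-- is expressed by the length because the recursions on `n` meet lists that are not literally of the
-- form `x ∷ xs`.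
∑-perms-picks : ∀ {A : Set} xs {n} → length xs ≡ suc n → ∀ (G : List A → ℚ) →
  ∑ (perms xs) G ≡ ∑[ p ∈ picks xs ] ∑[ σ ∈ perms (proj₂ p) ] G (proj₁ p ∷ σ)
∑-perms-picks (x ∷ xs) len = ∑-perms-pick x xs

-- Booleans, filters and lists without repetition

bool-ext : ∀ {b c} → (b ≡ true → c ≡ true) → (c ≡ true → b ≡ true) → b ≡ c
bool-ext {true}  {c}     f g = sym (f refl)
bool-ext {false} {true}  f g = g refl
bool-ext {false} {false} f g = refl

≢true⇒false : ∀ {b} → ¬ (b ≡ true) → b ≡ false
≢true⇒false = BoolP.¬-not

∨-true⁻ : ∀ b {c} → b ∨ c ≡ true → b ≡ true ⊎ c ≡ true
∨-true⁻ true  _ = inj₁ refl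
∨-true⁻ false p = inj₂ p

T⇒≡true : ∀ {b} → Data.Bool.T b → b ≡ true
T⇒≡true {true} _ = refl

≡true⇒T : ∀ {b} → b ≡ true → Data.Bool.T b
≡true⇒T refl = _

module _ {A : Set} (P : A → Bool) where

  ∈-filterᵇ⁺ : ∀ {x xs} → x ∈ xs → P x ≡ true → x ∈ filterᵇ P xs
  ∈-filterᵇ⁺ x∈ px = ∈-filter⁺ (BoolP.T? ∘ P) x∈ (≡true⇒T px)

  ∈-filterᵇ⁻ : ∀ {x} xs → x ∈ filterᵇ P xs → x ∈ xs × P x ≡ true
  ∈-filterᵇ⁻ xs x∈ with ∈-filter⁻ (BoolP.T? ∘ P) {xs = xs} x∈
  ... | x∈xs , px = x∈xs , T⇒≡true px

  filterᵇ-all : ∀ xs → (∀ {x} → x ∈ xs → P x ≡ true) → filterᵇ P xs ≡ xs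
  filterᵇ-all xs f = ListP.filter-all (BoolP.T? ∘ P) (All.tabulate (≡true⇒T ∘ f))

  filterᵇ-none : ∀ xs → (∀ {x} → x ∈ xs → P x ≡ false) → filterᵇ P xs ≡ []
  filterᵇ-none xs f = ListP.filter-none (BoolP.T? ∘ P)
    (All.tabulate (λ x∈ px → contradiction (≡.trans (sym (T⇒≡true px)) (f x∈)) (λ ())))

  filterᵇ-++ : ∀ xs ys → filterᵇ P (xs ++ ys) ≡ filterᵇ P xs ++ filterᵇ P ys
  filterᵇ-++ = ListP.filter-++ (BoolP.T? ∘ P)

  filterᵇ-accept : ∀ {x} xs → P x ≡ true → filterᵇ P (x ∷ xs) ≡ x ∷ filterᵇ P xs
  filterᵇ-accept xs px rewrite px = refl

  filterᵇ-reject : ∀ {x} xs → P x ≡ false → filterᵇ P (x ∷ xs) ≡ filterᵇ P xs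
  filterᵇ-reject xs px rewrite px = refl

  filterᵇ-unique : ∀ {xs} → Unique xs → Unique (filterᵇ P xs)
  filterᵇ-unique = UniqueP.filter⁺ (BoolP.T? ∘ P)

filterᵇ-cong : ∀ {A : Set} {P Q : A → Bool} xs → (∀ {x} → x ∈ xs → P x ≡ Q x) → filterᵇ P xs ≡ filterᵇ Q xs
filterᵇ-cong []       eq = refl
filterᵇ-cong {P = P} {Q} (x ∷ xs) eq with P x | Q x | eq (here refl)
... | true  | .true  | refl = cong (x ∷_) (filterᵇ-cong xs (eq ∘ there))
... | false | .false | refl = filterᵇ-cong xs (eq ∘ there)

filterᵇ-∧ : ∀ {A : Set} (P Q : A → Bool) xs → filterᵇ (λ x → P x ∧ Q x) xs ≡ filterᵇ P (filterᵇ Q xs)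
filterᵇ-∧ P Q []       = refl
filterᵇ-∧ P Q (x ∷ xs) with Q x
... | false rewrite BoolP.∧-zeroʳ (P x) = filterᵇ-∧ P Q xs
... | true with P x
...   | true  = cong (x ∷_) (filterᵇ-∧ P Q xs)
...   | false = filterᵇ-∧ P Q xs

Unique-resp-↭ : ∀ {A : Set} {xs ys : List A} → xs ↭ ys → Unique xs → Unique ys
Unique-resp-↭ refl         u         = u
Unique-resp-↭ (prep x p)   (x∉ ∷ u)  = ↭P.All-resp-↭ p x∉ ∷ Unique-resp-↭ p u
Unique-resp-↭ (swap x y p) ((x≢y ∷ x∉) ∷ y∉ ∷ u) =
  ((λ y≡x → x≢y (sym y≡x)) ∷ ↭P.All-resp-↭ p y∉) ∷ ↭P.All-resp-↭ p x∉ ∷ Unique-resp-↭ p u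
Unique-resp-↭ (trans p q)  u         = Unique-resp-↭ q (Unique-resp-↭ p u)

Unique-head : ∀ {A : Set} {x : A} {xs} → Unique (x ∷ xs) → x ∉ xs
Unique-head = UniqueP.Unique[x∷xs]⇒x∉xs

∑-𝟙-unique : ∀ {A : Set} (P : A → Bool) {xs x₀} → Unique xs → x₀ ∈ xs → P x₀ ≡ true →
  (∀ {x} → x ∈ xs → P x ≡ true → x ≡ x₀) → ∑[ x ∈ xs ] 𝟙 (P x) ≡ 1ℚ
∑-𝟙-unique P {x₀ ∷ xs} u@(_ ∷ _) (here refl) px₀ only = begin
  𝟙 (P x₀) + ∑[ x ∈ xs ] 𝟙 (P x)  ≡⟨ cong₂ _+_ (cong 𝟙 px₀) (∑-cong xs others) ⟩
  1ℚ + ∑[ x ∈ xs ] 0ℚ             ≡⟨ cong (_+_ 1ℚ) (∑-zero xs) ⟩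
  1ℚ + 0ℚ                         ≡⟨ ℚP.+-identityʳ 1ℚ ⟩
  1ℚ                              ∎
  where
  others : ∀ {x} → x ∈ xs → 𝟙 (P x) ≡ 0ℚ
  others x∈ = cong 𝟙 (≢true⇒false (λ px → Unique-head u (subst (_∈ xs) (only (there x∈) px) x∈)))
∑-𝟙-unique P {y ∷ xs} {x₀} u@(_ ∷ uxs) (there x₀∈) px₀ only =
  ≡.trans (cong₂ _+_ (cong 𝟙 (≢true⇒false (λ py → Unique-head u (subst (_∈ xs) (sym (only (here refl) py)) x₀∈))))
                   (∑-𝟙-unique P uxs x₀∈ px₀ (only ∘ there)))
          (ℚP.+-identityˡ 1ℚ)

-- Addresses and the ancestor order

==ₐ⇒≡ : ∀ {a b} → a ==ₐ b ≡ true → a ≡ b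
==ₐ⇒≡ {a} {b} eq with ListP.≡-dec ℕ._≟_ a b
... | yes p = p

==ₐ-refl : ∀ a → a ==ₐ a ≡ true
==ₐ-refl a with ListP.≡-dec ℕ._≟_ a a
... | yes _ = refl
... | no ¬p = contradiction refl ¬p

≢⇒==ₐ-false : ∀ {a b} → a ≢ b → a ==ₐ b ≡ false
≢⇒==ₐ-false a≢b = ≢true⇒false (a≢b ∘ ==ₐ⇒≡)

any-==⁻ : ∀ {b} xs → any (λ a → a ==ₐ b) xs ≡ true → b ∈ xs
any-==⁻ {b} (x ∷ xs) eq with ∨-true⁻ (x ==ₐ b) eq
... | inj₁ x≡b = here (sym (==ₐ⇒≡ x≡b))
... | inj₂ r   = there (any-==⁻ xs r)

any-==⁺ : ∀ {b xs} → b ∈ xs → any (λ a → a ==ₐ b) xs ≡ true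
any-==⁺ {b} (here refl) rewrite ==ₐ-refl b = refl
any-==⁺ {b} {x ∷ xs} (there b∈) rewrite any-==⁺ b∈ = BoolP.∨-zeroʳ (x ==ₐ b)

infix 4 _⊑_
-- Addresses are read from the vertex upwards, so the ancestors of a vertex, itself included, are
-- the suffixes of its address. This is the inductive counterpart of the Boolean `strictAnc`.
data _⊑_ (u : Addr) : Addr → Set where
  ⊑-refl : u ⊑ u
  ⊑-step : ∀ {i w} → u ⊑ w → u ⊑ i ∷ w

⊑-trans : ∀ {u v w} → u ⊑ v → v ⊑ w → u ⊑ w
⊑-trans p ⊑-refl     = p
⊑-trans p (⊑-step q) = ⊑-step (⊑-trans p q)

⊑-length : ∀ {u w} → u ⊑ w → length u ℕ.≤ length w
⊑-length ⊑-refl     = ℕP.≤-refl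
⊑-length (⊑-step p) = ℕP.m≤n⇒m≤1+n (⊑-length p)

child⋢ : ∀ {i u} → ¬ (i ∷ u ⊑ u)
child⋢ p = ℕP.<-irrefl refl (⊑-length p)

⊑-parent : ∀ {i u w} → i ∷ u ⊑ w → u ⊑ w
⊑-parent = ⊑-trans (⊑-step ⊑-refl)

-- Two suffixes of one list are nested. This is where it matters that the order is a forest: the
-- ancestors of a vertex form a chain.
⊑-comparable : ∀ {u v w} → u ⊑ w → v ⊑ w → u ⊑ v ⊎ v ⊑ u
⊑-comparable ⊑-refl       q          = inj₂ q
⊑-comparable p@(⊑-step _) ⊑-refl     = inj₁ p
⊑-comparable (⊑-step p)   (⊑-step q) = ⊑-comparable p q

siblings-≡ : ∀ {i j p w} → i ∷ p ⊑ w → j ∷ p ⊑ w → i ≡ j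
siblings-≡ a b with ⊑-comparable a b
... | inj₁ ⊑-refl     = refl
... | inj₁ (⊑-step c) = contradiction c child⋢
... | inj₂ ⊑-refl     = refl
... | inj₂ (⊑-step c) = contradiction c child⋢

strictAnc⁻ : ∀ {u i w} → strictAnc u (i ∷ w) ≡ true → u ⊑ w
strictAnc⁻ {u} {i} {w} eq with ∨-true⁻ (u ==ₐ w) {strictAnc u w} eq
strictAnc⁻ {u} {i} {w}     eq | inj₁ u≡w rewrite ==ₐ⇒≡ {u} {w} u≡w = ⊑-refl
strictAnc⁻ {u} {i} {j ∷ w} eq | inj₂ r = ⊑-step (strictAnc⁻ {i = j} r)

strictAnc⁺ : ∀ {u i w} → u ⊑ w → strictAnc u (i ∷ w) ≡ true
strictAnc⁺ {u} ⊑-refl rewrite ==ₐ-refl u = refl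
strictAnc⁺ {u} {i} (⊑-step {j} {w} p) rewrite strictAnc⁺ {u} {j} p = BoolP.∨-zeroʳ (u ==ₐ (j ∷ w))

strictAnc⇒⊑ : ∀ {u} w → strictAnc u w ≡ true → u ⊑ w
strictAnc⇒⊑ (i ∷ w) eq = ⊑-step (strictAnc⁻ {i = i} eq)

-- Hook length formula for sets of addresses

-- The strict ancestors of a child of `w` are `w` and its own ancestors. The child need not exist
-- and its index 0 is arbitrary.
anc : Addr → Addr → Bool
anc u w = strictAnc u (0 ∷ w)

-- The vertices in seen have been numbered and those of V are left.
record Front (seen V : List Addr) : Set where
  field
    unique   : Unique V
    nonempty : [] ∉ V
    disjoint : ∀ {v} → v ∈ V → v ∉ seen
    downward : ∀ {i j p} → i ∷ j ∷ p ∈ seen → j ∷ p ∈ seen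
    covered  : ∀ {i j p} → i ∷ j ∷ p ∈ V → j ∷ p ∈ seen ⊎ j ∷ p ∈ V

open Front

seen-down : ∀ {seen V u w} → Front seen V → u ≢ [] → u ⊑ w → w ∈ seen → u ∈ seen
seen-down fr u≢[] ⊑-refl                    w∈ = w∈
seen-down {u = []} fr u≢[] (⊑-step p)       w∈ = contradiction refl u≢[]
seen-down {u = _ ∷ _} fr u≢[] (⊑-step {w = j ∷ w} p) w∈ = seen-down fr u≢[] p (downward fr w∈)

-- A strict ancestor `u` of `v` lies at or above the parent of `v`, which is already numbered. The
-- numbered vertices are closed under parents, so `u` would be numbered as well.
no-available-below : ∀ {seen V u v} → Front seen V → u ∈ V → parentBefore seen v ≡ true →
  u ⊑ v → u ≡ v
no-available-below fr u∈ av ⊑-refl = refl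
no-available-below fr u∈ av (⊑-step {w = []} ⊑-refl) = contradiction u∈ (nonempty fr)
no-available-below {seen} fr u∈ av (⊑-step {w = j ∷ p} q) =
  contradiction (seen-down fr (λ { refl → nonempty fr u∈ }) q (any-==⁻ seen av)) (disjoint fr u∈)

-- Climb from `w` until the parent is numbered or a root, an address of length one, is reached; by
-- `covered` the climb does not leave `V`.
available-above : ∀ {seen V} → Front seen V → ∀ w → w ∈ V →
  ∃[ v ] (v ∈ V × parentBefore seen v ≡ true × v ⊑ w)
available-above fr []      w∈ = contradiction w∈ (nonempty fr)
available-above fr (i ∷ []) w∈ = i ∷ [] , w∈ , refl , ⊑-refl
available-above {seen} {V} fr (i ∷ j ∷ p) w∈ =
  [ (λ s∈ → i ∷ j ∷ p , w∈ , any-==⁺ s∈ , ⊑-refl)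
  , (λ p∈ → descend (available-above fr (j ∷ p) p∈)) ] (covered fr w∈)
  where
  descend : ∃[ v ] (v ∈ V × parentBefore seen v ≡ true × v ⊑ j ∷ p) →
            ∃[ v ] (v ∈ V × parentBefore seen v ≡ true × v ⊑ i ∷ j ∷ p)
  descend (v , v∈ , av , v⊑) = v , v∈ , av , ⊑-step v⊑

-- Two available vertices above `w` are comparable, and an available vertex lies strictly below no
-- unnumbered one, so they coincide.
∑-available-above : ∀ {seen V} → Front seen V → ∀ {w} → w ∈ V →
  ∑[ v ∈ V ] 𝟙 (parentBefore seen v ∧ anc v w) ≡ 1ℚ
∑-available-above {seen} {V} fr {w} w∈ with available-above fr w w∈
... | v₀ , v₀∈ , av₀ , v₀⊑ = ∑-𝟙-unique _ (unique fr) v₀∈ (cong₂ _∧_ av₀ (strictAnc⁺ {i = 0} v₀⊑)) only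
  where
  only : ∀ {v} → v ∈ V → parentBefore seen v ∧ anc v w ≡ true → v ≡ v₀
  only {v} v∈ eq with ⊑-comparable (strictAnc⁻ {i = 0} (BoolP.∧-conicalʳ (parentBefore seen v) _ eq)) v₀⊑
  ... | inj₁ v⊑v₀ = no-available-below fr v∈ av₀ v⊑v₀
  ... | inj₂ v₀⊑v = sym (no-available-below fr v₀∈ (BoolP.∧-conicalˡ _ _ eq) v₀⊑v)

Front-step : ∀ {seen V v rest} → Front seen V → V ↭ v ∷ rest → parentBefore seen v ≡ true →
  Front (v ∷ seen) rest
Front-step {seen} {V} {v} {rest} fr V↭ av = record
  { unique   = tail-unique (Unique-resp-↭ V↭ (unique fr))
  ; nonempty = nonempty fr ∘ back
  ; disjoint = λ { {u} u∈ (here refl) → Unique-head (Unique-resp-↭ V↭ (unique fr)) u∈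
                 ; u∈ (there s∈) → disjoint fr (back u∈) s∈ }
  ; downward = downward′ av
  ; covered  = covered′
  }
  where
  back : ∀ {u} → u ∈ rest → u ∈ V
  back u∈ = ↭P.∈-resp-↭ (↭-sym V↭) (there u∈)
  tail-unique : ∀ {x xs} → Unique {A = Addr} (x ∷ xs) → Unique xs
  tail-unique (_ ∷ u) = u
  downward′ : ∀ {v} → parentBefore seen v ≡ true → ∀ {i j p} → i ∷ j ∷ p ∈ v ∷ seen → j ∷ p ∈ v ∷ seen
  downward′ av (here refl) = there (any-==⁻ seen av)
  downward′ av (there s∈)  = there (downward fr s∈)
  covered′ : ∀ {i j p} → i ∷ j ∷ p ∈ rest → j ∷ p ∈ v ∷ seen ⊎ j ∷ p ∈ rest
  covered′ w∈ with covered fr (back w∈)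
  ... | inj₁ s∈ = inj₁ (there s∈)
  ... | inj₂ p∈ with ↭P.∈-resp-↭ V↭ p∈
  ...   | here refl = inj₁ (here refl)
  ...   | there r∈  = inj₂ r∈

∏ : List Addr → (Addr → ℚ) → ℚ
∏ []       h = 1ℚ
∏ (v ∷ vs) h = h v * ∏ vs h

∏-++ : ∀ us vs h → ∏ (us ++ vs) h ≡ ∏ us h * ∏ vs h
∏-++ []       vs h = sym (ℚP.*-identityˡ _)
∏-++ (u ∷ us) vs h = ≡.trans (cong (_*_ (h u)) (∏-++ us vs h)) (sym (ℚP.*-assoc (h u) _ _))

∏-↭ : ∀ {us vs} → us ↭ vs → ∀ h → ∏ us h ≡ ∏ vs h
∏-↭ refl          h = refl
∏-↭ (prep x p)    h = cong (_*_ (h x)) (∏-↭ p h)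
∏-↭ (swap {us} {vs} x y p) h = ≡.trans (cong (λ s → h x * (h y * s)) (∏-↭ p h))
  (solve 3 (λ a b c → a :* (b :* c) := b :* (a :* c)) refl (h x) (h y) (∏ vs h))
∏-↭ (trans p q)   h = ≡.trans (∏-↭ p h) (∏-↭ q h)

-- Hook length formula, by the choice of the vertex numbered first: it is a minimal
-- element v of V, and the hooks of the minimal elements partition V.
hook-formula-from : ∀ n {seen V} (h : Addr → ℚ) → length V ≡ n → Front seen V →
  (∀ {v} → v ∈ V → h v ≡ ∑[ w ∈ V ] 𝟙 (anc v w)) →
  ∑[ σ ∈ perms V ] 𝟙 (increasing seen σ) * ∏ V h ≡ ι (n !)
hook-formula-from zero    {V = []}    h len fr hook = sym ι-1
hook-formula-from (suc n) {seen} {V} h len fr hook = begin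
  ∑[ σ ∈ perms V ] 𝟙 (increasing seen σ) * ∏ V h
    ≡⟨ cong (_* ∏ V h) (∑-perms-picks V len _) ⟩
  ∑[ p ∈ picks V ] ∑[ σ ∈ perms (proj₂ p) ] 𝟙 (parentBefore seen (proj₁ p) ∧ increasing (proj₁ p ∷ seen) σ) * ∏ V h
    ≡⟨ ∑-*ʳ (∏ V h) (picks V) _ ⟨
  ∑[ p ∈ picks V ] (∑[ σ ∈ perms (proj₂ p) ] 𝟙 (parentBefore seen (proj₁ p) ∧ increasing (proj₁ p ∷ seen) σ) * ∏ V h)
    ≡⟨ ∑-cong (picks V) first ⟩
  ∑[ p ∈ picks V ] (𝟙 (parentBefore seen (proj₁ p)) * h (proj₁ p) * ι (n !))
    ≡⟨ ∑-*ʳ (ι (n !)) (picks V) _ ⟩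
  ∑[ p ∈ picks V ] (𝟙 (parentBefore seen (proj₁ p)) * h (proj₁ p)) * ι (n !)
    ≡⟨ cong (_* ι (n !)) (∑-picks-proj₁ V _) ⟩
  ∑[ v ∈ V ] (𝟙 (parentBefore seen v) * h v) * ι (n !)
    ≡⟨ cong (_* ι (n !)) total ⟩
  ι (suc n) * ι (n !)
    ≡⟨ ι-* (suc n) (n !) ⟨
  ι (suc n !) ∎
  where
  first : ∀ {p} → p ∈ picks V →
    ∑[ σ ∈ perms (proj₂ p) ] 𝟙 (parentBefore seen (proj₁ p) ∧ increasing (proj₁ p ∷ seen) σ) * ∏ V h
      ≡ 𝟙 (parentBefore seen (proj₁ p)) * h (proj₁ p) * ι (n !)
  first {v , rest} p∈ with parentBefore seen v in av
  ... | false = begin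
    ∑[ σ ∈ perms rest ] 0ℚ * ∏ V h  ≡⟨ cong (_* ∏ V h) (∑-zero (perms rest)) ⟩
    0ℚ * ∏ V h                      ≡⟨ ℚP.*-zeroˡ (∏ V h) ⟩
    0ℚ                              ≡⟨ ℚP.*-zeroˡ (ι (n !)) ⟨
    0ℚ * ι (n !)                    ≡⟨ cong (_* ι (n !)) (ℚP.*-zeroˡ (h v)) ⟨
    0ℚ * h v * ι (n !)              ∎
  ... | true = begin
    E * ∏ V h              ≡⟨ cong (_*_ E) (∏-↭ V↭ h) ⟩
    E * (h v * ∏ rest h)   ≡⟨ solve 3 (λ a b c → a :* (b :* c) := con 1ℚ :* b :* (a :* c)) refl E (h v) (∏ rest h) ⟩
    1ℚ * h v * (E * ∏ rest h)
      ≡⟨ cong (1ℚ * h v *_) (hook-formula-from n h (ℕP.suc-injective (≡.trans (sym (↭P.↭-length V↭)) len)) (Front-step fr V↭ av) hook′) ⟩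
    1ℚ * h v * ι (n !)     ∎
    where
    E : ℚ
    E = ∑[ σ ∈ perms rest ] 𝟙 (increasing (v ∷ seen) σ)
    V↭ : V ↭ v ∷ rest
    V↭ = picks-↭ p∈
    v∈V : v ∈ V
    v∈V = ↭P.∈-resp-↭ (↭-sym V↭) (here refl)
    -- The available vertex `v` lies below no other vertex of `V`, so its removal does not change
    -- the remaining hooks.
    hook′ : ∀ {u} → u ∈ rest → h u ≡ ∑[ w ∈ rest ] 𝟙 (anc u w)
    hook′ {u} u∈ = begin
      h u                                    ≡⟨ hook u∈V ⟩
      ∑[ w ∈ V ] 𝟙 (anc u w)                 ≡⟨ ∑-↭ V↭ _ ⟩
      𝟙 (anc u v) + ∑[ w ∈ rest ] 𝟙 (anc u w) ≡⟨ cong (λ b → 𝟙 b + _) u⋢v ⟩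
      0ℚ + ∑[ w ∈ rest ] 𝟙 (anc u w)         ≡⟨ ℚP.+-identityˡ _ ⟩
      ∑[ w ∈ rest ] 𝟙 (anc u w)              ∎
      where
      u∈V : u ∈ V
      u∈V = ↭P.∈-resp-↭ (↭-sym V↭) (there u∈)
      u⋢v : anc u v ≡ false
      u⋢v = ≢true⇒false (λ eq → Unique-head (Unique-resp-↭ V↭ (unique fr))
        (subst (_∈ rest) (no-available-below fr u∈V av (strictAnc⁻ {i = 0} eq)) u∈))
  total : ∑[ v ∈ V ] (𝟙 (parentBefore seen v) * h v) ≡ ι (suc n)
  total = begin
    ∑[ v ∈ V ] (𝟙 (parentBefore seen v) * h v)
      ≡⟨ ∑-cong V (λ {v} v∈ → ≡.trans (cong (𝟙 (parentBefore seen v) *_) (hook v∈))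
           (≡.trans (sym (∑-*ˡ (𝟙 (parentBefore seen v)) V _)) (∑-cong V (λ {w} _ → sym (𝟙-∧ (parentBefore seen v) (anc v w)))))) ⟩
    ∑[ v ∈ V ] ∑[ w ∈ V ] 𝟙 (parentBefore seen v ∧ anc v w)
      ≡⟨ ∑-swap V V _ ⟩
    ∑[ w ∈ V ] ∑[ v ∈ V ] 𝟙 (parentBefore seen v ∧ anc v w)
      ≡⟨ ∑-cong V (∑-available-above fr) ⟩
    ∑[ w ∈ V ] 1ℚ
      ≡⟨ ∑-one V ⟩
    ι (length V)
      ≡⟨ cong ι len ⟩
    ι (suc n) ∎

-- Addresses of the vertices of a tree and products of hooks

∈-addrsL : ∀ {k} p i (ts : List (LTree k)) {w} → w ∈ addrsL p i ts → ∃[ j ] (i ℕ.≤ j × j ∷ p ⊑ w)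
∈-addrsL p i (node a cs ∷ ts) (here refl) = i , ℕP.≤-refl , ⊑-refl
∈-addrsL p i (node a cs ∷ ts) (there w∈) with ∈-++⁻ (addrsL (i ∷ p) 0 cs) w∈
... | inj₁ w∈cs with ∈-addrsL (i ∷ p) 0 cs w∈cs
...   | _ , _ , q = i , ℕP.≤-refl , ⊑-parent q
∈-addrsL p i (node a cs ∷ ts) (there w∈) | inj₂ w∈ts with ∈-addrsL p (suc i) ts w∈ts
...   | j , i<j , q = j , ℕP.<⇒≤ i<j , q

∈-children⇒strict : ∀ {k} p (ts : List (LTree k)) {w} → w ∈ addrsL p 0 ts → strictAnc p w ≡ true
∈-children⇒strict p ts {w} w∈ with ∈-addrsL p 0 ts w∈
... | j , _ , q = strict q
  where
  strict : ∀ {w} → j ∷ p ⊑ w → strictAnc p w ≡ true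
  strict ⊑-refl         = strictAnc⁺ {p} {j} ⊑-refl
  strict (⊑-step {i} q) = strictAnc⁺ {i = i} (⊑-parent q)

¬strict-below : ∀ {v u} → v ⊑ u → strictAnc u v ≡ false
¬strict-below {[]}    q = refl
¬strict-below {i ∷ v} q = ≢true⇒false (λ eq → child⋢ (⊑-trans q (strictAnc⁻ {i = i} eq)))

∈-siblings⇒¬strict : ∀ {k} {p i u} (ts : List (LTree k)) {w} → i ∷ p ⊑ u →
  w ∈ addrsL p (suc i) ts → strictAnc u w ≡ false
∈-siblings⇒¬strict {p = p} {i} ts {w} q w∈ with ∈-addrsL p (suc i) ts w∈
... | j , i<j , r = ≢true⇒false (λ eq → ℕP.<⇒≢ i<j (siblings-≡ (⊑-trans q (strictAnc⇒⊑ w eq)) r))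

Under : Addr → ℕ → Addr → Set
Under p i u = ∃[ j ] (i ℕ.≤ j × j ∷ p ⊑ u)

Under⇒¬strict : ∀ {p i u w} → Under p (suc i) u → i ∷ p ⊑ w → strictAnc u w ≡ false
Under⇒¬strict {w = w} (j , i<j , r) q =
  ≢true⇒false (λ eq → ℕP.<⇒≢ i<j (siblings-≡ q (⊑-trans r (strictAnc⇒⊑ w eq))))

-- V contains all the vertices of ts (placed at the children i, i+1, … of p)
-- and no further descendant of any of them.
record Located {k} (V : List Addr) (p : Addr) (i : ℕ) (ts : List (LTree k)) : Set where
  constructor located
  field
    locate : ∀ {u} → Under p i u → filterᵇ (strictAnc u) V ≡ filterᵇ (strictAnc u) (addrsL p i ts)

open Located

module _ {k : ℕ} {V : List Addr} {p : Addr} {i : ℕ} {a : Fin k} {cs ts : List (LTree k)}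
         (loc : Located V p i (node a cs ∷ ts)) where

  private
    v = i ∷ p

  below-self : ∀ {u} → v ⊑ u →
    filterᵇ (strictAnc u) V ≡ filterᵇ (strictAnc u) (addrsL v 0 cs)
  below-self {u} q = begin
    filterᵇ (strictAnc u) V
      ≡⟨ locate loc (i , ℕP.≤-refl , q) ⟩
    filterᵇ (strictAnc u) (v ∷ addrsL v 0 cs ++ addrsL p (suc i) ts)
      ≡⟨ filterᵇ-reject (strictAnc u) _ (¬strict-below q) ⟩
    filterᵇ (strictAnc u) (addrsL v 0 cs ++ addrsL p (suc i) ts)
      ≡⟨ filterᵇ-++ (strictAnc u) (addrsL v 0 cs) _ ⟩
    filterᵇ (strictAnc u) (addrsL v 0 cs) ++ filterᵇ (strictAnc u) (addrsL p (suc i) ts)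
      ≡⟨ cong (filterᵇ (strictAnc u) (addrsL v 0 cs) ++_) (filterᵇ-none (strictAnc u) _ (∈-siblings⇒¬strict ts q)) ⟩
    filterᵇ (strictAnc u) (addrsL v 0 cs) ++ []
      ≡⟨ ListP.++-identityʳ _ ⟩
    filterᵇ (strictAnc u) (addrsL v 0 cs) ∎

  located-descendants : filterᵇ (strictAnc v) V ≡ addrsL v 0 cs
  located-descendants = ≡.trans (below-self ⊑-refl) (filterᵇ-all (strictAnc v) _ (∈-children⇒strict v cs))

  located-children : Located V v 0 cs
  located-children = located (λ { (_ , _ , q) → below-self (⊑-parent q) })

  located-siblings : Located V p (suc i) ts
  located-siblings = located beside-self
    where
    beside-self : ∀ {u} → Under p (suc i) u → filterᵇ (strictAnc u) V ≡ filterᵇ (strictAnc u) (addrsL p (suc i) ts)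
    beside-self {u} un@(j , i<j , r) = begin
      filterᵇ (strictAnc u) V
        ≡⟨ locate loc (j , ℕP.<⇒≤ i<j , r) ⟩
      filterᵇ (strictAnc u) (v ∷ addrsL v 0 cs ++ addrsL p (suc i) ts)
        ≡⟨ filterᵇ-reject (strictAnc u) _ (Under⇒¬strict un ⊑-refl) ⟩
      filterᵇ (strictAnc u) (addrsL v 0 cs ++ addrsL p (suc i) ts)
        ≡⟨ filterᵇ-++ (strictAnc u) (addrsL v 0 cs) _ ⟩
      filterᵇ (strictAnc u) (addrsL v 0 cs) ++ filterᵇ (strictAnc u) (addrsL p (suc i) ts)
        ≡⟨ cong (_++ filterᵇ (strictAnc u) (addrsL p (suc i) ts)) (filterᵇ-none (strictAnc u) _ outside) ⟩
      filterᵇ (strictAnc u) (addrsL p (suc i) ts) ∎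
      where
      outside : ∀ {w} → w ∈ addrsL v 0 cs → strictAnc u w ≡ false
      outside w∈ with ∈-addrsL v 0 cs w∈
      ... | _ , _ , q = Under⇒¬strict un (⊑-parent q)

addrsL-unique : ∀ {k} p i (ts : List (LTree k)) → Unique (addrsL p i ts)
addrsL-unique p i [] = []
addrsL-unique p i (node a cs ∷ ts) =
  All.tabulate apart ∷ UniqueP.++⁺ (addrsL-unique (i ∷ p) 0 cs) (addrsL-unique p (suc i) ts) disj
  where
  below : ∀ {w} → w ∈ addrsL (i ∷ p) 0 cs → i ∷ p ⊑ w
  below w∈ with ∈-addrsL (i ∷ p) 0 cs w∈
  ... | _ , _ , q = ⊑-parent q
  beside : ∀ {w} → w ∈ addrsL p (suc i) ts → ¬ (i ∷ p ⊑ w)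
  beside w∈ q with ∈-addrsL p (suc i) ts w∈
  ... | j , i<j , r = ℕP.<⇒≢ i<j (siblings-≡ q r)
  disj : ∀ {w} → ¬ (w ∈ addrsL (i ∷ p) 0 cs × w ∈ addrsL p (suc i) ts)
  disj (w∈ , w∈′) = beside w∈′ (below w∈)
  apart : ∀ {w} → w ∈ addrsL (i ∷ p) 0 cs ++ addrsL p (suc i) ts → i ∷ p ≢ w
  apart w∈ refl with ∈-++⁻ (addrsL (i ∷ p) 0 cs) w∈
  ... | inj₂ w∈ts = beside w∈ts ⊑-refl
  ... | inj₁ w∈cs with ∈-addrsL (i ∷ p) 0 cs w∈cs
  ...   | _ , _ , q = child⋢ q

addrsL-parent : ∀ {k} p i (ts : List (LTree k)) {j w} → j ∷ w ∈ addrsL p i ts → w ≡ p ⊎ w ∈ addrsL p i ts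
addrsL-parent p i (node a cs ∷ ts) (here refl) = inj₁ refl
addrsL-parent p i (node a cs ∷ ts) (there w∈) with ∈-++⁻ (addrsL (i ∷ p) 0 cs) w∈
... | inj₁ w∈cs with addrsL-parent (i ∷ p) 0 cs w∈cs
...   | inj₁ refl = inj₂ (here refl)
...   | inj₂ q    = inj₂ (there (∈-++⁺ˡ q))
addrsL-parent p i (node a cs ∷ ts) (there w∈) | inj₂ w∈ts with addrsL-parent p (suc i) ts w∈ts
...   | inj₁ eq = inj₁ eq
...   | inj₂ q  = inj₂ (there (∈-++⁺ʳ (addrsL (i ∷ p) 0 cs) q))

length-addrsL : ∀ {k} p i (ts : List (LTree k)) → length (addrsL p i ts) ≡ sizeL ts
length-addrsL p i [] = refl
length-addrsL p i (node a cs ∷ ts) = cong suc (≡.trans (ListP.length-++ (addrsL (i ∷ p) 0 cs))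
  (cong₂ ℕ._+_ (length-addrsL (i ∷ p) 0 cs) (length-addrsL p (suc i) ts)))

hooksL : ∀ {k} → List (LTree k) → ℕ
hooksL []               = 1
hooksL (node a cs ∷ ts) = suc (sizeL cs) ℕ.* hooksL cs ℕ.* hooksL ts

hooksL-nonZero : ∀ {k} (ts : List (LTree k)) → ℕ.NonZero (hooksL ts)
hooksL-nonZero []               = _
hooksL-nonZero (node a cs ∷ ts) = ℕP.m*n≢0 (suc (sizeL cs) ℕ.* hooksL cs) (hooksL ts)
  {{ℕP.m*n≢0 (suc (sizeL cs)) (hooksL cs) {{_}} {{hooksL-nonZero cs}}}} {{hooksL-nonZero ts}}

hookLength : List Addr → Addr → ℚ
hookLength V v = ι (suc (length (filterᵇ (strictAnc v) V)))

-- Connects two descriptions of the hooks: counted in the whole list `V`, as the numbering argument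
-- uses them, and recursive in the tree, as the deletion of leaves uses them. `Located` allows a
-- count over `V` to be read off from the branch.
∏-hookLength : ∀ {k} V p i (ts : List (LTree k)) → Located V p i ts →
  ∏ (addrsL p i ts) (hookLength V) ≡ ι (hooksL ts)
∏-hookLength V p i [] loc = sym ι-1
∏-hookLength V p i (node a cs ∷ ts) loc = begin
  hookLength V v * ∏ (addrsL v 0 cs ++ addrsL p (suc i) ts) (hookLength V)
    ≡⟨ cong₂ _*_ (cong (λ n → ι (suc n)) (≡.trans (cong length (located-descendants loc)) (length-addrsL v 0 cs)))
         (≡.trans (∏-++ (addrsL v 0 cs) (addrsL p (suc i) ts) (hookLength V))
           (cong₂ _*_ (∏-hookLength V v 0 cs (located-children loc)) (∏-hookLength V p (suc i) ts (located-siblings loc)))) ⟩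
  ι (suc (sizeL cs)) * (ι (hooksL cs) * ι (hooksL ts))
    ≡⟨ ℚP.*-assoc (ι (suc (sizeL cs))) (ι (hooksL cs)) (ι (hooksL ts)) ⟨
  ι (suc (sizeL cs)) * ι (hooksL cs) * ι (hooksL ts)
    ≡⟨ cong (_* ι (hooksL ts)) (ι-* (suc (sizeL cs)) (hooksL cs)) ⟨
  ι (suc (sizeL cs) ℕ.* hooksL cs) * ι (hooksL ts)
    ≡⟨ ι-* (suc (sizeL cs) ℕ.* hooksL cs) (hooksL ts) ⟨
  ι (hooksL (node a cs ∷ ts)) ∎
  where
  v : Addr
  v = i ∷ p

hookLength-anc : ∀ {V v} → Unique V → v ∈ V → hookLength V v ≡ ∑[ w ∈ V ] 𝟙 (anc v w)
hookLength-anc {V} {v} uV v∈ = begin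
  ι (suc (length (filterᵇ (strictAnc v) V)))
    ≡⟨ ι-suc (length (filterᵇ (strictAnc v) V)) ⟩
  1ℚ + ι (length (filterᵇ (strictAnc v) V))
    ≡⟨ cong₂ _+_ (sym (∑-𝟙-unique (v ==ₐ_) uV v∈ (==ₐ-refl v) (λ _ eq → sym (==ₐ⇒≡ eq)))) (ι-length-filterᵇ (strictAnc v) V) ⟩
  ∑[ w ∈ V ] 𝟙 (v ==ₐ w) + ∑[ w ∈ V ] 𝟙 (strictAnc v w)
    ≡⟨ ∑-+ V (λ w → 𝟙 (v ==ₐ w)) (λ w → 𝟙 (strictAnc v w)) ⟨
  ∑[ w ∈ V ] (𝟙 (v ==ₐ w) + 𝟙 (strictAnc v w))
    ≡⟨ ∑-cong V (λ {w} _ → split w) ⟩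
  ∑[ w ∈ V ] 𝟙 (anc v w) ∎
  where
  split : ∀ w → 𝟙 (v ==ₐ w) + 𝟙 (strictAnc v w) ≡ 𝟙 (anc v w)
  split w with v ==ₐ w in eq
  ... | false = ℚP.+-identityˡ _
  ... | true rewrite ==ₐ⇒≡ {v} {w} eq | ¬strict-below {w} ⊑-refl = refl

hook-formulaL : ∀ {k} (ts : List (LTree k)) →
  length (filterᵇ (increasing []) (perms (addrsL [] 0 ts))) ℕ.* hooksL ts ≡ sizeL ts !
hook-formulaL ts = ι-injective (begin
  ι (length (filterᵇ (increasing []) (perms V)) ℕ.* hooksL ts)
    ≡⟨ ι-* (length (filterᵇ (increasing []) (perms V))) (hooksL ts) ⟩
  ι (length (filterᵇ (increasing []) (perms V))) * ι (hooksL ts)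
    ≡⟨ cong₂ _*_ (ι-length-filterᵇ (increasing []) (perms V)) (sym (∏-hookLength V [] 0 ts (located (λ _ → refl)))) ⟩
  ∑[ σ ∈ perms V ] 𝟙 (increasing [] σ) * ∏ V (hookLength V)
    ≡⟨ hook-formula-from (sizeL ts) (hookLength V) (length-addrsL [] 0 ts) start (hookLength-anc uV) ⟩
  ι (sizeL ts !) ∎)
  where
  V : List Addr
  V = addrsL [] 0 ts
  uV : Unique V
  uV = addrsL-unique [] 0 ts
  []∉ : [] ∉ V
  []∉ []∈ with ∈-addrsL [] 0 ts []∈
  ... | _ , _ , ()
  covered′ : ∀ {i j p} → i ∷ j ∷ p ∈ V → j ∷ p ∈ [] ⊎ j ∷ p ∈ V
  covered′ w∈ with addrsL-parent [] 0 ts w∈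
  ... | inj₂ p∈ = inj₂ p∈
  start : Front [] V
  start = record { unique = uV ; nonempty = []∉ ; disjoint = λ _ () ; downward = λ () ; covered = covered′ }

-- A forest as a list of labelled trees (all labels equal), so that its vertices
-- have the same addresses and the root case needs no separate treatment.
erase : ∀ {k} → List (LTree k) → List (LTree 1)
erase []               = []
erase (node a cs ∷ ts) = node Fin.zero (erase cs) ∷ erase ts

asTrees : ∀ {k} → Forest k → List (LTree 1)
asTrees = map (node Fin.zero ∘ erase)

addrsL-erase : ∀ {k} p i (ts : List (LTree k)) → addrsL p i (erase ts) ≡ addrsL p i ts
addrsL-erase p i []               = refl
addrsL-erase p i (node a cs ∷ ts) =
  cong ((i ∷ p) ∷_) (cong₂ _++_ (addrsL-erase (i ∷ p) 0 cs) (addrsL-erase p (suc i) ts))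

addrsL-asTrees : ∀ {k} i (x : Forest k) → addrsL [] i (asTrees x) ≡ addrsFrom i x
addrsL-asTrees i []      = refl
addrsL-asTrees i (t ∷ x) =
  cong ((i ∷ []) ∷_) (cong₂ _++_ (addrsL-erase (i ∷ []) 0 t) (addrsL-asTrees (suc i) x))

sizeL-erase : ∀ {k} (ts : List (LTree k)) → sizeL (erase ts) ≡ sizeL ts
sizeL-erase []               = refl
sizeL-erase (node a cs ∷ ts) = cong suc (cong₂ ℕ._+_ (sizeL-erase cs) (sizeL-erase ts))

hooksL-erase : ∀ {k} (ts : List (LTree k)) → hooksL (erase ts) ≡ hooksL ts
hooksL-erase []               = refl
hooksL-erase (node a cs ∷ ts) =
  cong₂ ℕ._*_ (cong₂ ℕ._*_ (cong suc (sizeL-erase cs)) (hooksL-erase cs)) (hooksL-erase ts)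

sizeF : ∀ {k} → Forest k → ℕ
sizeF []      = 0
sizeF (t ∷ x) = sizeR t ℕ.+ sizeF x

hooksF : ∀ {k} → Forest k → ℕ
hooksF []      = 1
hooksF (t ∷ x) = sizeR t ℕ.* hooksL t ℕ.* hooksF x

sizeL-asTrees : ∀ {k} (x : Forest k) → sizeL (asTrees x) ≡ sizeF x
sizeL-asTrees []      = refl
sizeL-asTrees (t ∷ x) = cong suc (cong₂ ℕ._+_ (sizeL-erase t) (sizeL-asTrees x))

hooksL-asTrees : ∀ {k} (x : Forest k) → hooksL (asTrees x) ≡ hooksF x
hooksL-asTrees []      = refl
hooksL-asTrees (t ∷ x) =
  cong₂ ℕ._*_ (cong₂ ℕ._*_ (cong suc (sizeL-erase t)) (hooksL-erase t)) (hooksL-asTrees x)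

hook-formula : ∀ {k} (x : Forest k) → η x ℕ.* hooksF x ≡ sizeF x !
hook-formula x = begin
  η x ℕ.* hooksF x
    ≡⟨ cong₂ (λ V h → length (filterᵇ (increasing []) (perms V)) ℕ.* h) (addrsL-asTrees 0 x) (hooksL-asTrees x) ⟨
  length (filterᵇ (increasing []) (perms (addrsL [] 0 (asTrees x)))) ℕ.* hooksL (asTrees x)
    ≡⟨ hook-formulaL (asTrees x) ⟩
  sizeL (asTrees x) !
    ≡⟨ cong _! (sizeL-asTrees x) ⟩
  sizeF x ! ∎

-- Sequences of leaf deletions and isolated roots

∈-delL-size : ∀ {k} (ts : List (LTree k)) {us} → us ∈ delL ts → suc (sizeL us) ≡ sizeL ts
∈-delL-size (node a [] ∷ ts) (here refl) = refl
∈-delL-size (node a [] ∷ ts) (there us∈) with ∈-map⁻ _ us∈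
... | us , us∈′ , refl = cong suc (∈-delL-size ts us∈′)
∈-delL-size (node a cs@(_ ∷ _) ∷ ts) us∈ with ∈-++⁻ (map (λ cs' → node a cs' ∷ ts) (delL cs)) us∈
... | inj₁ us∈ˡ with ∈-map⁻ _ us∈ˡ
...   | ds , ds∈ , refl = cong suc (cong (ℕ._+ sizeL ts) (∈-delL-size cs ds∈))
∈-delL-size (node a cs@(_ ∷ _) ∷ ts) us∈ | inj₂ us∈ʳ with ∈-map⁻ _ us∈ʳ
... | us , us∈′ , refl = cong suc (≡.trans (sym (ℕP.+-suc (sizeL cs) (sizeL us))) (cong (sizeL cs ℕ.+_) (∈-delL-size ts us∈′)))

∈-delF-size : ∀ {k} (x : Forest k) {z} → z ∈ delF x → suc (sizeF z) ≡ sizeF x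
∈-delF-size ([] ∷ x) (here refl) = refl
∈-delF-size ([] ∷ x) (there z∈) with ∈-map⁻ _ z∈
... | z , z∈′ , refl = cong suc (∈-delF-size x z∈′)
∈-delF-size (t@(_ ∷ _) ∷ x) z∈ with ∈-++⁻ (map (_∷ x) (delL t)) z∈
... | inj₁ z∈ˡ with ∈-map⁻ _ z∈ˡ
...   | us , us∈ , refl = cong suc (cong (ℕ._+ sizeF x) (∈-delL-size t us∈))
∈-delF-size (t@(_ ∷ _) ∷ x) z∈ | inj₂ z∈ʳ with ∈-map⁻ _ z∈ʳ
... | z , z∈′ , refl = ≡.trans (sym (ℕP.+-suc (sizeR t) (sizeF z))) (cong (sizeR t ℕ.+_) (∈-delF-size x z∈′))

∑-seqDel-suc : ∀ {k} r (x : Forest k) F → ∑ (seqDel (suc r) x) F ≡ ∑[ z ∈ delF x ] ∑ (seqDel r z) F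
∑-seqDel-suc r x F = ∑-concatMap (seqDel r) (delF x) F

-- Each deletion removes one vertex. This kills the top term left over when an isolated root is
-- summed out, and the sequences that would go on after a lone boss has been deleted.
∑-seqDel-overfull : ∀ {k} r (x : Forest k) F → sizeF x ℕ.< r → ∑ (seqDel r x) F ≡ 0ℚ
∑-seqDel-overfull (suc r) x F (s≤s size≤r) = begin
  ∑ (seqDel (suc r) x) F                ≡⟨ ∑-seqDel-suc r x F ⟩
  ∑[ z ∈ delF x ] ∑ (seqDel r z) F      ≡⟨ ∑-cong (delF x) (λ {z} z∈ → ∑-seqDel-overfull r z F
                                             (ℕP.≤-trans (ℕP.≤-reflexive (∈-delF-size x z∈)) size≤r)) ⟩
  ∑[ z ∈ delF x ] 0ℚ                    ≡⟨ ∑-zero (delF x) ⟩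
  0ℚ                                    ∎

-- The factor suc r is the choice of the step at which the extra isolated root is deleted.
∑-seqDel-bullet : ∀ {k} r (x : Forest k) F →
  ∑ (seqDel (suc r) ([] ∷ x)) F ≡ ∑[ z ∈ seqDel (suc r) x ] F ([] ∷ z) + ι (suc r) * ∑ (seqDel r x) F
∑-seqDel-bullet r x F = begin
  ∑ (seqDel (suc r) ([] ∷ x)) F
    ≡⟨ ∑-seqDel-suc r ([] ∷ x) F ⟩
  ∑ (seqDel r x) F + ∑[ z ∈ map ([] ∷_) (delF x) ] ∑ (seqDel r z) F
    ≡⟨ cong (_+_ (∑ (seqDel r x) F)) (∑-map ([] ∷_) (delF x) _) ⟩
  ∑ (seqDel r x) F + ∑[ z ∈ delF x ] ∑ (seqDel r ([] ∷ z)) F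
    ≡⟨ cong (_+_ (∑ (seqDel r x) F)) (rest r) ⟩
  ∑ (seqDel r x) F + (∑[ z ∈ seqDel (suc r) x ] F ([] ∷ z) + ι r * ∑ (seqDel r x) F)
    ≡⟨ solve 3 (λ s k n → s :+ (k :+ n :* s) := k :+ (con 1ℚ :+ n) :* s) refl (∑ (seqDel r x) F) kept (ι r) ⟩
  kept + (1ℚ + ι r) * ∑ (seqDel r x) F
    ≡⟨ cong (λ n → kept + n * ∑ (seqDel r x) F) (ι-suc r) ⟨
  ∑[ z ∈ seqDel (suc r) x ] F ([] ∷ z) + ι (suc r) * ∑ (seqDel r x) F ∎
  where
  kept : ℚ
  kept = ∑[ z ∈ seqDel (suc r) x ] F ([] ∷ z)
  rest : ∀ r → ∑[ z ∈ delF x ] ∑ (seqDel r ([] ∷ z)) F ≡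
         ∑[ z ∈ seqDel (suc r) x ] F ([] ∷ z) + ι r * ∑ (seqDel r x) F
  rest zero = begin
    ∑[ z ∈ delF x ] ∑ (seqDel 0 ([] ∷ z)) F
      ≡⟨ ∑-seqDel-suc 0 x (λ z → F ([] ∷ z)) ⟨
    ∑[ z ∈ seqDel 1 x ] F ([] ∷ z)
      ≡⟨ ℚP.+-identityʳ _ ⟨
    ∑[ z ∈ seqDel 1 x ] F ([] ∷ z) + 0ℚ
      ≡⟨ cong (_+_ (∑[ z ∈ seqDel 1 x ] F ([] ∷ z)))
           (≡.trans (cong (_* ∑ (seqDel 0 x) F) ι-0) (ℚP.*-zeroˡ (∑ (seqDel 0 x) F))) ⟨
    ∑[ z ∈ seqDel 1 x ] F ([] ∷ z) + ι 0 * ∑ (seqDel 0 x) F ∎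
  rest (suc r) = begin
    ∑[ z ∈ delF x ] ∑ (seqDel (suc r) ([] ∷ z)) F
      ≡⟨ ∑-cong (delF x) (λ {z} _ → ∑-seqDel-bullet r z F) ⟩
    ∑[ z ∈ delF x ] (∑[ u ∈ seqDel (suc r) z ] F ([] ∷ u) + ι (suc r) * ∑ (seqDel r z) F)
      ≡⟨ ∑-+ (delF x) _ _ ⟩
    ∑[ z ∈ delF x ] ∑[ u ∈ seqDel (suc r) z ] F ([] ∷ u) + ∑[ z ∈ delF x ] (ι (suc r) * ∑ (seqDel r z) F)
      ≡⟨ cong₂ _+_ (sym (∑-seqDel-suc (suc r) x _))
           (≡.trans (∑-*ˡ (ι (suc r)) (delF x) _) (cong (ι (suc r) *_) (sym (∑-seqDel-suc r x F)))) ⟩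
    ∑[ z ∈ seqDel (suc (suc r)) x ] F ([] ∷ z) + ι (suc r) * ∑ (seqDel (suc r) x) F ∎

-- the coefficient of y in m Δ_{1^r}(x), after disjoint union with b isolated roots
delCount : ∀ {k} → Forest k → ℕ → ℕ → Forest k → ℚ
delCount y b r x = ∑[ z ∈ seqDel r x ] 𝟙 (isoF y (bullets (r ℕ.+ b) ++ z))

ι-coeff : ∀ {k} (y : Forest k) r x → ι (coeff y (mΔ r x)) ≡ delCount y 0 r x
ι-coeff y r x = begin
  ι (coeff y (mΔ r x))
    ≡⟨ ι-length-filterᵇ (λ z → isoF y z) (mΔ r x) ⟩
  ∑[ z ∈ map (λ z → bullets r ++ z) (seqDel r x) ] 𝟙 (isoF y z)
    ≡⟨ ∑-map (λ z → bullets r ++ z) (seqDel r x) (λ z → 𝟙 (isoF y z)) ⟩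
  ∑[ z ∈ seqDel r x ] 𝟙 (isoF y (bullets r ++ z))
    ≡⟨ cong (λ n → ∑[ z ∈ seqDel r x ] 𝟙 (isoF y (bullets n ++ z))) (ℕP.+-identityʳ r) ⟨
  delCount y 0 r x ∎

frac-coeff : ∀ {k} (y : Forest k) r x → frac (coeff y (mΔ r x)) 1 ≡ delCount y 0 r x
frac-coeff y r x = ≡.trans (sym (ι-def (coeff y (mΔ r x)))) (ι-coeff y r x)

bullets-snoc : ∀ {k} n (z : Forest k) → bullets n ++ [] ∷ z ≡ bullets (suc n) ++ z
bullets-snoc zero    z = refl
bullets-snoc (suc n) z = cong ([] ∷_) (bullets-snoc n z)

bullets-+-suc : ∀ {k} r b (z : Forest k) → bullets (suc r ℕ.+ b) ++ z ≡ bullets (r ℕ.+ suc b) ++ z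
bullets-+-suc r b z = cong (λ n → bullets n ++ z) (sym (ℕP.+-suc r b))

delCount-bullet-zero : ∀ {k} (y : Forest k) b x → delCount y b 0 ([] ∷ x) ≡ delCount y (suc b) 0 x
delCount-bullet-zero y b x = cong (λ z → 𝟙 (isoF y z) + 0ℚ) (bullets-snoc b x)

delCount-bullet-suc : ∀ {k} (y : Forest k) b r x →
  delCount y b (suc r) ([] ∷ x) ≡ delCount y (suc b) (suc r) x + ι (suc r) * delCount y (suc b) r x
delCount-bullet-suc y b r x = ≡.trans (∑-seqDel-bullet r x _) (cong₂ (λ s t → s + ι (suc r) * t)
  (∑-cong (seqDel (suc r) x) (λ {z} _ → cong (𝟙 ∘ isoF y)
    (≡.trans (bullets-snoc (suc r ℕ.+ b) z) (bullets-+-suc (suc r) b z))))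
  (∑-cong (seqDel r x) (λ {z} _ → cong (𝟙 ∘ isoF y) (bullets-+-suc r b z))))

delCount-bullets-zero : ∀ {k} (y : Forest k) N b x →
  delCount y b 0 (bullets N ++ x) ≡ delCount y (N ℕ.+ b) 0 x
delCount-bullets-zero y zero    b x = refl
delCount-bullets-zero y (suc N) b x = begin
  delCount y b 0 ([] ∷ bullets N ++ x) ≡⟨ delCount-bullet-zero y b (bullets N ++ x) ⟩
  delCount y (suc b) 0 (bullets N ++ x) ≡⟨ delCount-bullets-zero y N (suc b) x ⟩
  delCount y (N ℕ.+ suc b) 0 x         ≡⟨ cong (λ n → delCount y n 0 x) (ℕP.+-suc N b) ⟩
  delCount y (suc N ℕ.+ b) 0 x         ∎

-- The deleted leaf lies in `x` or is one of the `N` isolated roots. In the second case the new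
-- isolated root restores the forest; this becomes the event of no firing in the single model.
delCount-bullets-one : ∀ {k} (y : Forest k) N b x →
  delCount y b 1 (bullets N ++ x) ≡ delCount y (N ℕ.+ b) 1 x + ι N * delCount y (N ℕ.+ b) 0 x
delCount-bullets-one y zero    b x = sym (≡.trans (cong (_+_ (delCount y b 1 x))
  (≡.trans (cong (_* delCount y b 0 x) ι-0) (ℚP.*-zeroˡ (delCount y b 0 x)))) (ℚP.+-identityʳ _))
delCount-bullets-one y (suc N) b x = begin
  delCount y b 1 ([] ∷ bullets N ++ x)
    ≡⟨ delCount-bullet-suc y b 0 (bullets N ++ x) ⟩
  delCount y (suc b) 1 (bullets N ++ x) + ι 1 * delCount y (suc b) 0 (bullets N ++ x)
    ≡⟨ cong₂ (λ s t → s + ι 1 * t) (delCount-bullets-one y N (suc b) x) (delCount-bullets-zero y N (suc b) x) ⟩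
  delCount y (N ℕ.+ suc b) 1 x + ι N * delCount y (N ℕ.+ suc b) 0 x + ι 1 * delCount y (N ℕ.+ suc b) 0 x
    ≡⟨ cong (λ n → delCount y n 1 x + ι N * delCount y n 0 x + ι 1 * delCount y n 0 x) (ℕP.+-suc N b) ⟩
  d₁ + ι N * d₀ + ι 1 * d₀
    ≡⟨ cong (λ u → d₁ + ι N * d₀ + u * d₀) ι-1 ⟩
  d₁ + ι N * d₀ + 1ℚ * d₀
    ≡⟨ solve 3 (λ s n t → s :+ n :* t :+ con 1ℚ :* t := s :+ (con 1ℚ :+ n) :* t) refl d₁ (ι N) d₀ ⟩
  d₁ + (1ℚ + ι N) * d₀
    ≡⟨ cong (λ n → d₁ + n * d₀) (ι-suc N) ⟨
  d₁ + ι (suc N) * d₀ ∎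
  where
  d₀ d₁ : ℚ
  d₀ = delCount y (suc N ℕ.+ b) 0 x
  d₁ = delCount y (suc N ℕ.+ b) 1 x

-- Binomial weights

-- The last term is split off, as in `binSum`, so that the two can be compared term by term.
∑≤ : ℕ → (ℕ → ℚ) → ℚ
∑≤ zero    f = f 0
∑≤ (suc n) f = ∑≤ n f + f (suc n)

∑≤-cong : ∀ n {f g} → (∀ r → r ℕ.≤ n → f r ≡ g r) → ∑≤ n f ≡ ∑≤ n g
∑≤-cong zero    eq = eq 0 z≤n
∑≤-cong (suc n) eq = cong₂ _+_ (∑≤-cong n (λ r r≤n → eq r (ℕP.m≤n⇒m≤1+n r≤n))) (eq (suc n) ℕP.≤-refl)

∑≤-*ˡ : ∀ c n f → ∑≤ n (λ r → c * f r) ≡ c * ∑≤ n f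
∑≤-*ˡ c zero    f = refl
∑≤-*ˡ c (suc n) f = ≡.trans (cong (_+ c * f (suc n)) (∑≤-*ˡ c n f)) (sym (ℚP.*-distribˡ-+ c (∑≤ n f) (f (suc n))))

∑≤-head : ∀ n f → ∑≤ (suc n) f ≡ f 0 + ∑≤ n (f ∘ suc)
∑≤-head zero    f = refl
∑≤-head (suc n) f = ≡.trans (cong (_+ f (suc (suc n))) (∑≤-head n f)) (ℚP.+-assoc (f 0) _ _)

∑-∑≤-swap : ∀ {A : Set} (xs : List A) n (f : A → ℕ → ℚ) →
  ∑[ x ∈ xs ] ∑≤ n (f x) ≡ ∑≤ n (λ r → ∑[ x ∈ xs ] f x r)
∑-∑≤-swap xs zero    f = refl
∑-∑≤-swap xs (suc n) f = ≡.trans (∑-+ xs _ _) (cong (_+ ∑[ x ∈ xs ] f x (suc n)) (∑-∑≤-swap xs n f))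

-- Bracketed as in `binSum`, with `1ℚ - q` replaced by a free `p`: the relation `p + q ≡ 1ℚ` enters
-- only when isolated roots are summed out.
weight : ℚ → ℚ → ℕ → ℕ → ℚ
weight p q m r = frac 1 (r !) * (p ^ℚ r) * (q ^ℚ (m ∸ r))

binSum-∑≤ : ∀ {k} m q (x y : Forest k) r →
  binSum m q x y r ≡ ∑≤ r (λ j → weight (1ℚ - q) q m j * delCount y 0 j x)
binSum-∑≤ m q x y zero = begin
  frac (coeff y (mΔ 0 x)) 1 * (q ^ℚ m)
    ≡⟨ cong (_* (q ^ℚ m)) (frac-coeff y 0 x) ⟩
  delCount y 0 0 x * (q ^ℚ m)
    ≡⟨ solve 2 (λ d w → d :* w := con 1ℚ :* con 1ℚ :* w :* d) refl (delCount y 0 0 x) (q ^ℚ m) ⟩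
  weight (1ℚ - q) q m 0 * delCount y 0 0 x ∎
binSum-∑≤ m q x y (suc r) =
  cong₂ _+_ (binSum-∑≤ m q x y r) (cong (weight (1ℚ - q) q m (suc r) *_) (frac-coeff y (suc r) x))

frac-!-suc : ∀ r → frac 1 (suc r !) * ι (suc r) ≡ frac 1 (r !)
frac-!-suc r = ι-cancelʳ (r !) {{ℕ.>-nonZero (ℕP.1≤n! r)}} (begin
  frac 1 (suc r !) * ι (suc r) * ι (r !)   ≡⟨ ℚP.*-assoc (frac 1 (suc r !)) (ι (suc r)) (ι (r !)) ⟩
  frac 1 (suc r !) * (ι (suc r) * ι (r !)) ≡⟨ cong (frac 1 (suc r !) *_) (ι-* (suc r) (r !)) ⟨
  frac 1 (suc r !) * ι (suc r !)           ≡⟨ frac-inverse (suc r !) {{ℕ.>-nonZero (ℕP.1≤n! (suc r))}} ⟩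
  1ℚ                                       ≡⟨ frac-inverse (r !) {{ℕ.>-nonZero (ℕP.1≤n! r)}} ⟨
  frac 1 (r !) * ι (r !)                   ∎)

module _ (p q : ℚ) where

  weight-suc-total : ∀ {m r} → r ℕ.≤ m → weight p q (suc m) r ≡ q * weight p q m r
  weight-suc-total {m} {r} r≤m = begin
    a * (q ^ℚ (suc m ∸ r))     ≡⟨ cong (λ e → a * (q ^ℚ e)) (ℕP.+-∸-assoc 1 r≤m) ⟩
    a * (q * (q ^ℚ (m ∸ r)))   ≡⟨ solve 3 (λ a q b → a :* (q :* b) := q :* (a :* b)) refl a q (q ^ℚ (m ∸ r)) ⟩
    q * (a * (q ^ℚ (m ∸ r)))   ∎
    where
    a : ℚ
    a = frac 1 (r !) * (p ^ℚ r)

  weight-suc-suc : ∀ m r → weight p q (suc m) (suc r) * ι (suc r) ≡ p * weight p q m r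
  weight-suc-suc m r = begin
    frac 1 (suc r !) * (p * (p ^ℚ r)) * (q ^ℚ (m ∸ r)) * ι (suc r)
      ≡⟨ solve 5 (λ f p e g n → f :* (p :* e) :* g :* n := p :* (f :* n :* e :* g)) refl
           (frac 1 (suc r !)) p (p ^ℚ r) (q ^ℚ (m ∸ r)) (ι (suc r)) ⟩
    p * (frac 1 (suc r !) * ι (suc r) * (p ^ℚ r) * (q ^ℚ (m ∸ r)))
      ≡⟨ cong (λ f → p * (f * (p ^ℚ r) * (q ^ℚ (m ∸ r)))) (frac-!-suc r) ⟩
    p * weight p q m r ∎

  -- One step of the binomial theorem. A sequence of deletions either avoids the additional isolated
  -- root, which gives a factor `q`, or contains it in one of `suc r` places, which turns
  -- `1 / (suc r) !` into `1 / r !` and gives a factor `p`. The term with `c (suc r)` stays apart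
  -- because for `r ≡ m` no factor `q` can be split off from its weight; where the lemma is applied,
  -- `c (suc m)` is zero.
  ∑≤-weight-bullet : ∀ {c c′ : ℕ → ℚ} → c′ 0 ≡ c 0 → (∀ r → c′ (suc r) ≡ c (suc r) + ι (suc r) * c r) →
    ∀ {m} r → r ℕ.≤ m →
    ∑≤ (suc r) (λ j → weight p q (suc m) j * c′ j) ≡
      (p + q) * ∑≤ r (λ j → weight p q m j * c j) + weight p q (suc m) (suc r) * c (suc r)
  ∑≤-weight-bullet {c} {c′} c₀ cₛ {m} r r≤m = begin
    ∑≤ (suc r) (λ j → weight p q (suc m) j * c′ j)
      ≡⟨ cong (_+_ (∑≤ r (λ j → weight p q (suc m) j * c′ j))) (raise r) ⟩
    ∑≤ r (λ j → weight p q (suc m) j * c′ j) + (p * (weight p q m r * c r) + t)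
      ≡⟨ cong (_+ (p * (weight p q m r * c r) + t)) (earlier r r≤m) ⟩
    p * before r + q * s + (p * (weight p q m r * c r) + t)
      ≡⟨ solve 6 (λ p q b s u t → p :* b :+ q :* s :+ (p :* u :+ t) := p :* (b :+ u) :+ q :* s :+ t) refl
           p q (before r) s (weight p q m r * c r) t ⟩
    p * (before r + weight p q m r * c r) + q * s + t
      ≡⟨ cong (λ z → p * z + q * s + t) (before-step r) ⟩
    p * s + q * s + t
      ≡⟨ cong (_+ t) (ℚP.*-distribʳ-+ s p q) ⟨
    (p + q) * s + t ∎
    where
    s t : ℚ
    s = ∑≤ r (λ j → weight p q m j * c j)
    t = weight p q (suc m) (suc r) * c (suc r)
    -- The sum over `j < r`. Since `∑≤` always has at least one term, the empty sum needs its own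
    -- clause.
    before : ℕ → ℚ
    before zero    = 0ℚ
    before (suc r) = ∑≤ r (λ j → weight p q m j * c j)
    before-step : ∀ r → before r + weight p q m r * c r ≡ ∑≤ r (λ j → weight p q m j * c j)
    before-step zero    = ℚP.+-identityˡ _
    before-step (suc r) = refl
    raise : ∀ r → weight p q (suc m) (suc r) * c′ (suc r) ≡
            p * (weight p q m r * c r) + weight p q (suc m) (suc r) * c (suc r)
    raise r = begin
      weight p q (suc m) (suc r) * c′ (suc r)
        ≡⟨ cong (weight p q (suc m) (suc r) *_) (cₛ r) ⟩
      weight p q (suc m) (suc r) * (c (suc r) + ι (suc r) * c r)
        ≡⟨ solve 4 (λ w a n b → w :* (a :+ n :* b) := w :* n :* b :+ w :* a) refl
             (weight p q (suc m) (suc r)) (c (suc r)) (ι (suc r)) (c r) ⟩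
      weight p q (suc m) (suc r) * ι (suc r) * c r + weight p q (suc m) (suc r) * c (suc r)
        ≡⟨ cong (_+ weight p q (suc m) (suc r) * c (suc r))
             (≡.trans (cong (_* c r) (weight-suc-suc m r)) (ℚP.*-assoc p (weight p q m r) (c r))) ⟩
      p * (weight p q m r * c r) + weight p q (suc m) (suc r) * c (suc r) ∎
    earlier : ∀ r → r ℕ.≤ m → ∑≤ r (λ j → weight p q (suc m) j * c′ j) ≡
              p * before r + q * ∑≤ r (λ j → weight p q m j * c j)
    earlier zero    r≤m = begin
      weight p q (suc m) 0 * c′ 0        ≡⟨ cong₂ _*_ (weight-suc-total {m} z≤n) c₀ ⟩
      q * weight p q m 0 * c 0           ≡⟨ solve 4 (λ p q w c → q :* w :* c := p :* con 0ℚ :+ q :* (w :* c)) refl p q (weight p q m 0) (c 0) ⟩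
      p * 0ℚ + q * (weight p q m 0 * c 0) ∎
    earlier (suc r) r<m = begin
      ∑≤ r (λ j → weight p q (suc m) j * c′ j) + weight p q (suc m) (suc r) * c′ (suc r)
        ≡⟨ cong₂ _+_ (earlier r (ℕP.<⇒≤ r<m)) (raise r) ⟩
      p * before r + q * S + (p * (weight p q m r * c r) + weight p q (suc m) (suc r) * c (suc r))
        ≡⟨ cong (λ w → p * before r + q * S + (p * (weight p q m r * c r) + w * c (suc r))) (weight-suc-total r<m) ⟩
      p * before r + q * S + (p * (weight p q m r * c r) + q * weight p q m (suc r) * c (suc r))
        ≡⟨ solve 7 (λ p q b S u w c → p :* b :+ q :* S :+ (p :* u :+ q :* w :* c) := p :* (b :+ u) :+ q :* (S :+ w :* c))
             refl p q (before r) S (weight p q m r * c r) (weight p q m (suc r)) (c (suc r)) ⟩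
      p * (before r + weight p q m r * c r) + q * (S + weight p q m (suc r) * c (suc r))
        ≡⟨ cong (λ z → p * z + q * (S + weight p q m (suc r) * c (suc r))) (before-step r) ⟩
      p * S + q * (S + weight p q m (suc r) * c (suc r)) ∎
      where
      S : ℚ
      S = ∑≤ r (λ j → weight p q m j * c j)

sizeF-bullets : ∀ {k} N (x : Forest k) → sizeF (bullets N ++ x) ≡ N ℕ.+ sizeF x
sizeF-bullets zero    x = refl
sizeF-bullets (suc N) x = cong suc (sizeF-bullets N x)

-- Isolated roots contribute the factor (p + q)^N = 1 of the binomial theorem.
∑≤-weight-bullets : ∀ {k} p q → p + q ≡ 1ℚ → ∀ (y : Forest k) N b x →
  ∑≤ (N ℕ.+ sizeF x) (λ r → weight p q (N ℕ.+ sizeF x) r * delCount y b r (bullets N ++ x)) ≡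
    ∑≤ (sizeF x) (λ r → weight p q (sizeF x) r * delCount y (N ℕ.+ b) r x)
∑≤-weight-bullets p q p+q y zero    b x = refl
∑≤-weight-bullets p q p+q y (suc N) b x = begin
  ∑≤ (suc m) (λ r → weight p q (suc m) r * delCount y b r ([] ∷ bullets N ++ x))
    ≡⟨ ∑≤-weight-bullet p q (delCount-bullet-zero y b (bullets N ++ x)) (λ r → delCount-bullet-suc y b r (bullets N ++ x)) m ℕP.≤-refl ⟩
  (p + q) * s + weight p q (suc m) (suc m) * delCount y (suc b) (suc m) (bullets N ++ x)
    ≡⟨ cong₂ (λ e d → e * s + weight p q (suc m) (suc m) * d) p+q
         (∑-seqDel-overfull (suc m) (bullets N ++ x) _ (s≤s (ℕP.≤-reflexive (sizeF-bullets N x)))) ⟩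
  1ℚ * s + weight p q (suc m) (suc m) * 0ℚ
    ≡⟨ solve 2 (λ s w → con 1ℚ :* s :+ w :* con 0ℚ := s) refl s (weight p q (suc m) (suc m)) ⟩
  s
    ≡⟨ ∑≤-weight-bullets p q p+q y N (suc b) x ⟩
  ∑≤ (sizeF x) (λ r → weight p q (sizeF x) r * delCount y (N ℕ.+ suc b) r x)
    ≡⟨ cong (λ n → ∑≤ (sizeF x) (λ r → weight p q (sizeF x) r * delCount y n r x)) (ℕP.+-suc N b) ⟩
  ∑≤ (sizeF x) (λ r → weight p q (sizeF x) r * delCount y (suc N ℕ.+ b) r x) ∎
  where
  m : ℕ
  m = N ℕ.+ sizeF x
  s : ℚ
  s = ∑≤ m (λ r → weight p q m r * delCount y (suc b) r (bullets N ++ x))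

-- The forests `embed T0 S` are told apart by their labels

open IsRootedSubtree

any⁻ : ∀ {A : Set} (P : A → Bool) xs → any P xs ≡ true → ∃[ x ] (x ∈ xs × P x ≡ true)
any⁻ P (x ∷ xs) eq with ∨-true⁻ (P x) eq
... | inj₁ px = x , here refl , px
... | inj₂ r with any⁻ P xs r
...   | y , y∈ , py = y , there y∈ , py

mutual
  isoT-refl : ∀ {k} (t : LTree k) → isoT t t ≡ true
  isoT-refl (node a cs) with a Fin.≟ a
  ... | yes _  = isoLs-refl cs
  ... | no a≢a = contradiction refl a≢a

  isoLs-refl : ∀ {k} (ts : List (LTree k)) → isoLs ts ts ≡ true
  isoLs-refl []       = refl
  isoLs-refl (t ∷ ts) rewrite isoT-refl t | isoLs-refl ts = refl

isoF-refl : ∀ {k} (x : Forest k) → isoF x x ≡ true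
isoF-refl []      = refl
isoF-refl (t ∷ x) rewrite isoLs-refl t | isoF-refl x = refl

labelsT : ∀ {k} → LTree k → List (Fin k)
labelsT (node a cs) = a ∷ labelsL cs

labelsL-concatMap : ∀ {k} (ts : List (LTree k)) → labelsL ts ≡ concatMap labelsT ts
labelsL-concatMap []               = refl
labelsL-concatMap (node a cs ∷ ts) = cong (λ l → a ∷ labelsL cs ++ l) (labelsL-concatMap ts)

concatMap-↭ : ∀ {A B : Set} (f : A → List B) {xs ys} → xs ↭ ys → concatMap f xs ↭ concatMap f ys
concatMap-↭ f refl         = ↭-refl
concatMap-↭ f (prep x p)   = ↭P.++⁺ˡ (f x) (concatMap-↭ f p)
concatMap-↭ f (swap {xs} x y p) = trans (↭P.shifts (f x) (f y)) (↭P.++⁺ˡ (f y) (↭P.++⁺ˡ (f x) (concatMap-↭ f p)))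
concatMap-↭ f (trans p q)  = trans (concatMap-↭ f p) (concatMap-↭ f q)

mutual
  isoT-labels : ∀ {k} (t u : LTree k) → isoT t u ≡ true → labelsT t ↭ labelsT u
  isoT-labels (node a cs) (node b ds) eq with a Fin.≟ b
  ... | yes refl = prep a (isoLs-labels cs ds eq)

  isoLs-labels : ∀ {k} (ts us : List (LTree k)) → isoLs ts us ≡ true → labelsL ts ↭ labelsL us
  isoLs-labels [] [] eq = ↭-refl
  isoLs-labels (t ∷ ts) us eq with any⁻ _ (picks us) eq
  ... | (u , rest) , p∈ , eq′ = ≡.subst₂ _↭_ (sym (labelsL-concatMap (t ∷ ts))) (sym (labelsL-concatMap us)) (trans
    (↭P.++⁺ (isoT-labels t u (BoolP.∧-conicalˡ _ _ eq′))
         (≡.subst₂ _↭_ (labelsL-concatMap ts) (labelsL-concatMap rest) (isoLs-labels ts rest (BoolP.∧-conicalʳ (isoT t u) _ eq′))))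
    (↭-sym (concatMap-↭ labelsT (picks-↭ p∈))))

isoF-labels : ∀ {k} (x y : Forest k) → isoF x y ≡ true → concatMap labelsL x ↭ concatMap labelsL y
isoF-labels [] [] eq = ↭-refl
isoF-labels (t ∷ x) y eq with any⁻ _ (picks y) eq
... | (u , rest) , p∈ , eq′ = trans
  (↭P.++⁺ (isoLs-labels t u (BoolP.∧-conicalˡ _ _ eq′)) (isoF-labels x rest (BoolP.∧-conicalʳ (isoLs t u) _ eq′)))
  (↭-sym (concatMap-↭ labelsL (picks-↭ p∈)))

Closed : VSet → Set
Closed S = ∀ i a → S (i ∷ a) ≡ true → S a ≡ true

closed-up : ∀ {S u w} → Closed S → u ⊑ w → S w ≡ true → S u ≡ true
closed-up cl ⊑-refl                 Sw = Sw
closed-up cl (⊑-step {i} {w} q) Sw = closed-up cl q (cl i w Sw)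

absent-below : ∀ {k S p} (ts : List (LTree k)) → Closed S → S p ≡ false →
  ∀ {w} → w ∈ addrsL p 0 ts → S w ≡ false
absent-below {p = p} ts cl Sp w∈ with ∈-addrsL p 0 ts w∈
... | _ , _ , q = ≢true⇒false (λ Sw → contradiction (≡.trans (sym (closed-up cl (⊑-parent q) Sw)) Sp) (λ ()))

members-below-absent : ∀ {k S p} (ts : List (LTree k)) → Closed S → S p ≡ false → members (addrsL p 0 ts) S ≡ []
members-below-absent {S = S} {p} ts cl Sp = filterᵇ-none S (addrsL p 0 ts) (absent-below ts cl Sp)

-- `induceL` discards everything below an absent vertex, while `members` tests each address
-- separately; they agree because `S` is closed under parents.
sizeL-induceL : ∀ {k S} → Closed S → ∀ p i (ts : List (LTree k)) →
  sizeL (induceL S p i ts) ≡ length (members (addrsL p i ts) S)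
sizeL-induceL cl p i [] = refl
sizeL-induceL {S = S} cl p i (node a cs ∷ ts) with S (i ∷ p) in eq
... | false = ≡.trans (sizeL-induceL cl p (suc i) ts) (cong length (sym
  (≡.trans (filterᵇ-++ S (addrsL (i ∷ p) 0 cs) (addrsL p (suc i) ts))
    (cong (_++ members (addrsL p (suc i) ts) S) (members-below-absent cs cl eq)))))
... | true = cong suc (begin
  sizeL (induceL S (i ∷ p) 0 cs) ℕ.+ sizeL (induceL S p (suc i) ts)
    ≡⟨ cong₂ ℕ._+_ (sizeL-induceL cl (i ∷ p) 0 cs) (sizeL-induceL cl p (suc i) ts) ⟩
  length (members (addrsL (i ∷ p) 0 cs) S) ℕ.+ length (members (addrsL p (suc i) ts) S)
    ≡⟨ ListP.length-++ (members (addrsL (i ∷ p) 0 cs) S) ⟨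
  length (members (addrsL (i ∷ p) 0 cs) S ++ members (addrsL p (suc i) ts) S)
    ≡⟨ cong length (filterᵇ-++ S (addrsL (i ∷ p) 0 cs) (addrsL p (suc i) ts)) ⟨
  length (members (addrsL (i ∷ p) 0 cs ++ addrsL p (suc i) ts) S) ∎)

-- Carries addresses and labels in one list: a subtree selects entries by address, an isomorphism
-- sees only the labels.
labelled : ∀ {k} → Addr → ℕ → List (LTree k) → List (Addr × Fin k)
labelled p i []               = []
labelled p i (node a cs ∷ ts) = (i ∷ p , a) ∷ labelled (i ∷ p) 0 cs ++ labelled p (suc i) ts

map-proj₁-labelled : ∀ {k} p i (ts : List (LTree k)) → map proj₁ (labelled p i ts) ≡ addrsL p i ts
map-proj₁-labelled p i [] = refl
map-proj₁-labelled p i (node a cs ∷ ts) = cong ((i ∷ p) ∷_)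
  (≡.trans (ListP.map-++ proj₁ (labelled (i ∷ p) 0 cs) _) (cong₂ _++_ (map-proj₁-labelled (i ∷ p) 0 cs) (map-proj₁-labelled p (suc i) ts)))

map-proj₂-labelled : ∀ {k} p i (ts : List (LTree k)) → map proj₂ (labelled p i ts) ≡ labelsL ts
map-proj₂-labelled p i [] = refl
map-proj₂-labelled p i (node a cs ∷ ts) = cong (a ∷_)
  (≡.trans (ListP.map-++ proj₂ (labelled (i ∷ p) 0 cs) _) (cong₂ _++_ (map-proj₂-labelled (i ∷ p) 0 cs) (map-proj₂-labelled p (suc i) ts)))

∈-labelled⇒∈-addrsL : ∀ {k} p i (ts : List (LTree k)) {z} → z ∈ labelled p i ts → proj₁ z ∈ addrsL p i ts
∈-labelled⇒∈-addrsL p i ts z∈ = subst (_ ∈_) (map-proj₁-labelled p i ts) (∈-map⁺ proj₁ z∈)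

labelled-below-absent : ∀ {k S p} (ts : List (LTree k)) → Closed S → S p ≡ false →
  filterᵇ (S ∘ proj₁) (labelled p 0 ts) ≡ []
labelled-below-absent {S = S} {p} ts cl Sp = filterᵇ-none (S ∘ proj₁) (labelled p 0 ts)
  (absent-below ts cl Sp ∘ ∈-labelled⇒∈-addrsL p 0 ts)

labelsL-induceL : ∀ {k S} → Closed S → ∀ p i (ts : List (LTree k)) →
  labelsL (induceL S p i ts) ≡ map proj₂ (filterᵇ (S ∘ proj₁) (labelled p i ts))
labelsL-induceL cl p i [] = refl
labelsL-induceL {S = S} cl p i (node a cs ∷ ts) with S (i ∷ p) in eq
... | false = ≡.trans (labelsL-induceL cl p (suc i) ts) (cong (map proj₂) (sym
  (≡.trans (filterᵇ-++ (S ∘ proj₁) (labelled (i ∷ p) 0 cs) (labelled p (suc i) ts))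
    (cong (_++ filterᵇ (S ∘ proj₁) (labelled p (suc i) ts)) (labelled-below-absent cs cl eq)))))
... | true = cong (a ∷_) (begin
  labelsL (induceL S (i ∷ p) 0 cs) ++ labelsL (induceL S p (suc i) ts)
    ≡⟨ cong₂ _++_ (labelsL-induceL cl (i ∷ p) 0 cs) (labelsL-induceL cl p (suc i) ts) ⟩
  map proj₂ (filterᵇ (S ∘ proj₁) (labelled (i ∷ p) 0 cs)) ++ map proj₂ (filterᵇ (S ∘ proj₁) (labelled p (suc i) ts))
    ≡⟨ ListP.map-++ proj₂ (filterᵇ (S ∘ proj₁) (labelled (i ∷ p) 0 cs)) _ ⟨
  map proj₂ (filterᵇ (S ∘ proj₁) (labelled (i ∷ p) 0 cs) ++ filterᵇ (S ∘ proj₁) (labelled p (suc i) ts))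
    ≡⟨ cong (map proj₂) (filterᵇ-++ (S ∘ proj₁) (labelled (i ∷ p) 0 cs) (labelled p (suc i) ts)) ⟨
  map proj₂ (filterᵇ (S ∘ proj₁) (labelled (i ∷ p) 0 cs ++ labelled p (suc i) ts)) ∎)

map-unique-injective : ∀ {A B : Set} (f : A → B) {xs x y} → Unique (map f xs) → x ∈ xs → y ∈ xs → f x ≡ f y → x ≡ y
map-unique-injective f u       (here refl) (here refl) eq = refl
map-unique-injective f {xs = _ ∷ xs} u (here refl) (there y∈)  eq =
  contradiction (subst (_∈ map f xs) (sym eq) (∈-map⁺ f y∈)) (Unique-head u)
map-unique-injective f {xs = _ ∷ xs} u (there x∈)  (here refl) eq =
  contradiction (subst (_∈ map f xs) eq (∈-map⁺ f x∈)) (Unique-head u)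
map-unique-injective f (_ ∷ u) (there x∈)  (there y∈)  eq = map-unique-injective f u x∈ y∈ eq

filterᵇ-labels-⊆ : ∀ {A B : Set} (f : A → B) (P Q : A → Bool) {xs} → Unique (map f xs) →
  map f (filterᵇ P xs) ↭ map f (filterᵇ Q xs) → ∀ {x} → x ∈ xs → P x ≡ true → Q x ≡ true
filterᵇ-labels-⊆ f P Q {xs} u p {x} x∈ Px with ∈-map⁻ f (↭P.∈-resp-↭ p (∈-map⁺ f (∈-filterᵇ⁺ P x∈ Px)))
... | y , y∈ , eq with ∈-filterᵇ⁻ Q xs y∈
...   | y∈xs , Qy rewrite map-unique-injective f u x∈ y∈xs eq = Qy

sameSet⁻ : ∀ {S S′} V → sameSet V S S′ ≡ true → ∀ {a} → a ∈ V → S a ≡ S′ a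
sameSet⁻ {S} {S′} (v ∷ V) eq a∈ with S v BoolP.≟ S′ v
sameSet⁻ (v ∷ V) eq (here refl) | yes p = p
sameSet⁻ (v ∷ V) eq (there a∈)  | yes p = sameSet⁻ V eq a∈

sameSet⁺ : ∀ {S S′} V → (∀ {a} → a ∈ V → S a ≡ S′ a) → sameSet V S S′ ≡ true
sameSet⁺ [] f = refl
sameSet⁺ {S} {S′} (v ∷ V) f with S v BoolP.≟ S′ v
... | yes p = sameSet⁺ V (f ∘ there)
... | no ¬p = contradiction (f (here refl)) ¬p

induceL-cong : ∀ {k S S′} p i (ts : List (LTree k)) → (∀ {a} → a ∈ addrsL p i ts → S a ≡ S′ a) →
  induceL S p i ts ≡ induceL S′ p i ts
induceL-cong p i [] f = refl
induceL-cong {S = S} {S′} p i (node a cs ∷ ts) f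
  rewrite f (here refl)
        | induceL-cong {S = S} {S′} (i ∷ p) 0 cs (f ∘ there ∘ ∈-++⁺ˡ)
        | induceL-cong {S = S} {S′} p (suc i) ts (f ∘ there ∘ ∈-++⁺ʳ (addrsL (i ∷ p) 0 cs)) = refl

embed-cong : ∀ {k S S′} (T0 : RTree k) → (∀ {a} → a ∈ addrsR T0 → S a ≡ S′ a) → embed T0 S ≡ embed T0 S′
embed-cong T0 f = cong₂ (λ M T → bullets (sizeR T0 ∸ length M) ++ (T ∷ []))
  (filterᵇ-cong (addrsR T0) f) (induceL-cong [] 0 T0 (f ∘ there))

concatMap-labels-bullets : ∀ {k} N (T : RTree k) → concatMap labelsL (bullets N ++ T ∷ []) ≡ labelsL T
concatMap-labels-bullets zero    T = ListP.++-identityʳ (labelsL T)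
concatMap-labels-bullets (suc N) T = concatMap-labels-bullets N T

-- Isomorphic forests have the same multiset of labels, and since the labels of `T0` are distinct,
-- this multiset tells which vertices are present. Conversely, sets that agree on the vertices of
-- `T0` give literally equal forests.
isoF-embed : ∀ {k} (T0 : RTree k) → Unique (labelsL T0) → ∀ {S S′} → IsRootedSubtree T0 S → IsRootedSubtree T0 S′ →
  isoF (embed T0 S′) (embed T0 S) ≡ sameSet (addrsR T0) S S′
isoF-embed T0 uL {S} {S′} sub sub′ = bool-ext to from
  where
  Z = labelled [] 0 T0
  uZ : Unique (map proj₂ Z)
  uZ rewrite map-proj₂-labelled [] 0 T0 = uL
  labels-↭ : isoF (embed T0 S′) (embed T0 S) ≡ true →
    map proj₂ (filterᵇ (S′ ∘ proj₁) Z) ↭ map proj₂ (filterᵇ (S ∘ proj₁) Z)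
  labels-↭ eq = ≡.subst₂ _↭_ (labels S′ sub′) (labels S sub) (isoF-labels (embed T0 S′) (embed T0 S) eq)
    where
    labels : ∀ R → IsRootedSubtree T0 R → concatMap labelsL (embed T0 R) ≡ map proj₂ (filterᵇ (R ∘ proj₁) Z)
    labels R subR = ≡.trans (concatMap-labels-bullets (sizeR T0 ∸ length (members (addrsR T0) R)) (induce T0 R))
      (labelsL-induceL (closed subR) [] 0 T0)
  to : isoF (embed T0 S′) (embed T0 S) ≡ true → sameSet (addrsR T0) S S′ ≡ true
  to eq = sameSet⁺ (addrsR T0) agree
    where
    agree : ∀ {a} → a ∈ addrsR T0 → S a ≡ S′ a
    agree (here refl) = ≡.trans (root∈ sub) (sym (root∈ sub′))
    agree (there a∈) with ∈-map⁻ proj₁ (subst (_ ∈_) (sym (map-proj₁-labelled [] 0 T0)) a∈)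
    ... | z , z∈ , refl = bool-ext
      (filterᵇ-labels-⊆ proj₂ (S ∘ proj₁) (S′ ∘ proj₁) uZ (↭-sym (labels-↭ eq)) z∈)
      (filterᵇ-labels-⊆ proj₂ (S′ ∘ proj₁) (S ∘ proj₁) uZ (labels-↭ eq) z∈)
  from : sameSet (addrsR T0) S S′ ≡ true → isoF (embed T0 S′) (embed T0 S) ≡ true
  from eq rewrite embed-cong T0 (sameSet⁻ {S} {S′} (addrsR T0) eq) = isoF-refl (embed T0 S′)

-- Deleting a leaf of an induced subtree

removeV-self : ∀ S u → removeV S u u ≡ false
removeV-self S u rewrite ==ₐ-refl u = BoolP.∧-zeroʳ (S u)

removeV-other : ∀ S {u a} → a ≢ u → removeV S u a ≡ S a
removeV-other S {u} {a} a≢u rewrite ≢⇒==ₐ-false a≢u = BoolP.∧-identityʳ (S a)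

removeV⁻ : ∀ S {u a} → removeV S u a ≡ true → S a ≡ true × a ≢ u
removeV⁻ S {u} {a} eq = BoolP.∧-conicalˡ _ _ eq ,
  λ { refl → contradiction (≡.trans (sym eq) (removeV-self S u)) (λ ()) }

module _ {k : ℕ} {p : Addr} {i : ℕ} {a : Fin k} {cs ts : List (LTree k)} where

  private
    v = i ∷ p

  self∉siblings : v ∉ addrsL p (suc i) ts
  self∉siblings v∈ = Unique-head (addrsL-unique p i (node a [] ∷ ts)) v∈

  self∉children : v ∉ addrsL v 0 cs
  self∉children v∈ = Unique-head (addrsL-unique p i (node a cs ∷ ts)) (∈-++⁺ˡ v∈)

  children∉siblings : ∀ {w} → w ∈ addrsL v 0 cs → w ∉ addrsL p (suc i) ts
  children∉siblings w∈ w∈′ with ∈-addrsL v 0 cs w∈ | ∈-addrsL p (suc i) ts w∈′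
  ... | _ , _ , q | j , i<j , r = ℕP.<⇒≢ i<j (siblings-≡ (⊑-parent q) r)

-- Lists the leaves in the order in which `delL` deletes them, so that `delL-induceL` is an equality
-- of lists. A vertex is a leaf when no child of it is induced, even if it has children in `T0`.
leavesL : ∀ {k} → VSet → Addr → ℕ → List (LTree k) → List Addr
leavesL S p i [] = []
leavesL S p i (node a cs ∷ ts) with S (i ∷ p) | induceL S (i ∷ p) 0 cs
... | false | _     = leavesL S p (suc i) ts
... | true  | []    = (i ∷ p) ∷ leavesL S p (suc i) ts
... | true  | _ ∷ _ = leavesL S (i ∷ p) 0 cs ++ leavesL S p (suc i) ts

leavesL-⊆ : ∀ {k S} p i (ts : List (LTree k)) {ℓ} → ℓ ∈ leavesL S p i ts → ℓ ∈ addrsL p i ts × S ℓ ≡ true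
leavesL-⊆ {S = S} p i (node a cs ∷ ts) ℓ∈ with S (i ∷ p) in eq | induceL S (i ∷ p) 0 cs
... | false | _ with leavesL-⊆ p (suc i) ts ℓ∈
...   | q , Sℓ = there (∈-++⁺ʳ (addrsL (i ∷ p) 0 cs) q) , Sℓ
leavesL-⊆ p i (node a cs ∷ ts) (here refl) | true | [] = here refl , eq
leavesL-⊆ p i (node a cs ∷ ts) (there ℓ∈)  | true | [] with leavesL-⊆ p (suc i) ts ℓ∈
... | q , Sℓ = there (∈-++⁺ʳ (addrsL (i ∷ p) 0 cs) q) , Sℓ
leavesL-⊆ {S = S} p i (node a cs ∷ ts) ℓ∈ | true | _ ∷ _ with ∈-++⁻ (leavesL S (i ∷ p) 0 cs) ℓ∈
... | inj₁ r with leavesL-⊆ (i ∷ p) 0 cs r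
...   | q , Sℓ = there (∈-++⁺ˡ q) , Sℓ
leavesL-⊆ {S = S} p i (node a cs ∷ ts) ℓ∈ | true | _ ∷ _ | inj₂ r with leavesL-⊆ p (suc i) ts r
... | q , Sℓ = there (∈-++⁺ʳ (addrsL (i ∷ p) 0 cs) q) , Sℓ

induceL-removeV-outside : ∀ {k S ℓ} p i (ts : List (LTree k)) → ℓ ∉ addrsL p i ts →
  induceL (removeV S ℓ) p i ts ≡ induceL S p i ts
induceL-removeV-outside {S = S} p i ts ℓ∉ = induceL-cong p i ts (λ a∈ → removeV-other S (λ { refl → ℓ∉ a∈ }))

module _ {k : ℕ} (S : VSet) (p : Addr) (i : ℕ) (a : Fin k) (cs ts : List (LTree k)) where

  private
    v = i ∷ p

  induceL-absent : S v ≡ false → induceL S p i (node a cs ∷ ts) ≡ induceL S p (suc i) ts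
  induceL-absent Sv rewrite Sv = refl

  induceL-present : S v ≡ true →
    induceL S p i (node a cs ∷ ts) ≡ node a (induceL S v 0 cs) ∷ induceL S p (suc i) ts
  induceL-present Sv rewrite Sv = refl

  leavesL-absent : S v ≡ false → leavesL S p i (node a cs ∷ ts) ≡ leavesL S p (suc i) ts
  leavesL-absent Sv rewrite Sv = refl

  leavesL-leaf : S v ≡ true → induceL S v 0 cs ≡ [] →
    leavesL S p i (node a cs ∷ ts) ≡ v ∷ leavesL S p (suc i) ts
  leavesL-leaf Sv eq rewrite Sv | eq = refl

  leavesL-inner : ∀ {d ds} → S v ≡ true → induceL S v 0 cs ≡ d ∷ ds →
    leavesL S p i (node a cs ∷ ts) ≡ leavesL S v 0 cs ++ leavesL S p (suc i) ts
  leavesL-inner Sv eq rewrite Sv | eq = refl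

  -- The three cases of `leavesL` together with their equations. Goals below contain `S` and
  -- `removeV S ℓ` side by side, so they are rewritten by explicit equations instead of abstracting
  -- over `S v`.
  data NodeView : Set where
    absent : S v ≡ false → NodeView
    leaf   : S v ≡ true → induceL S v 0 cs ≡ [] → NodeView
    inner  : ∀ {d ds} → S v ≡ true → induceL S v 0 cs ≡ d ∷ ds → NodeView

  nodeView : NodeView
  nodeView with S v in eq
  ... | false = absent eq
  ... | true with induceL S v 0 cs in eqc
  ...   | []     = leaf eq eqc
  ...   | d ∷ ds = inner eq eqc

module _ {k : ℕ} (S : VSet) (p : Addr) (i : ℕ) (a : Fin k) (cs ts : List (LTree k)) where

  private
    v = i ∷ p

  removeV-absent : ∀ {ℓ} → S v ≡ false →
    induceL (removeV S ℓ) p i (node a cs ∷ ts) ≡ induceL (removeV S ℓ) p (suc i) ts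
  removeV-absent {ℓ} Sv = induceL-absent (removeV S ℓ) p i a cs ts (cong (_∧ not (v ==ₐ ℓ)) Sv)

  removeV-node : induceL (removeV S v) p i (node a cs ∷ ts) ≡ induceL S p (suc i) ts
  removeV-node = ≡.trans (induceL-absent (removeV S v) p i a cs ts (removeV-self S v))
    (induceL-removeV-outside p (suc i) ts (self∉siblings {a = a} {cs = cs}))

  removeV-child : ∀ {ℓ} → S v ≡ true → ℓ ∈ addrsL v 0 cs →
    induceL (removeV S ℓ) p i (node a cs ∷ ts) ≡ node a (induceL (removeV S ℓ) v 0 cs) ∷ induceL S p (suc i) ts
  removeV-child {ℓ} Sv ℓ∈ = ≡.trans
    (induceL-present (removeV S ℓ) p i a cs ts
      (≡.trans (removeV-other S (λ { refl → self∉children {a = a} {ts = ts} ℓ∈ })) Sv))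
    (cong (node a (induceL (removeV S ℓ) v 0 cs) ∷_)
      (induceL-removeV-outside p (suc i) ts (children∉siblings {a = a} ℓ∈)))

  removeV-sibling : ∀ {ℓ} → S v ≡ true → ℓ ∈ addrsL p (suc i) ts →
    induceL (removeV S ℓ) p i (node a cs ∷ ts) ≡ node a (induceL S v 0 cs) ∷ induceL (removeV S ℓ) p (suc i) ts
  removeV-sibling {ℓ} Sv ℓ∈ = ≡.trans
    (induceL-present (removeV S ℓ) p i a cs ts
      (≡.trans (removeV-other S (λ { refl → self∉siblings {a = a} {cs = cs} ℓ∈ })) Sv))
    (cong (λ ds → node a ds ∷ induceL (removeV S ℓ) p (suc i) ts)
      (induceL-removeV-outside v 0 cs (λ ℓ∈′ → children∉siblings {a = a} ℓ∈′ ℓ∈)))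

length≡0⇒[] : ∀ {A : Set} (xs : List A) → length xs ≡ 0 → xs ≡ []
length≡0⇒[] [] _ = refl

map-cong-∈ : ∀ {A B : Set} {f g : A → B} xs → (∀ {x} → x ∈ xs → f x ≡ g x) → map f xs ≡ map g xs
map-cong-∈ xs eq = ListP.map-cong-local (All.tabulate eq)

-- The passage from the algebra to the firing model: the coproduct deletes a leaf of a tree, a
-- cascade removes an address from a set of positions.
delL-induceL : ∀ {k} S p i (ts : List (LTree k)) →
  delL (induceL S p i ts) ≡ map (λ ℓ → induceL (removeV S ℓ) p i ts) (leavesL S p i ts)
delL-induceL S p i [] = refl
delL-induceL {k} S p i (node a cs ∷ ts) with nodeView S p i a cs ts
... | absent Sv = begin
  delL (induceL S p i (node a cs ∷ ts))
    ≡⟨ cong delL (induceL-absent S p i a cs ts Sv) ⟩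
  delL (induceL S p (suc i) ts)
    ≡⟨ delL-induceL S p (suc i) ts ⟩
  map (λ ℓ → induceL (removeV S ℓ) p (suc i) ts) (leavesL S p (suc i) ts)
    ≡⟨ map-cong-∈ (leavesL S p (suc i) ts) (λ _ → sym (removeV-absent S p i a cs ts Sv)) ⟩
  map (λ ℓ → induceL (removeV S ℓ) p i (node a cs ∷ ts)) (leavesL S p (suc i) ts)
    ≡⟨ cong (map _) (leavesL-absent S p i a cs ts Sv) ⟨
  map (λ ℓ → induceL (removeV S ℓ) p i (node a cs ∷ ts)) (leavesL S p i (node a cs ∷ ts)) ∎
... | leaf Sv c≡[] = begin
  delL (induceL S p i (node a cs ∷ ts))
    ≡⟨ cong delL (≡.trans (induceL-present S p i a cs ts Sv) (cong (λ ds → node a ds ∷ induceL S p (suc i) ts) c≡[])) ⟩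
  induceL S p (suc i) ts ∷ map (node a [] ∷_) (delL (induceL S p (suc i) ts))
    ≡⟨ cong (λ us → induceL S p (suc i) ts ∷ map (node a [] ∷_) us) (delL-induceL S p (suc i) ts) ⟩
  induceL S p (suc i) ts ∷ map (node a [] ∷_) (map (λ ℓ → induceL (removeV S ℓ) p (suc i) ts) (leavesL S p (suc i) ts))
    ≡⟨ cong₂ _∷_ (sym (removeV-node S p i a cs ts)) (≡.trans (sym (ListP.map-∘ (leavesL S p (suc i) ts)))
         (map-cong-∈ (leavesL S p (suc i) ts) (λ ℓ∈ → sym
           (≡.trans (removeV-sibling S p i a cs ts Sv (proj₁ (leavesL-⊆ p (suc i) ts ℓ∈))) (cong (λ ds → node a ds ∷ induceL (removeV S _) p (suc i) ts) c≡[]))))) ⟩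
  map (λ ℓ → induceL (removeV S ℓ) p i (node a cs ∷ ts)) ((i ∷ p) ∷ leavesL S p (suc i) ts)
    ≡⟨ cong (map _) (leavesL-leaf S p i a cs ts Sv c≡[]) ⟨
  map (λ ℓ → induceL (removeV S ℓ) p i (node a cs ∷ ts)) (leavesL S p i (node a cs ∷ ts)) ∎
... | inner {d} {ds} Sv c≡ = begin
  delL (induceL S p i (node a cs ∷ ts))
    ≡⟨ cong delL (≡.trans (induceL-present S p i a cs ts Sv) (cong (λ ds → node a ds ∷ induceL S p (suc i) ts) c≡)) ⟩
  map (λ es → node a es ∷ induceL S p (suc i) ts) (delL (d ∷ ds)) ++ map (node a (d ∷ ds) ∷_) (delL (induceL S p (suc i) ts))
    ≡⟨ cong (λ es → map (λ es → node a es ∷ induceL S p (suc i) ts) (delL es) ++ map (node a es ∷_) (delL (induceL S p (suc i) ts))) c≡ ⟨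
  map (λ es → node a es ∷ induceL S p (suc i) ts) (delL (induceL S (i ∷ p) 0 cs))
    ++ map (node a (induceL S (i ∷ p) 0 cs) ∷_) (delL (induceL S p (suc i) ts))
    ≡⟨ cong₂ (λ us ws → map (λ es → node a es ∷ induceL S p (suc i) ts) us ++ map (node a (induceL S (i ∷ p) 0 cs) ∷_) ws)
         (delL-induceL S (i ∷ p) 0 cs) (delL-induceL S p (suc i) ts) ⟩
  map (λ es → node a es ∷ induceL S p (suc i) ts) (map (λ ℓ → induceL (removeV S ℓ) (i ∷ p) 0 cs) (leavesL S (i ∷ p) 0 cs))
    ++ map (node a (induceL S (i ∷ p) 0 cs) ∷_) (map (λ ℓ → induceL (removeV S ℓ) p (suc i) ts) (leavesL S p (suc i) ts))
    ≡⟨ cong₂ _++_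
         (≡.trans (sym (ListP.map-∘ (leavesL S (i ∷ p) 0 cs)))
           (map-cong-∈ (leavesL S (i ∷ p) 0 cs) (λ ℓ∈ → sym (removeV-child S p i a cs ts Sv (proj₁ (leavesL-⊆ (i ∷ p) 0 cs ℓ∈))))))
         (≡.trans (sym (ListP.map-∘ (leavesL S p (suc i) ts)))
           (map-cong-∈ (leavesL S p (suc i) ts) (λ ℓ∈ → sym (removeV-sibling S p i a cs ts Sv (proj₁ (leavesL-⊆ p (suc i) ts ℓ∈)))))) ⟩
  map (λ ℓ → induceL (removeV S ℓ) p i (node a cs ∷ ts)) (leavesL S (i ∷ p) 0 cs)
    ++ map (λ ℓ → induceL (removeV S ℓ) p i (node a cs ∷ ts)) (leavesL S p (suc i) ts)
    ≡⟨ ListP.map-++ _ (leavesL S (i ∷ p) 0 cs) (leavesL S p (suc i) ts) ⟨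
  map (λ ℓ → induceL (removeV S ℓ) p i (node a cs ∷ ts)) (leavesL S (i ∷ p) 0 cs ++ leavesL S p (suc i) ts)
    ≡⟨ cong (map _) (leavesL-inner S p i a cs ts Sv c≡) ⟨
  map (λ ℓ → induceL (removeV S ℓ) p i (node a cs ∷ ts)) (leavesL S p i (node a cs ∷ ts)) ∎

sizeL-removeV-leaf : ∀ {k} S p i (ts : List (LTree k)) {ℓ} → ℓ ∈ leavesL S p i ts →
  suc (sizeL (induceL (removeV S ℓ) p i ts)) ≡ sizeL (induceL S p i ts)
sizeL-removeV-leaf S p i ts {ℓ} ℓ∈ = ∈-delL-size (induceL S p i ts)
  (subst (induceL (removeV S ℓ) p i ts ∈_) (sym (delL-induceL S p i ts)) (∈-map⁺ (λ ℓ → induceL (removeV S ℓ) p i ts) ℓ∈))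

-- Harmonic functions for the promotion step

strictDesc-node : ∀ {k} {V S p i} {a : Fin k} {cs ts} → Located V p i (node a cs ∷ ts) →
  strictDesc V S (i ∷ p) ≡ members (addrsL (i ∷ p) 0 cs) S
strictDesc-node {V = V} {S} {p} {i} loc =
  ≡.trans (filterᵇ-∧ S (strictAnc (i ∷ p)) V) (cong (filterᵇ S) (located-descendants loc))

-- If C is harmonic for the promotion step, the total of C over the positions is a
-- combination of its values β at the leaves, with coefficients the ratios of hook products.
module _ {V : List Addr} {S : VSet} (cl : Closed S) (C β : Addr → ℚ)
  (C-leaf : ∀ v → strictDesc V S v ≡ [] → C v ≡ β v)
  (C-inner : ∀ v {n} → length (strictDesc V S v) ≡ suc n → ι (suc n) * C v ≡ ∑ (strictDesc V S v) C) where

  ∑-harmonic : ∀ {k} p i (ts : List (LTree k)) → Located V p i ts → (γ : Addr → ℚ) →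
    (∀ {ℓ} → ℓ ∈ leavesL S p i ts → β ℓ ≡ ι (hooksL (induceL (removeV S ℓ) p i ts)) * γ ℓ) →
    ∑ (members (addrsL p i ts) S) C ≡ ι (hooksL (induceL S p i ts)) * ∑ (leavesL S p i ts) γ
  ∑-harmonic p i [] loc γ βγ = sym (ℚP.*-zeroʳ (ι 1))
  ∑-harmonic p i (node a cs ∷ ts) loc γ βγ with nodeView S p i a cs ts
  ... | absent Sv = begin
    ∑ (members (v ∷ addrsL v 0 cs ++ addrsL p (suc i) ts) S) C
      ≡⟨ cong (λ M → ∑ M C) (≡.trans (filterᵇ-reject S _ Sv)
           (≡.trans (filterᵇ-++ S (addrsL v 0 cs) _) (cong (_++ members (addrsL p (suc i) ts) S) (members-below-absent cs cl Sv)))) ⟩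
    ∑ (members (addrsL p (suc i) ts) S) C
      ≡⟨ ∑-harmonic p (suc i) ts (located-siblings loc) γ (λ {ℓ} ℓ∈ →
           ≡.trans (βγ (subst (ℓ ∈_) (sym leaves≡) ℓ∈)) (cong (λ us → ι (hooksL us) * γ ℓ) (removeV-absent S p i a cs ts Sv))) ⟩
    ι (hooksL (induceL S p (suc i) ts)) * ∑ (leavesL S p (suc i) ts) γ
      ≡⟨ cong₂ (λ us L → ι (hooksL us) * ∑ L γ) (sym (induceL-absent S p i a cs ts Sv)) (sym leaves≡) ⟩
    ι (hooksL (induceL S p i (node a cs ∷ ts))) * ∑ (leavesL S p i (node a cs ∷ ts)) γ ∎
    where
    v = i ∷ p
    leaves≡ = leavesL-absent S p i a cs ts Sv
  ... | leaf Sv c≡[] = begin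
    ∑ (members (v ∷ addrsL v 0 cs ++ addrsL p (suc i) ts) S) C
      ≡⟨ cong (λ M → ∑ M C) (≡.trans (filterᵇ-accept S _ Sv) (cong (v ∷_)
           (≡.trans (filterᵇ-++ S (addrsL v 0 cs) _) (cong (_++ members (addrsL p (suc i) ts) S) children≡[])))) ⟩
    C v + ∑ (members (addrsL p (suc i) ts) S) C
      ≡⟨ cong₂ _+_ (≡.trans (C-leaf v (≡.trans (strictDesc-node loc) children≡[]))
             (≡.trans (βγ (subst (v ∈_) (sym leaves≡) (here refl))) (cong (λ us → ι (hooksL us) * γ v) (removeV-node S p i a cs ts))))
           (∑-harmonic p (suc i) ts (located-siblings loc) γ βγ′) ⟩
    ι H * γ v + ι H * ∑ (leavesL S p (suc i) ts) γ
      ≡⟨ ℚP.*-distribˡ-+ (ι H) (γ v) _ ⟨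
    ι H * ∑ (v ∷ leavesL S p (suc i) ts) γ
      ≡⟨ cong₂ (λ h L → ι h * ∑ L γ) (sym (≡.trans (cong hooksL whole≡) (ℕP.*-identityˡ H))) (sym leaves≡) ⟩
    ι (hooksL (induceL S p i (node a cs ∷ ts))) * ∑ (leavesL S p i (node a cs ∷ ts)) γ ∎
    where
    v : Addr
    v = i ∷ p
    H : ℕ
    H = hooksL (induceL S p (suc i) ts)
    leaves≡ = leavesL-leaf S p i a cs ts Sv c≡[]
    whole≡ : induceL S p i (node a cs ∷ ts) ≡ node a [] ∷ induceL S p (suc i) ts
    whole≡ = ≡.trans (induceL-present S p i a cs ts Sv) (cong (λ ds → node a ds ∷ induceL S p (suc i) ts) c≡[])
    children≡[] : members (addrsL v 0 cs) S ≡ []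
    children≡[] = length≡0⇒[] (members (addrsL v 0 cs) S) (≡.trans (sym (sizeL-induceL cl v 0 cs)) (cong sizeL c≡[]))
    βγ′ : ∀ {ℓ} → ℓ ∈ leavesL S p (suc i) ts → β ℓ ≡ ι (hooksL (induceL (removeV S ℓ) p (suc i) ts)) * γ ℓ
    βγ′ {ℓ} ℓ∈ = ≡.trans (βγ (subst (ℓ ∈_) (sym leaves≡) (there ℓ∈))) (cong (λ h → ι h * γ ℓ)
      (≡.trans (cong hooksL (≡.trans (removeV-sibling S p i a cs ts Sv (proj₁ (leavesL-⊆ p (suc i) ts ℓ∈))) (cong (λ ds → node a ds ∷ induceL (removeV S _) p (suc i) ts) c≡[])))
             (ℕP.*-identityˡ _)))
  ... | inner {d} {ds} Sv c≡ = begin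
    ∑ (members (v ∷ addrsL v 0 cs ++ addrsL p (suc i) ts) S) C
      ≡⟨ cong (λ M → ∑ M C) (≡.trans (filterᵇ-accept S _ Sv) (cong (v ∷_) (filterᵇ-++ S (addrsL v 0 cs) _))) ⟩
    C v + ∑ (members (addrsL v 0 cs) S ++ members (addrsL p (suc i) ts) S) C
      ≡⟨ cong (_+_ (C v)) (∑-++ (members (addrsL v 0 cs) S) _ C) ⟩
    C v + (∑ (members (addrsL v 0 cs) S) C + ∑ (members (addrsL p (suc i) ts) S) C)
      ≡⟨ cong₂ (λ c g → c + (g + ∑ (members (addrsL p (suc i) ts) S) C)) C≡ children≡ ⟩
    ι Hc * ι Ht * Γc + (ι n * (ι Hc * ι Ht * Γc) + ∑ (members (addrsL p (suc i) ts) S) C)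
      ≡⟨ cong (λ g → ι Hc * ι Ht * Γc + (ι n * (ι Hc * ι Ht * Γc) + g)) siblings≡ ⟩
    ι Hc * ι Ht * Γc + (ι n * (ι Hc * ι Ht * Γc) + ι Ht * ((1ℚ + ι n) * ι Hc * Γt))
      ≡⟨ solve 5 (λ n c t x y → c :* t :* x :+ (n :* (c :* t :* x) :+ t :* ((con 1ℚ :+ n) :* c :* y)) := (con 1ℚ :+ n) :* c :* t :* (x :+ y))
           refl (ι n) (ι Hc) (ι Ht) Γc Γt ⟩
    (1ℚ + ι n) * ι Hc * ι Ht * (Γc + Γt)
      ≡⟨ cong₂ _*_ (sym hooks≡) (sym (∑-++ (leavesL S v 0 cs) _ γ)) ⟩
    ι (hooksL (node a cs′ ∷ ts′)) * ∑ (leavesL S v 0 cs ++ leavesL S p (suc i) ts) γ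
      ≡⟨ cong₂ (λ us L → ι (hooksL us) * ∑ L γ) (sym (induceL-present S p i a cs ts Sv)) (sym leaves≡) ⟩
    ι (hooksL (induceL S p i (node a cs ∷ ts))) * ∑ (leavesL S p i (node a cs ∷ ts)) γ ∎
    where
    v : Addr
    v = i ∷ p
    cs′ ts′ : List (LTree _)
    cs′ = induceL S v 0 cs
    ts′ = induceL S p (suc i) ts
    n Hc Ht : ℕ
    n  = sizeL cs′
    Hc = hooksL cs′
    Ht = hooksL ts′
    Γc Γt : ℚ
    Γc = ∑ (leavesL S v 0 cs) γ
    Γt = ∑ (leavesL S p (suc i) ts) γ
    leaves≡ = leavesL-inner S p i a cs ts Sv c≡
    n≢0 : ℕ.NonZero n
    n≢0 = subst (λ es → ℕ.NonZero (sizeL es)) (sym c≡) (size-nonZero d ds)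
      where
      size-nonZero : ∀ (d : LTree _) ds → ℕ.NonZero (sizeL (d ∷ ds))
      size-nonZero (node _ _) _ = _
    hooks≡ : ι (hooksL (node a cs′ ∷ ts′)) ≡ (1ℚ + ι n) * ι Hc * ι Ht
    hooks≡ = begin
      ι (suc n ℕ.* Hc ℕ.* Ht)       ≡⟨ ι-* (suc n ℕ.* Hc) Ht ⟩
      ι (suc n ℕ.* Hc) * ι Ht       ≡⟨ cong (_* ι Ht) (ι-* (suc n) Hc) ⟩
      ι (suc n) * ι Hc * ι Ht       ≡⟨ cong (λ s → s * ι Hc * ι Ht) (ι-suc n) ⟩
      (1ℚ + ι n) * ι Hc * ι Ht      ∎
    -- Deleting a leaf below `v` lowers the hook of `v` from `suc n` to `n`. For the recursive call
    -- this `n` and the hooks of the siblings are moved into the weight of the leaf.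
    βc : ∀ {ℓ} → ℓ ∈ leavesL S v 0 cs → β ℓ ≡ ι (hooksL (induceL (removeV S ℓ) v 0 cs)) * (ι n * ι Ht * γ ℓ)
    βc {ℓ} ℓ∈ = begin
      β ℓ
        ≡⟨ βγ (subst (ℓ ∈_) (sym leaves≡) (∈-++⁺ˡ ℓ∈)) ⟩
      ι (hooksL (induceL (removeV S ℓ) p i (node a cs ∷ ts))) * γ ℓ
        ≡⟨ cong (λ us → ι (hooksL us) * γ ℓ) (removeV-child S p i a cs ts Sv (proj₁ (leavesL-⊆ v 0 cs ℓ∈))) ⟩
      ι (suc (sizeL rem) ℕ.* hooksL rem ℕ.* Ht) * γ ℓ
        ≡⟨ cong (λ s → ι (s ℕ.* hooksL rem ℕ.* Ht) * γ ℓ) (sizeL-removeV-leaf S v 0 cs ℓ∈) ⟩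
      ι (n ℕ.* hooksL rem ℕ.* Ht) * γ ℓ
        ≡⟨ cong (_* γ ℓ) (≡.trans (ι-* (n ℕ.* hooksL rem) Ht) (cong (_* ι Ht) (ι-* n (hooksL rem)))) ⟩
      ι n * ι (hooksL rem) * ι Ht * γ ℓ
        ≡⟨ solve 4 (λ n r t g → n :* r :* t :* g := r :* (n :* t :* g)) refl (ι n) (ι (hooksL rem)) (ι Ht) (γ ℓ) ⟩
      ι (hooksL rem) * (ι n * ι Ht * γ ℓ) ∎
      where
      rem : List (LTree _)
      rem = induceL (removeV S ℓ) v 0 cs
    -- A leaf beside `v` leaves the hook of `v` and the hooks below it unchanged; they are moved
    -- into the weight.
    βt : ∀ {ℓ} → ℓ ∈ leavesL S p (suc i) ts → β ℓ ≡ ι (hooksL (induceL (removeV S ℓ) p (suc i) ts)) * ((1ℚ + ι n) * ι Hc * γ ℓ)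
    βt {ℓ} ℓ∈ = begin
      β ℓ
        ≡⟨ βγ (subst (ℓ ∈_) (sym leaves≡) (∈-++⁺ʳ (leavesL S v 0 cs) ℓ∈)) ⟩
      ι (hooksL (induceL (removeV S ℓ) p i (node a cs ∷ ts))) * γ ℓ
        ≡⟨ cong (λ us → ι (hooksL us) * γ ℓ) (removeV-sibling S p i a cs ts Sv (proj₁ (leavesL-⊆ p (suc i) ts ℓ∈))) ⟩
      ι (suc n ℕ.* Hc ℕ.* hooksL rem) * γ ℓ
        ≡⟨ cong (_* γ ℓ) (≡.trans (ι-* (suc n ℕ.* Hc) (hooksL rem)) (cong (_* ι (hooksL rem))
             (≡.trans (ι-* (suc n) Hc) (cong (_* ι Hc) (ι-suc n))))) ⟩
      (1ℚ + ι n) * ι Hc * ι (hooksL rem) * γ ℓ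
        ≡⟨ solve 4 (λ n c r g → n :* c :* r :* g := r :* (n :* c :* g)) refl (1ℚ + ι n) (ι Hc) (ι (hooksL rem)) (γ ℓ) ⟩
      ι (hooksL rem) * ((1ℚ + ι n) * ι Hc * γ ℓ) ∎
      where
      rem : List (LTree _)
      rem = induceL (removeV S ℓ) p (suc i) ts
    children≡ : ∑ (members (addrsL v 0 cs) S) C ≡ ι n * (ι Hc * ι Ht * Γc)
    children≡ = begin
      ∑ (members (addrsL v 0 cs) S) C
        ≡⟨ ∑-harmonic v 0 cs (located-children loc) (λ ℓ → ι n * ι Ht * γ ℓ) βc ⟩
      ι Hc * ∑ (leavesL S v 0 cs) (λ ℓ → ι n * ι Ht * γ ℓ)
        ≡⟨ cong (ι Hc *_) (∑-*ˡ (ι n * ι Ht) (leavesL S v 0 cs) γ) ⟩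
      ι Hc * (ι n * ι Ht * Γc)
        ≡⟨ solve 4 (λ c n t g → c :* (n :* t :* g) := n :* (c :* t :* g)) refl (ι Hc) (ι n) (ι Ht) Γc ⟩
      ι n * (ι Hc * ι Ht * Γc) ∎
    siblings≡ : ∑ (members (addrsL p (suc i) ts) S) C ≡ ι Ht * ((1ℚ + ι n) * ι Hc * Γt)
    siblings≡ = ≡.trans (∑-harmonic p (suc i) ts (located-siblings loc) (λ ℓ → (1ℚ + ι n) * ι Hc * γ ℓ) βt)
      (cong (ι Ht *_) (∑-*ˡ ((1ℚ + ι n) * ι Hc) (leavesL S p (suc i) ts) γ))
    -- The mean over the `n` strict descendants cancels the factor `n` that `βc` brought into their
    -- total. Hence `v` and its descendants together contribute the factor `1ℚ + ι n`, the hook of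
    -- `v`.
    C≡ : C v ≡ ι Hc * ι Ht * Γc
    C≡ = harmonic-value n≢0 (≡.trans (cong length (strictDesc-node loc)) (sym (sizeL-induceL cl v 0 cs)))
           (≡.trans (cong (λ D → ∑ D C) (strictDesc-node loc)) children≡)
      where
      harmonic-value : ∀ {n x} → ℕ.NonZero n → length (strictDesc V S v) ≡ n → ∑ (strictDesc V S v) C ≡ ι n * x → C v ≡ x
      harmonic-value {suc n} {x} _ len eq = ι-cancelʳ (suc n) (begin
        C v * ι (suc n)  ≡⟨ ℚP.*-comm (C v) (ι (suc n)) ⟩
        ι (suc n) * C v  ≡⟨ C-inner v len ⟩
        ∑ (strictDesc V S v) C ≡⟨ eq ⟩
        ι (suc n) * x    ≡⟨ ℚP.*-comm (ι (suc n)) x ⟩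
        x * ι (suc n)    ∎)

-- Expectations

Ex : ∀ {A : Set} → Dist A → (A → ℚ) → ℚ
Ex d φ = ∑[ p ∈ d ] (proj₁ p * φ (proj₂ p))

Ex-cong : ∀ {A : Set} (d : Dist A) {φ ψ : A → ℚ} → (∀ {p} → p ∈ d → φ (proj₂ p) ≡ ψ (proj₂ p)) → Ex d φ ≡ Ex d ψ
Ex-cong d eq = ∑-cong d (λ {p} p∈ → cong (proj₁ p *_) (eq p∈))

Ex-return : ∀ {A : Set} (x : A) φ → Ex ((1ℚ , x) ∷ []) φ ≡ φ x
Ex-return x φ = solve 1 (λ a → con 1ℚ :* a :+ con 0ℚ := a) refl (φ x)

Ex-scale : ∀ {A : Set} c (d : Dist A) φ → Ex (scaleD c d) φ ≡ c * Ex d φ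
Ex-scale c d φ = begin
  Ex (scaleD c d) φ                              ≡⟨ ∑-map _ d _ ⟩
  ∑[ p ∈ d ] (c * proj₁ p * φ (proj₂ p))         ≡⟨ ∑-cong d (λ {p} _ → ℚP.*-assoc c (proj₁ p) (φ (proj₂ p))) ⟩
  ∑[ p ∈ d ] (c * (proj₁ p * φ (proj₂ p)))       ≡⟨ ∑-*ˡ c d _ ⟩
  c * Ex d φ                                     ∎

Ex-bind : ∀ {A B : Set} (d : Dist A) (f : A → Dist B) φ → Ex (bindD d f) φ ≡ Ex d (λ x → Ex (f x) φ)
Ex-bind d f φ = ≡.trans (∑-concatMap _ d _) (∑-cong d (λ {p} _ → Ex-scale (proj₁ p) (f (proj₂ p)) φ))

Ex-uniform : ∀ {A : Set} (xs : List A) φ → Ex (uniform xs) φ ≡ frac 1 (length xs) * ∑ xs φ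
Ex-uniform xs φ = ≡.trans (∑-map _ xs _) (∑-*ˡ (frac 1 (length xs)) xs φ)

sumℚ-map : ∀ {A : Set} (f : A → ℚ) xs → sumℚ (map f xs) ≡ ∑ xs f
sumℚ-map f []       = refl
sumℚ-map f (x ∷ xs) = cong (_+_ (f x)) (sumℚ-map f xs)

probTo-Ex : ∀ V d S′ → probTo V d S′ ≡ Ex d (λ c → 𝟙 (sameSet V (proj₁ c) S′))
probTo-Ex V d S′ = begin
  probTo V d S′
    ≡⟨ sumℚ-map proj₁ (filterᵇ (λ p → sameSet V (proj₁ (proj₂ p)) S′) d) ⟩
  ∑ (filterᵇ (λ p → sameSet V (proj₁ (proj₂ p)) S′) d) proj₁
    ≡⟨ ∑-filterᵇ (λ p → sameSet V (proj₁ (proj₂ p)) S′) d proj₁ ⟩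
  ∑[ p ∈ d ] (𝟙 (sameSet V (proj₁ (proj₂ p)) S′) * proj₁ p)
    ≡⟨ ∑-cong d (λ {p} _ → ℚP.*-comm (𝟙 (sameSet V (proj₁ (proj₂ p)) S′)) (proj₁ p)) ⟩
  Ex d (λ c → 𝟙 (sameSet V (proj₁ c) S′)) ∎

-- The expected value of a cascade

filterᵇ-length-≤ : ∀ {A : Set} (P Q : A → Bool) xs → (∀ {x} → P x ≡ true → Q x ≡ true) →
  length (filterᵇ P xs) ℕ.≤ length (filterᵇ Q xs)
filterᵇ-length-≤ P Q [] imp = z≤n
filterᵇ-length-≤ P Q (x ∷ xs) imp with P x in eqP | Q x in eqQ
... | true  | true  = s≤s (filterᵇ-length-≤ P Q xs imp)
... | true  | false = contradiction (≡.trans (sym (imp eqP)) eqQ) (λ ())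
... | false | true  = ℕP.m≤n⇒m≤1+n (filterᵇ-length-≤ P Q xs imp)
... | false | false = filterᵇ-length-≤ P Q xs imp

filterᵇ-length-< : ∀ {A : Set} (P Q : A → Bool) {xs w} → (∀ {x} → P x ≡ true → Q x ≡ true) →
  w ∈ xs → Q w ≡ true → P w ≡ false → length (filterᵇ P xs) ℕ.< length (filterᵇ Q xs)
filterᵇ-length-< P Q {x ∷ xs} imp (here refl) Qw Pw rewrite Qw | Pw = s≤s (filterᵇ-length-≤ P Q xs imp)
filterᵇ-length-< P Q {x ∷ xs} imp (there w∈) Qw Pw with P x in eqP | Q x in eqQ
... | true  | true  = s≤s (filterᵇ-length-< P Q imp w∈ Qw Pw)
... | true  | false = contradiction (≡.trans (sym (imp eqP)) eqQ) (λ ())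
... | false | true  = ℕP.m≤n⇒m≤1+n (filterᵇ-length-< P Q imp w∈ Qw Pw)
... | false | false = filterᵇ-length-< P Q imp w∈ Qw Pw

strictAnc-trans : ∀ {u v w} → strictAnc u v ≡ true → strictAnc v w ≡ true → strictAnc u w ≡ true
strictAnc-trans {u} {i ∷ v} {j ∷ w} p q = strictAnc⁺ {i = j}
  (⊑-trans (strictAnc⇒⊑ (i ∷ v) p) (strictAnc⁻ {i = j} q))

module _ (V : List Addr) (S : VSet) where

  ∈-strictDesc⁻ : ∀ {u w} → w ∈ strictDesc V S u → w ∈ V × S w ≡ true × strictAnc u w ≡ true
  ∈-strictDesc⁻ {u} {w} w∈ with ∈-filterᵇ⁻ (λ a → S a ∧ strictAnc u a) V w∈
  ... | w∈V , eq = w∈V , BoolP.∧-conicalˡ _ _ eq , BoolP.∧-conicalʳ (S w) _ eq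

  -- The inclusion is proper because `w` is a strict descendant of `u` but not of itself. Thus the
  -- number of strict descendants bounds the remaining promotions, and the fuel `length V` is never
  -- exhausted.
  strictDesc-shrinks : ∀ {u w} → w ∈ strictDesc V S u → length (strictDesc V S w) ℕ.< length (strictDesc V S u)
  strictDesc-shrinks {u} {w} w∈ with ∈-strictDesc⁻ w∈
  ... | w∈V , Sw , u<w = filterᵇ-length-< _ _ (λ {x} eq →
      cong₂ _∧_ (BoolP.∧-conicalˡ _ _ eq) (strictAnc-trans {w = x} u<w (BoolP.∧-conicalʳ (S x) _ eq)))
      w∈V (cong₂ _∧_ Sw u<w) (≡.trans (cong (S w ∧_) (¬strict-below {w} ⊑-refl)) (BoolP.∧-zeroʳ (S w)))

  strictDesc-≤ : ∀ u → length (strictDesc V S u) ℕ.≤ length V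
  strictDesc-≤ u = ListP.length-filter (BoolP.T? ∘ (λ a → S a ∧ strictAnc u a)) V

  module _ (b : VSet → ℚ) where

    cascadeEx : ℕ → Emp → Addr → List Addr → ℚ
    cascadeEx f e u ws = Ex (cascadeWith V f (S , e) u ws) (b ∘ proj₁)

    cascadeEx-suc : ∀ f e u w ws → cascadeEx (suc f) e u (w ∷ ws) ≡
      frac 1 (suc (length ws)) * ∑[ w′ ∈ w ∷ ws ] cascadeEx f (setEmp e u (e w′)) w′ (strictDesc V S w′)
    cascadeEx-suc f e u w ws = ≡.trans (Ex-bind (uniform (w ∷ ws)) next (b ∘ proj₁))
      (Ex-uniform (w ∷ ws) (λ w′ → Ex (next w′) (b ∘ proj₁)))
      where
      next : Addr → Dist Config
      next w′ = cascadeWith V f (S , setEmp e u (e w′)) w′ (strictDesc V S w′)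

    -- Surplus fuel changes nothing, and the employees do not matter because `b` sees only the set
    -- of positions. Both are varied together, since a promotion consumes fuel and moves an employee
    -- at once.
    cascadeEx-fuel : ∀ f f′ e e′ u ws → (∀ {w} → w ∈ ws → length (strictDesc V S w) ℕ.< length ws) →
      length ws ℕ.≤ f → length ws ℕ.≤ f′ → cascadeEx f e u ws ≡ cascadeEx f′ e′ u ws
    cascadeEx-fuel f       f′       e e′ u []       dec _ _ = refl
    cascadeEx-fuel (suc f) (suc f′) e e′ u (w ∷ ws) dec (s≤s n≤f) (s≤s n≤f′) = begin
      cascadeEx (suc f) e u (w ∷ ws)
        ≡⟨ cascadeEx-suc f e u w ws ⟩
      frac 1 (suc (length ws)) * ∑[ w′ ∈ w ∷ ws ] cascadeEx f (setEmp e u (e w′)) w′ (strictDesc V S w′)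
        ≡⟨ cong (frac 1 (suc (length ws)) *_) (∑-cong (w ∷ ws) (λ {w′} w∈ →
             cascadeEx-fuel f f′ _ _ w′ (strictDesc V S w′) strictDesc-shrinks
               (ℕP.≤-trans (ℕP.≤-pred (dec w∈)) n≤f) (ℕP.≤-trans (ℕP.≤-pred (dec w∈)) n≤f′))) ⟩
      frac 1 (suc (length ws)) * ∑[ w′ ∈ w ∷ ws ] cascadeEx f′ (setEmp e′ u (e′ w′)) w′ (strictDesc V S w′)
        ≡⟨ cascadeEx-suc f′ e′ u w ws ⟨
      cascadeEx (suc f′) e′ u (w ∷ ws) ∎

    cascadeValue : Emp → Addr → ℚ
    cascadeValue e u = Ex (cascade V (S , e) u) (b ∘ proj₁)

    cascadeValue-leaf : ∀ e u → strictDesc V S u ≡ [] → cascadeValue e u ≡ b (removeV S u)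
    cascadeValue-leaf e u eq = ≡.trans (cong (cascadeEx (length V) e u) eq) (Ex-return {A = Config} (removeV S u , e) (b ∘ proj₁))

    -- The first promotion, with the denominator cleared. Afterwards `cascadeEx-fuel` restores the
    -- full fuel and the original employees, so that the same function `cascadeValue e` appears on
    -- both sides.
    cascadeValue-inner : ∀ e u {n} → length (strictDesc V S u) ≡ suc n →
      ι (suc n) * cascadeValue e u ≡ ∑ (strictDesc V S u) (cascadeValue e)
    cascadeValue-inner e u {n} len with length V in lenV | strictDesc V S u in sd | strictDesc-≤ u
    ... | suc f | w ∷ ws | s≤s n≤f = begin
      ι (suc n) * cascadeEx (suc f) e u (w ∷ ws)
        ≡⟨ cong (ι (suc n) *_) (cascadeEx-suc f e u w ws) ⟩
      ι (suc n) * (frac 1 (suc (length ws)) * s)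
        ≡⟨ cong (λ l → ι (suc n) * (frac 1 l * s)) len ⟩
      ι (suc n) * (frac 1 (suc n) * s)
        ≡⟨ solve 3 (λ a b c → a :* (b :* c) := b :* a :* c) refl (ι (suc n)) (frac 1 (suc n)) s ⟩
      frac 1 (suc n) * ι (suc n) * s
        ≡⟨ cong (_* s) (frac-inverse (suc n)) ⟩
      1ℚ * s
        ≡⟨ ℚP.*-identityˡ s ⟩
      s
        ≡⟨ ∑-cong (w ∷ ws) (λ {w′} w∈ → cascadeEx-fuel f (length V) _ e w′ (strictDesc V S w′) strictDesc-shrinks
             (ℕP.≤-trans (ℕP.≤-pred (shrinks w∈)) n≤f) (strictDesc-≤ w′)) ⟩
      ∑[ w′ ∈ w ∷ ws ] cascadeEx (length V) e w′ (strictDesc V S w′)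
        ≡⟨ cong (λ l → ∑[ w′ ∈ w ∷ ws ] cascadeEx l e w′ (strictDesc V S w′)) lenV ⟩
      ∑[ w′ ∈ w ∷ ws ] cascadeEx (suc f) e w′ (strictDesc V S w′) ∎
      where
      s : ℚ
      s = ∑[ w′ ∈ w ∷ ws ] cascadeEx f (setEmp e u (e w′)) w′ (strictDesc V S w′)
      shrinks : ∀ {w′} → w′ ∈ w ∷ ws → length (strictDesc V S w′) ℕ.< suc (length ws)
      shrinks {w′} w∈ = subst (λ D → length (strictDesc V S w′) ℕ.< length D) sd
        (strictDesc-shrinks (subst (w′ ∈_) (sym sd) w∈))

-- Positions and employees after a cascade

∈-members⁺ : ∀ {V S u} → u ∈ V → S u ≡ true → u ∈ members V S
∈-members⁺ {S = S} = ∈-filterᵇ⁺ S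

∈-members⁻ : ∀ {V S u} → u ∈ members V S → u ∈ V × S u ≡ true
∈-members⁻ {V} {S} = ∈-filterᵇ⁻ S V

members-removeV-↭ : ∀ {V S u} → Unique V → u ∈ V → S u ≡ true → members V S ↭ u ∷ members V (removeV S u)
members-removeV-↭ {x ∷ V} {S} {u} uV (here refl) Su
  rewrite filterᵇ-accept S V Su | filterᵇ-reject (removeV S u) V (removeV-self S u) =
  prep u (↭-reflexive (filterᵇ-cong V (λ a∈ → sym (removeV-other S (λ { refl → Unique-head uV a∈ })))))
members-removeV-↭ {x ∷ V} {S} {u} uV@(_ ∷ uV′) (there u∈) Su = byCases (S x) refl
  where
  kept : removeV S u x ≡ S x
  kept = removeV-other S (λ { refl → Unique-head uV u∈ })
  byCases : ∀ b → S x ≡ b → members (x ∷ V) S ↭ u ∷ members (x ∷ V) (removeV S u)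
  byCases true Sx = ≡.subst₂ (λ M N → M ↭ u ∷ N)
    (sym (filterᵇ-accept S V Sx)) (sym (filterᵇ-accept (removeV S u) V (≡.trans kept Sx)))
    (trans (prep x (members-removeV-↭ uV′ u∈ Su)) (swap x u ↭-refl))
  byCases false Sx = ≡.subst₂ (λ M N → M ↭ u ∷ N)
    (sym (filterᵇ-reject S V Sx)) (sym (filterᵇ-reject (removeV S u) V (≡.trans kept Sx)))
    (members-removeV-↭ uV′ u∈ Su)

members-removeV-swap : ∀ V S u w → members V (removeV (removeV S u) w) ≡ members V (removeV (removeV S w) u)
members-removeV-swap V S u w = filterᵇ-cong V (λ {a} _ → ≡.trans (BoolP.∧-assoc (S a) _ _)
  (≡.trans (cong (S a ∧_) (BoolP.∧-comm (not (a ==ₐ u)) _)) (sym (BoolP.∧-assoc (S a) _ _))))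

∈-bindD⁻ : ∀ {A B : Set} (d : Dist A) (f : A → Dist B) {r} → r ∈ bindD d f →
  ∃[ p ] ∃[ q ] (p ∈ d × q ∈ f (proj₂ p) × proj₂ r ≡ proj₂ q)
∈-bindD⁻ (p ∷ d) f r∈ with ∈-++⁻ (map (λ q → proj₁ p * proj₁ q , proj₂ q) (f (proj₂ p))) r∈
... | inj₂ r∈d with ∈-bindD⁻ d f r∈d
...   | p′ , q , p′∈ , q∈ , eq = p′ , q , there p′∈ , q∈ , eq
∈-bindD⁻ (p ∷ d) f r∈ | inj₁ r∈p with ∈-map⁻ _ r∈p
... | q , q∈ , eq = p , q , here refl , q∈ , cong proj₂ eq

∈-uniform⁻ : ∀ {A : Set} (xs : List A) {p} → p ∈ uniform xs → proj₂ p ∈ xs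
∈-uniform⁻ xs p∈ with ∈-map⁻ _ p∈
... | x , x∈ , eq = subst (_∈ xs) (sym (cong proj₂ eq)) x∈

-- What the next firing has to know: the tree has lost one leaf, and the positions left are filled
-- by the employees other than the one who was at `u`. Promotions have moved them, so only a
-- permutation can be stated.
record Outcome (V : List Addr) (S : VSet) (e : Emp) (u : Addr) (c : Config) : Set where
  field
    final     : Addr
    final∈    : final ∈ V
    final-in  : S final ≡ true
    is-leaf   : strictDesc V S final ≡ []
    set≡      : proj₁ c ≡ removeV S final
    employees : map (proj₂ c) (members V (proj₁ c)) ↭ map e (members V (removeV S u))

setEmp-self : ∀ e u x → setEmp e u x u ≡ x
setEmp-self e u x rewrite ==ₐ-refl u = refl

setEmp-other : ∀ e {u a} x → a ≢ u → setEmp e u x a ≡ e a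
setEmp-other e x a≢u rewrite ≢⇒==ₐ-false a≢u = refl

-- Both lists consist of `e w` and of the employees at the positions other than `u` and `w`; on the
-- left `e w` sits at `u`, on the right still at `w`.
promote-employees : ∀ {V S} e {u w} → Unique V → u ∈ V → S u ≡ true → w ∈ V → S w ≡ true → w ≢ u →
  map (setEmp e u (e w)) (members V (removeV S w)) ↭ map e (members V (removeV S u))
promote-employees {V} {S} e {u} {w} uV u∈ Su w∈ Sw w≢u = trans
  (↭P.map⁺ (setEmp e u (e w)) (members-removeV-↭ uV u∈ (≡.trans (removeV-other S (w≢u ∘ sym)) Su)))
  (trans (↭-reflexive middle)
    (↭-sym (↭P.map⁺ e (members-removeV-↭ uV w∈ (≡.trans (removeV-other S w≢u) Sw)))))
  where
  rest = members V (removeV (removeV S w) u)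
  middle : map (setEmp e u (e w)) (u ∷ rest) ≡ map e (w ∷ members V (removeV (removeV S u) w))
  middle = cong₂ _∷_ (setEmp-self e u (e w)) (≡.trans
    (map-cong-∈ rest (λ a∈ → setEmp-other e (e w) (proj₂ (removeV⁻ (removeV S w) (proj₂ (∈-members⁻ {V} a∈))))))
    (cong (map e) (members-removeV-swap V S w u)))

promote-outcome : ∀ {V S} e {u w c} → Unique V → u ∈ V → S u ≡ true → w ∈ strictDesc V S u →
  Outcome V S (setEmp e u (e w)) w c → Outcome V S e u c
promote-outcome {V} {S} e {u} {w} uV u∈ Su w∈ out with ∈-strictDesc⁻ V S w∈
... | w∈V , Sw , u<w = record
  { Outcome out
  ; employees = trans (Outcome.employees out) (promote-employees {S = S} e uV u∈ Su w∈V Sw w≢u)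
  }
  where
  w≢u : w ≢ u
  w≢u refl = contradiction (≡.trans (sym u<w) (¬strict-below {w} ⊑-refl)) (λ ())

cascade-outcome : ∀ {V S} → Unique V → ∀ f e u → u ∈ V → S u ≡ true → ∀ ws → ws ≡ strictDesc V S u →
  ∀ {p} → p ∈ cascadeWith V f (S , e) u ws → Outcome V S e u (proj₂ p)
cascade-outcome uV f e u u∈ Su [] eq (here refl) = record
  { final = u ; final∈ = u∈ ; final-in = Su ; is-leaf = sym eq ; set≡ = refl ; employees = ↭-refl }
cascade-outcome {V} {S} uV (suc f) e u u∈ Su (w₀ ∷ ws) eq {p} p∈ = promoted (∈-bindD⁻ (uniform (w₀ ∷ ws)) next p∈)
  where
  next : Addr → Dist Config
  next w = cascadeWith V f (S , setEmp e u (e w)) w (strictDesc V S w)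
  promoted : ∃[ d ] ∃[ q ] (d ∈ uniform (w₀ ∷ ws) × q ∈ next (proj₂ d) × proj₂ p ≡ proj₂ q) →
    Outcome V S e u (proj₂ p)
  promoted ((_ , w) , q , d∈ , q∈ , r≡q) = subst (Outcome V S e u) (sym r≡q)
    (promote-outcome e uV u∈ Su w∈
      (cascade-outcome uV f (setEmp e u (e w)) w (proj₁ w∈⁻) (proj₁ (proj₂ w∈⁻)) (strictDesc V S w) refl q∈))
    where
    w∈ : w ∈ strictDesc V S u
    w∈ = subst (w ∈_) eq (∈-uniform⁻ (w₀ ∷ ws) d∈)
    w∈⁻ : w ∈ V × S w ≡ true × strictAnc u w ≡ true
    w∈⁻ = ∈-strictDesc⁻ V S w∈

-- Random sets in random order

-- Runs over the ordered selections of `j` entries, taken by place in the list. A set of `j`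
-- employees in uniformly random order gives each of its selections the weight `1 / j !`, which is
-- the factor in `BinT2R`.
∑arrangements : ∀ {A : Set} → ℕ → List A → (List A → ℚ) → ℚ
∑arrangements zero    xs G = G []
∑arrangements (suc j) xs G = ∑[ p ∈ picks xs ] ∑arrangements j (proj₂ p) (λ σ → G (proj₁ p ∷ σ))

∑arrangements-cong : ∀ {A : Set} j (xs : List A) {F G} → (∀ σ → F σ ≡ G σ) → ∑arrangements j xs F ≡ ∑arrangements j xs G
∑arrangements-cong zero    xs eq = eq []
∑arrangements-cong (suc j) xs eq = ∑-cong (picks xs) (λ {p} _ → ∑arrangements-cong j (proj₂ p) (λ σ → eq (proj₁ p ∷ σ)))

∑arrangements-∑ : ∀ {A B : Set} j (xs : List A) (ys : List B) (c : B → ℚ) (G : B → List A → ℚ) →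
  ∑arrangements j xs (λ σ → ∑[ y ∈ ys ] (c y * G y σ)) ≡ ∑[ y ∈ ys ] (c y * ∑arrangements j xs (G y))
∑arrangements-∑ zero    xs ys c G = refl
∑arrangements-∑ (suc j) xs ys c G = begin
  ∑[ p ∈ picks xs ] ∑arrangements j (proj₂ p) (λ σ → ∑[ y ∈ ys ] (c y * G y (proj₁ p ∷ σ)))
    ≡⟨ ∑-cong (picks xs) (λ {p} _ → ∑arrangements-∑ j (proj₂ p) ys c (λ y σ → G y (proj₁ p ∷ σ))) ⟩
  ∑[ p ∈ picks xs ] ∑[ y ∈ ys ] (c y * ∑arrangements j (proj₂ p) (λ σ → G y (proj₁ p ∷ σ)))
    ≡⟨ ∑-swap (picks xs) ys _ ⟩
  ∑[ y ∈ ys ] ∑[ p ∈ picks xs ] (c y * ∑arrangements j (proj₂ p) (λ σ → G y (proj₁ p ∷ σ)))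
    ≡⟨ ∑-cong ys (λ {y} _ → ∑-*ˡ (c y) (picks xs) _) ⟩
  ∑[ y ∈ ys ] (c y * ∑arrangements (suc j) xs (G y)) ∎

-- Double counting of pairs of a subset and one of its elements. It moves the choice of the first
-- fired employee in front of the choice of the set.
∑-sublists-picks : ∀ {A : Set} (xs : List A) (h : A × List A → ℚ) →
  ∑[ F ∈ sublists xs ] ∑ (picks F) h ≡ ∑[ p ∈ picks xs ] ∑[ F ∈ sublists (proj₂ p) ] h (proj₁ p , F)
∑-sublists-picks []       h = refl
∑-sublists-picks (y ∷ ys) h = begin
  ∑[ F ∈ map (y ∷_) (sublists ys) ++ sublists ys ] ∑ (picks F) h
    ≡⟨ ∑-++ (map (y ∷_) (sublists ys)) (sublists ys) _ ⟩
  ∑[ F ∈ map (y ∷_) (sublists ys) ] ∑ (picks F) h + ∑[ F ∈ sublists ys ] ∑ (picks F) h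
    ≡⟨ cong₂ _+_ with-y (∑-sublists-picks ys h) ⟩
  first + ∑[ p ∈ picks ys ] ∑[ F ∈ sublists (proj₂ p) ] h (proj₁ p , y ∷ F)
    + ∑[ p ∈ picks ys ] ∑[ F ∈ sublists (proj₂ p) ] h (proj₁ p , F)
    ≡⟨ ℚP.+-assoc first _ _ ⟩
  first + (∑[ p ∈ picks ys ] ∑[ F ∈ sublists (proj₂ p) ] h (proj₁ p , y ∷ F)
    + ∑[ p ∈ picks ys ] ∑[ F ∈ sublists (proj₂ p) ] h (proj₁ p , F))
    ≡⟨ cong (_+_ first) (≡.trans (sym (∑-+ (picks ys) _ _)) (∑-cong (picks ys) (λ {p} _ → sym (both p)))) ⟩
  first + ∑[ p ∈ picks ys ] ∑[ F ∈ sublists (y ∷ proj₂ p) ] h (proj₁ p , F)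
    ≡⟨ cong (_+_ first) (∑-map _ (picks ys) _) ⟨
  ∑[ p ∈ picks (y ∷ ys) ] ∑[ F ∈ sublists (proj₂ p) ] h (proj₁ p , F) ∎
  where
  first : ℚ
  first = ∑[ F ∈ sublists ys ] h (y , F)
  with-y : ∑[ F ∈ map (y ∷_) (sublists ys) ] ∑ (picks F) h ≡
           first + ∑[ p ∈ picks ys ] ∑[ F ∈ sublists (proj₂ p) ] h (proj₁ p , y ∷ F)
  with-y = begin
    ∑[ F ∈ map (y ∷_) (sublists ys) ] ∑ (picks F) h
      ≡⟨ ∑-map (y ∷_) (sublists ys) _ ⟩
    ∑[ F ∈ sublists ys ] ∑ (picks (y ∷ F)) h
      ≡⟨ ∑-cong (sublists ys) (λ {F} _ → cong (_+_ (h (y , F))) (∑-map _ (picks F) h)) ⟩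
    ∑[ F ∈ sublists ys ] (h (y , F) + ∑[ p ∈ picks F ] h (proj₁ p , y ∷ proj₂ p))
      ≡⟨ ∑-+ (sublists ys) _ _ ⟩
    first + ∑[ F ∈ sublists ys ] ∑[ p ∈ picks F ] h (proj₁ p , y ∷ proj₂ p)
      ≡⟨ cong (_+_ first) (∑-sublists-picks ys (λ p → h (proj₁ p , y ∷ proj₂ p))) ⟩
    first + ∑[ p ∈ picks ys ] ∑[ F ∈ sublists (proj₂ p) ] h (proj₁ p , y ∷ F) ∎
  both : ∀ p → ∑[ F ∈ sublists (y ∷ proj₂ p) ] h (proj₁ p , F) ≡
    ∑[ F ∈ sublists (proj₂ p) ] h (proj₁ p , y ∷ F) + ∑[ F ∈ sublists (proj₂ p) ] h (proj₁ p , F)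
  both p = ≡.trans (∑-++ (map (y ∷_) (sublists (proj₂ p))) (sublists (proj₂ p)) _)
    (cong (_+ _) (∑-map (y ∷_) (sublists (proj₂ p)) _))

∑-sublists-null : ∀ {A : Set} (xs : List A) → ∑[ F ∈ sublists xs ] 𝟙 (null F) ≡ 1ℚ
∑-sublists-null []       = refl
∑-sublists-null (x ∷ xs) = begin
  ∑[ F ∈ map (x ∷_) (sublists xs) ++ sublists xs ] 𝟙 (null F)
    ≡⟨ ∑-++ (map (x ∷_) (sublists xs)) (sublists xs) _ ⟩
  ∑[ F ∈ map (x ∷_) (sublists xs) ] 𝟙 (null F) + ∑[ F ∈ sublists xs ] 𝟙 (null F)
    ≡⟨ cong₂ _+_ (≡.trans (∑-map (x ∷_) (sublists xs) _) (∑-zero (sublists xs))) (∑-sublists-null xs) ⟩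
  0ℚ + 1ℚ
    ≡⟨ ℚP.+-identityˡ 1ℚ ⟩
  1ℚ ∎

length-picks : ∀ {A : Set} {xs : List A} {n p} → length xs ≡ suc n → p ∈ picks xs → length (proj₂ p) ≡ n
length-picks len p∈ = ℕP.suc-injective (≡.trans (sym (↭P.↭-length (picks-↭ p∈))) len)

-- Splitting off the first entry of the arrangement leaves a subset of the other entries. As `w`
-- depends on the size alone, the induction continues with `w ∘ suc`.
∑-sublists-perms : ∀ {A : Set} n (xs : List A) → length xs ≡ n → ∀ (w : ℕ → ℚ) P →
  ∑[ F ∈ sublists xs ] (w (length F) * ∑ (perms F) P) ≡ ∑≤ n (λ j → w j * ∑arrangements j xs P)
∑-sublists-perms zero    []  len w P = solve 2 (λ a b → a :* (b :+ con 0ℚ) :+ con 0ℚ := a :* b) refl (w 0) (P [])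
∑-sublists-perms {A} (suc n) xs len w P = begin
  ∑[ F ∈ sublists xs ] (w (length F) * ∑ (perms F) P)
    ≡⟨ ∑-cong (sublists xs) (λ {F} _ → split F) ⟩
  ∑[ F ∈ sublists xs ] (𝟙 (null F) * (w 0 * P []) + ∑ (picks F) H)
    ≡⟨ ∑-+ (sublists xs) _ _ ⟩
  ∑[ F ∈ sublists xs ] (𝟙 (null F) * (w 0 * P [])) + ∑[ F ∈ sublists xs ] ∑ (picks F) H
    ≡⟨ cong₂ _+_ empty (∑-sublists-picks xs H) ⟩
  w 0 * P [] + ∑[ p ∈ picks xs ] ∑[ F ∈ sublists (proj₂ p) ] (w (suc (length F)) * ∑[ σ ∈ perms F ] P (proj₁ p ∷ σ))
    ≡⟨ cong (_+_ (w 0 * P [])) (∑-cong (picks xs) (λ {p} p∈ →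
         ∑-sublists-perms n (proj₂ p) (length-picks len p∈) (w ∘ suc) (λ σ → P (proj₁ p ∷ σ)))) ⟩
  w 0 * P [] + ∑[ p ∈ picks xs ] ∑≤ n (λ j → w (suc j) * ∑arrangements j (proj₂ p) (λ σ → P (proj₁ p ∷ σ)))
    ≡⟨ cong (_+_ (w 0 * P [])) (∑-∑≤-swap (picks xs) n _) ⟩
  w 0 * P [] + ∑≤ n (λ j → ∑[ p ∈ picks xs ] (w (suc j) * ∑arrangements j (proj₂ p) (λ σ → P (proj₁ p ∷ σ))))
    ≡⟨ cong (_+_ (w 0 * P [])) (∑≤-cong n (λ j _ → ∑-*ˡ (w (suc j)) (picks xs) _)) ⟩
  w 0 * P [] + ∑≤ n (λ j → w (suc j) * ∑arrangements (suc j) xs P)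
    ≡⟨ ∑≤-head n (λ j → w j * ∑arrangements j xs P) ⟨
  ∑≤ (suc n) (λ j → w j * ∑arrangements j xs P) ∎
  where
  H : A × List A → ℚ
  H p = w (suc (length (proj₂ p))) * ∑[ σ ∈ perms (proj₂ p) ] P (proj₁ p ∷ σ)
  -- The empty set has one ordering but no first element, so it is missed by `picks`; the indicator
  -- term accounts for it.
  split : ∀ F → w (length F) * ∑ (perms F) P ≡ 𝟙 (null F) * (w 0 * P []) + ∑ (picks F) H
  split []       = solve 2 (λ a b → a :* (b :+ con 0ℚ) := con 1ℚ :* (a :* b) :+ con 0ℚ) refl (w 0) (P [])
  split (x ∷ F) = begin
    w (suc (length F)) * ∑ (perms (x ∷ F)) P
      ≡⟨ cong (w (suc (length F)) *_) (∑-perms-pick x F P) ⟩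
    w (suc (length F)) * ∑[ p ∈ picks (x ∷ F) ] ∑[ σ ∈ perms (proj₂ p) ] P (proj₁ p ∷ σ)
      ≡⟨ ∑-*ˡ (w (suc (length F))) (picks (x ∷ F)) _ ⟨
    ∑[ p ∈ picks (x ∷ F) ] (w (suc (length F)) * ∑[ σ ∈ perms (proj₂ p) ] P (proj₁ p ∷ σ))
      ≡⟨ ∑-cong (picks (x ∷ F)) (λ {p} p∈ → cong (λ l → w (suc l) * ∑[ σ ∈ perms (proj₂ p) ] P (proj₁ p ∷ σ))
           (sym (length-picks {xs = x ∷ F} refl p∈))) ⟩
    ∑ (picks (x ∷ F)) H
      ≡⟨ ℚP.+-identityˡ _ ⟨
    0ℚ + ∑ (picks (x ∷ F)) H
      ≡⟨ cong (_+ ∑ (picks (x ∷ F)) H) (ℚP.*-zeroˡ (w 0 * P [])) ⟨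
    0ℚ * (w 0 * P []) + ∑ (picks (x ∷ F)) H ∎
  empty : ∑[ F ∈ sublists xs ] (𝟙 (null F) * (w 0 * P [])) ≡ w 0 * P []
  empty = begin
    ∑[ F ∈ sublists xs ] (𝟙 (null F) * (w 0 * P [])) ≡⟨ ∑-*ʳ (w 0 * P []) (sublists xs) (𝟙 ∘ null) ⟩
    ∑[ F ∈ sublists xs ] 𝟙 (null F) * (w 0 * P [])   ≡⟨ cong (_* (w 0 * P [])) (∑-sublists-null xs) ⟩
    1ℚ * (w 0 * P [])                                ≡⟨ ℚP.*-identityˡ _ ⟩
    w 0 * P []                                       ∎

length-perms : ∀ {A : Set} n (xs : List A) → length xs ≡ n → length (perms xs) ≡ n !
length-perms zero    []  len = refl
length-perms (suc n) xs len = ι-injective (begin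
  ι (length (perms xs))
    ≡⟨ ∑-one (perms xs) ⟨
  ∑[ σ ∈ perms xs ] 1ℚ
    ≡⟨ ∑-perms-picks xs len _ ⟩
  ∑[ p ∈ picks xs ] ∑[ σ ∈ perms (proj₂ p) ] 1ℚ
    ≡⟨ ∑-cong (picks xs) (λ {p} p∈ → ≡.trans (∑-one (perms (proj₂ p))) (cong ι (length-perms n (proj₂ p) (length-picks len p∈)))) ⟩
  ∑[ p ∈ picks xs ] ι (n !)
    ≡⟨ ∑-picks-proj₁ xs (λ _ → ι (n !)) ⟩
  ∑[ x ∈ xs ] ι (n !)
    ≡⟨ ∑-cong xs (λ _ → sym (ℚP.*-identityˡ (ι (n !)))) ⟩
  ∑[ x ∈ xs ] (1ℚ * ι (n !))
    ≡⟨ ∑-*ʳ (ι (n !)) xs (λ _ → 1ℚ) ⟩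
  ∑[ x ∈ xs ] 1ℚ * ι (n !)
    ≡⟨ cong (_* ι (n !)) (≡.trans (∑-one xs) (cong ι len)) ⟩
  ι (suc n) * ι (n !)
    ≡⟨ ι-* (suc n) (n !) ⟨
  ι (suc n !) ∎)

-- Firings compared with deletions

-- `fireEmp` takes the first position that holds the employee; since the employees are distinct, it
-- is the only one.
fireEmp-fireAt : ∀ V S e {v} → Unique (map e (members V S)) → v ∈ members V S →
  fireEmp V (S , e) (e v) ≡ fireAt V (S , e) v
fireEmp-fireAt V S e {v} u v∈ with filterᵇ (λ a → S a ∧ (e a ==ₐ e v)) V in eq
... | [] = contradiction (subst (v ∈_) eq (∈-filterᵇ⁺ _ (proj₁ (∈-members⁻ {V} v∈)) (cong₂ _∧_ (proj₂ (∈-members⁻ {V} v∈)) (==ₐ-refl (e v))))) (λ ())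
... | v′ ∷ _ = cong (fireAt V (S , e)) (map-unique-injective e u v′∈ v∈ ev′≡ev)
  where
  found : v′ ∈ V × S v′ ∧ (e v′ ==ₐ e v) ≡ true
  found = ∈-filterᵇ⁻ (λ a → S a ∧ (e a ==ₐ e v)) V (subst (v′ ∈_) (sym eq) (here refl))
  v′∈ : v′ ∈ members V S
  v′∈ = ∈-members⁺ {V} {S} (proj₁ found) (BoolP.∧-conicalˡ _ _ (proj₂ found))
  ev′≡ev : e v′ ≡ e v
  ev′≡ev = ==ₐ⇒≡ (BoolP.∧-conicalʳ (S v′) _ (proj₂ found))

fireAt-alone : ∀ V S e v → length (members V S) ≡ 1 → fireAt V (S , e) v ≡ (1ℚ , (S , e)) ∷ []
fireAt-alone V S e v eq rewrite eq = refl

fireAt-cascade : ∀ V S e v {n} → length (members V S) ≡ suc (suc n) → fireAt V (S , e) v ≡ cascade V (S , e) v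
fireAt-cascade V S e v eq rewrite eq = refl

leavesL-strictDesc : ∀ {k} {V S} → Closed S → ∀ p i (ts : List (LTree k)) → Located V p i ts →
  ∀ {ℓ} → ℓ ∈ leavesL S p i ts → strictDesc V S ℓ ≡ []
leavesL-strictDesc {S = S} cl p i (node a cs ∷ ts) loc {ℓ} ℓ∈ with nodeView S p i a cs ts
... | absent Sv = leavesL-strictDesc cl p (suc i) ts (located-siblings loc) (subst (ℓ ∈_) (leavesL-absent S p i a cs ts Sv) ℓ∈)
... | inner Sv c≡ with ∈-++⁻ (leavesL S (i ∷ p) 0 cs) (subst (ℓ ∈_) (leavesL-inner S p i a cs ts Sv c≡) ℓ∈)
...   | inj₁ q = leavesL-strictDesc cl (i ∷ p) 0 cs (located-children loc) q
...   | inj₂ q = leavesL-strictDesc cl p (suc i) ts (located-siblings loc) q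
leavesL-strictDesc {V = V} {S} cl p i (node a cs ∷ ts) loc {ℓ} ℓ∈ | leaf Sv c≡[]
  with subst (ℓ ∈_) (leavesL-leaf S p i a cs ts Sv c≡[]) ℓ∈
... | there q = leavesL-strictDesc cl p (suc i) ts (located-siblings loc) q
... | here refl = ≡.trans (strictDesc-node loc) (length≡0⇒[] (members (addrsL (i ∷ p) 0 cs) S)
  (≡.trans (sym (sizeL-induceL cl (i ∷ p) 0 cs)) (cong sizeL c≡[])))

-- The size condition excludes the bare root, whose deletion would leave no tree. The isolated root
-- produced by the first deletion is moved from the number of deletions to `b`.
delCount-tree : ∀ {k} (y : Forest k) b j T {n} → sizeL T ≡ suc n →
  delCount y b (suc j) (T ∷ []) ≡ ∑[ T′ ∈ delL T ] delCount y (suc b) j (T′ ∷ [])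
delCount-tree y b j T@(_ ∷ _) _ = begin
  delCount y b (suc j) (T ∷ [])
    ≡⟨ ∑-seqDel-suc j (T ∷ []) _ ⟩
  ∑[ x ∈ map (_∷ []) (delL T) ++ [] ] ∑[ z ∈ seqDel j x ] 𝟙 (isoF y (bullets (suc j ℕ.+ b) ++ z))
    ≡⟨ cong (λ L → ∑[ x ∈ L ] ∑[ z ∈ seqDel j x ] 𝟙 (isoF y (bullets (suc j ℕ.+ b) ++ z)))
         (ListP.++-identityʳ (map (_∷ []) (delL T))) ⟩
  ∑[ x ∈ map (_∷ []) (delL T) ] ∑[ z ∈ seqDel j x ] 𝟙 (isoF y (bullets (suc j ℕ.+ b) ++ z))
    ≡⟨ ∑-map (_∷ []) (delL T) _ ⟩
  ∑[ T′ ∈ delL T ] ∑[ z ∈ seqDel j (T′ ∷ []) ] 𝟙 (isoF y (bullets (suc j ℕ.+ b) ++ z))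
    ≡⟨ ∑-cong (delL T) (λ {T′} _ → ∑-cong (seqDel j (T′ ∷ [])) (λ {z} _ → cong (𝟙 ∘ isoF y) (bullets-+-suc j b z))) ⟩
  ∑[ T′ ∈ delL T ] delCount y (suc b) j (T′ ∷ []) ∎

hooksF-bullets : ∀ {k} N (T : RTree k) → hooksF (bullets N ++ T ∷ []) ≡ sizeR T ℕ.* hooksL T
hooksF-bullets zero    T = ℕP.*-identityʳ _
hooksF-bullets (suc N) T = ≡.trans (ℕP.*-identityˡ (hooksF (bullets N ++ T ∷ []))) (hooksF-bullets N T)

module _ {k : ℕ} (T0 : RTree k) where

  private
    V : List Addr
    V = addrsR T0
    m : ℕ
    m = sizeR T0

  -- `pad R` isolated roots complete the tree to `m` vertices. Their hooks are 1, so `hooks R` is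
  -- the hook product of the whole forest `embed T0 R`.
  count pad hooks : VSet → ℕ
  count R = length (members V R)
  pad R   = m ∸ count R
  hooks R = sizeR (induce T0 R) ℕ.* hooksL (induce T0 R)

  V-unique : Unique V
  V-unique = All.tabulate root∉ ∷ addrsL-unique [] 0 T0
    where
    root∉ : ∀ {a} → a ∈ addrsL [] 0 T0 → [] ≢ a
    root∉ a∈ refl with ∈-addrsL [] 0 T0 a∈
    ... | _ , _ , ()

  T0-located : Located V [] 0 T0
  T0-located = located (λ _ → refl)

  module _ {R : VSet} (sub : IsRootedSubtree T0 R) where

    members-root : members V R ≡ [] ∷ members (addrsL [] 0 T0) R
    members-root = filterᵇ-accept R (addrsL [] 0 T0) (root∈ sub)

    count-size : count R ≡ sizeR (induce T0 R)
    count-size = ≡.trans (cong length members-root) (cong suc (sym (sizeL-induceL (closed sub) [] 0 T0)))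

    count≤m : count R ℕ.≤ m
    count≤m = ℕP.≤-trans (ListP.length-filter (BoolP.T? ∘ R) V) (ℕP.≤-reflexive (cong suc (length-addrsL [] 0 T0)))

    pad+count : pad R ℕ.+ count R ≡ m
    pad+count = ℕP.m∸n+n≡m count≤m

    sizeF-tree : sizeF (induce T0 R ∷ []) ≡ count R
    sizeF-tree = ≡.trans (ℕP.+-identityʳ _) (sym count-size)

    sizeF-embed : sizeF (embed T0 R) ≡ m
    sizeF-embed = ≡.trans (sizeF-bullets (pad R) _) (≡.trans (cong (pad R ℕ.+_) sizeF-tree) pad+count)

    η-hooks : η (embed T0 R) ℕ.* hooks R ≡ m !
    η-hooks = begin
      η (embed T0 R) ℕ.* hooks R              ≡⟨ cong (η (embed T0 R) ℕ.*_) (hooksF-bullets (pad R) (induce T0 R)) ⟨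
      η (embed T0 R) ℕ.* hooksF (embed T0 R)  ≡⟨ hook-formula (embed T0 R) ⟩
      sizeF (embed T0 R) !                    ≡⟨ cong _! sizeF-embed ⟩
      m !                                     ∎

    strictDesc-root : strictDesc V R [] ≡ members (addrsL [] 0 T0) R
    strictDesc-root = ≡.trans (filterᵇ-∧ R (strictAnc []) V)
      (cong (filterᵇ R) (filterᵇ-all (strictAnc []) (addrsL [] 0 T0) (∈-children⇒strict [] T0)))

    removeV-subtree : ∀ {ℓ} → ℓ ≢ [] → strictDesc V R ℓ ≡ [] → IsRootedSubtree T0 (removeV R ℓ)
    removeV-subtree {ℓ} ℓ≢[] isLeaf = record
      { root∈  = ≡.trans (removeV-other R (ℓ≢[] ∘ sym)) (root∈ sub)
      ; ⊆T0    = λ a eq → ⊆T0 sub a (proj₁ (removeV⁻ R {ℓ} {a} eq))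
      ; closed = λ i a eq → ≡.trans
          (removeV-other R (λ { refl → childless i (proj₁ (removeV⁻ R {ℓ} {i ∷ a} eq)) }))
          (closed sub i a (proj₁ (removeV⁻ R {ℓ} {i ∷ a} eq)))
      }
      where
      childless : ∀ i → ¬ (R (i ∷ ℓ) ≡ true)
      childless i Ri with any⁻ (λ b → (i ∷ ℓ) ==ₐ b) V (⊆T0 sub (i ∷ ℓ) Ri)
      ... | b , b∈ , eq = contradiction (subst (i ∷ ℓ ∈_) isLeaf child∈) (λ ())
        where
        child∈ : i ∷ ℓ ∈ strictDesc V R ℓ
        child∈ = ∈-filterᵇ⁺ (λ a → R a ∧ strictAnc ℓ a) (subst (_∈ V) (sym (==ₐ⇒≡ {i ∷ ℓ} eq)) b∈)
          (cong₂ _∧_ Ri (strictAnc⁺ {ℓ} {i} ⊑-refl))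

    count-removeV : ∀ {ℓ} → ℓ ∈ V → R ℓ ≡ true → count R ≡ suc (count (removeV R ℓ))
    count-removeV ℓ∈ Rℓ = ↭P.↭-length (members-removeV-↭ {S = R} V-unique ℓ∈ Rℓ)

    pad-removeV : ∀ {ℓ} → ℓ ∈ V → R ℓ ≡ true → pad (removeV R ℓ) ≡ suc (pad R)
    pad-removeV {ℓ} ℓ∈ Rℓ = ℕP.+-cancelʳ-≡ (count (removeV R ℓ)) _ _ (begin
      pad (removeV R ℓ) ℕ.+ count (removeV R ℓ)  ≡⟨ ℕP.m∸n+n≡m (ℕP.≤-trans (ℕP.n≤1+n _) (subst (ℕ._≤ m) (count-removeV ℓ∈ Rℓ) count≤m)) ⟩
      m                                          ≡⟨ pad+count ⟨
      pad R ℕ.+ count R                          ≡⟨ cong (pad R ℕ.+_) (count-removeV ℓ∈ Rℓ) ⟩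
      pad R ℕ.+ suc (count (removeV R ℓ))        ≡⟨ ℕP.+-suc (pad R) _ ⟩
      suc (pad R) ℕ.+ count (removeV R ℓ)        ∎)

    nonleaf-root : ∀ {c ℓ} → count R ≡ suc (suc c) → strictDesc V R ℓ ≡ [] → ℓ ≢ []
    nonleaf-root cnt isLeaf refl = contradiction
      (≡.trans (sym cnt) (cong length (≡.trans members-root (cong ([] ∷_) (≡.trans (sym strictDesc-root) isLeaf))))) (λ ())

    leaf-∈ : ∀ {ℓ} → ℓ ∈ leavesL R [] 0 T0 → ℓ ∈ V × R ℓ ≡ true
    leaf-∈ ℓ∈ = there (proj₁ (leavesL-⊆ [] 0 T0 ℓ∈)) , proj₂ (leavesL-⊆ [] 0 T0 ℓ∈)

  module _ {S′ : VSet} (sub′ : IsRootedSubtree T0 S′) (uL : Unique (labelsL T0)) where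

    private
      y : Forest k
      y = embed T0 S′

    -- By the hook formula, the ratio of `η y` to `η (embed T0 R)` is this constant times `hooks R`;
    -- the dependence on `R` is thus reduced to a hook product.
    κ : ℚ
    κ = ι (η y) * frac 1 (m !)

    -- η(y)/η(x) times the number of sequences of j deletions in the tree part of
    -- x = embed T0 R that lead to y
    value : ℕ → VSet → ℚ
    value j R = κ * ι (hooks R) * delCount y (pad R) j (induce T0 R ∷ [])

    reached : VSet → ℚ
    reached R = 𝟙 (sameSet V R S′)

    frac-η : ∀ {R} → IsRootedSubtree T0 R → frac (η y) (η (embed T0 R)) ≡ κ * ι (hooks R)
    frac-η {R} sub = begin
      frac (η y) ηx                          ≡⟨ frac-split (η y) ηx ⟩
      ι (η y) * frac 1 ηx                    ≡⟨ cong (ι (η y) *_) reciprocal ⟩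
      ι (η y) * (frac 1 (m !) * ι (hooks R)) ≡⟨ ℚP.*-assoc (ι (η y)) _ _ ⟨
      κ * ι (hooks R)                        ∎
      where
      ηx : ℕ
      ηx = η (embed T0 R)
      m!≢0 : ℕ.NonZero (m !)
      m!≢0 = ℕ.>-nonZero (ℕP.1≤n! m)
      ηx≢0 : ℕ.NonZero ηx
      ηx≢0 = ℕP.m*n≢0⇒m≢0 ηx {hooks R} {{subst ℕ.NonZero (sym (η-hooks sub)) m!≢0}}
      reciprocal : frac 1 ηx ≡ frac 1 (m !) * ι (hooks R)
      reciprocal = ι-cancelʳ ηx {{ηx≢0}} (begin
        frac 1 ηx * ι ηx                       ≡⟨ frac-inverse ηx {{ηx≢0}} ⟩
        1ℚ                                     ≡⟨ frac-inverse (m !) {{m!≢0}} ⟨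
        frac 1 (m !) * ι (m !)                 ≡⟨ cong (λ f → frac 1 (m !) * ι f) (η-hooks sub) ⟨
        frac 1 (m !) * ι (ηx ℕ.* hooks R)      ≡⟨ cong (frac 1 (m !) *_) (≡.trans (ι-* ηx (hooks R)) (ℚP.*-comm (ι ηx) _)) ⟩
        frac 1 (m !) * (ι (hooks R) * ι ηx)    ≡⟨ ℚP.*-assoc (frac 1 (m !)) _ _ ⟨
        frac 1 (m !) * ι (hooks R) * ι ηx      ∎)

    -- The factor `κ * ι (hooks R)` is a quotient of two values of `η`. Where the indicator is
    -- nonzero the two forests coincide and the quotient is 1.
    value-zero : ∀ {R} → IsRootedSubtree T0 R → value 0 R ≡ reached R
    value-zero {R} sub = begin
      κ * ι (hooks R) * (𝟙 (isoF y (embed T0 R)) + 0ℚ)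
        ≡⟨ cong (κ * ι (hooks R) *_) (≡.trans (ℚP.+-identityʳ _) (cong 𝟙 (isoF-embed T0 uL sub sub′))) ⟩
      κ * ι (hooks R) * 𝟙 (sameSet V R S′)
        ≡⟨ only-same (sameSet V R S′) refl ⟩
      reached R ∎
      where
      only-same : ∀ b → sameSet V R S′ ≡ b → κ * ι (hooks R) * 𝟙 b ≡ 𝟙 (sameSet V R S′)
      only-same false eq = ≡.trans (ℚP.*-zeroʳ (κ * ι (hooks R))) (cong 𝟙 (sym eq))
      only-same true  eq = begin
        κ * ι (hooks R) * 1ℚ                  ≡⟨ ℚP.*-identityʳ _ ⟩
        κ * ι (hooks R)                       ≡⟨ cong (λ T → κ * ι (sizeR T ℕ.* hooksL T)) (induceL-cong [] 0 T0 (sameSet⁻ {R} {S′} V eq ∘ there)) ⟩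
        κ * ι (hooks S′)                      ≡⟨ solve 3 (λ a b c → a :* b :* c := b :* (a :* c)) refl (ι (η y)) (frac 1 (m !)) (ι (hooks S′)) ⟩
        frac 1 (m !) * (ι (η y) * ι (hooks S′)) ≡⟨ cong (frac 1 (m !) *_) (≡.trans (sym (ι-* (η y) (hooks S′))) (cong ι (η-hooks sub′))) ⟩
        frac 1 (m !) * ι (m !)                ≡⟨ frac-inverse (m !) {{ℕ.>-nonZero (ℕP.1≤n! m)}} ⟩
        1ℚ                                    ≡⟨ cong 𝟙 eq ⟨
        𝟙 (sameSet V R S′)                    ∎

    -- The root has no label and is not part of the list of labelled trees, so `∑-harmonic` covers
    -- only the vertices below the boss. The boss is added by the same cancellation of `n` that an
    -- inner vertex undergoes there.
    cascade-step : ∀ {R c} → IsRootedSubtree T0 R → count R ≡ suc (suc c) → ∀ j e →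
      ∑[ v ∈ members V R ] cascadeValue V R (value j) e v ≡ value (suc j) R
    cascade-step {R} {c} sub cnt j e = begin
      ∑[ v ∈ members V R ] C v
        ≡⟨ cong (λ M → ∑ M C) (members-root sub) ⟩
      C [] + ∑ D C
        ≡⟨ cong₂ _+_ root≡ total≡ ⟩
      ι H * Γ + ι n * (ι H * Γ)
        ≡⟨ solve 3 (λ n h g → h :* g :+ n :* (h :* g) := (con 1ℚ :+ n) :* h :* g) refl (ι n) (ι H) Γ ⟩
      (1ℚ + ι n) * ι H * Γ
        ≡⟨ cong₂ _*_ (≡.trans (cong (_* ι H) (sym (ι-suc n))) (sym (ι-* (suc n) H)))
             (∑-*ˡ κ (leavesL R [] 0 T0) (λ ℓ → delCount y (suc (pad R)) j (induce T0 (removeV R ℓ) ∷ []))) ⟩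
      ι (hooks R) * (κ * ∑[ ℓ ∈ leavesL R [] 0 T0 ] delCount y (suc (pad R)) j (induce T0 (removeV R ℓ) ∷ []))
        ≡⟨ cong (λ d → ι (hooks R) * (κ * d)) deletions ⟨
      ι (hooks R) * (κ * delCount y (pad R) (suc j) (T ∷ []))
        ≡⟨ solve 3 (λ h k d → h :* (k :* d) := k :* h :* d) refl (ι (hooks R)) κ _ ⟩
      value (suc j) R ∎
      where
      T : RTree k
      T = induce T0 R
      n H : ℕ
      n = sizeL T
      H = hooksL T
      D : List Addr
      D = members (addrsL [] 0 T0) R
      C γ : Addr → ℚ
      C = cascadeValue V R (value j) e
      γ ℓ = κ * delCount y (suc (pad R)) j (induce T0 (removeV R ℓ) ∷ [])
      Γ : ℚ
      Γ = ∑ (leavesL R [] 0 T0) γ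
      n≡ : n ≡ suc c
      n≡ = ℕP.suc-injective (≡.trans (sym (count-size sub)) cnt)
      -- The factor `n` is the hook of the root after the deletion; the deleted leaf reappears as
      -- one more isolated root in `pad`.
      βγ : ∀ {ℓ} → ℓ ∈ leavesL R [] 0 T0 →
        value j (removeV R ℓ) ≡ ι (hooksL (induceL (removeV R ℓ) [] 0 T0)) * (ι n * γ ℓ)
      βγ {ℓ} ℓ∈ = begin
        κ * ι (suc (sizeL T′) ℕ.* hooksL T′) * delCount y (pad (removeV R ℓ)) j (T′ ∷ [])
          ≡⟨ cong₂ (λ s b → κ * ι (s ℕ.* hooksL T′) * delCount y b j (T′ ∷ []))
               (sizeL-removeV-leaf R [] 0 T0 ℓ∈) (pad-removeV sub (proj₁ (leaf-∈ sub ℓ∈)) (proj₂ (leaf-∈ sub ℓ∈))) ⟩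
        κ * ι (n ℕ.* hooksL T′) * d
          ≡⟨ cong (λ q → κ * q * d) (ι-* n (hooksL T′)) ⟩
        κ * (ι n * ι (hooksL T′)) * d
          ≡⟨ solve 4 (λ k n h d → k :* (n :* h) :* d := h :* (n :* (k :* d))) refl κ (ι n) (ι (hooksL T′)) d ⟩
        ι (hooksL T′) * (ι n * γ ℓ) ∎
        where
        T′ : RTree k
        T′ = induce T0 (removeV R ℓ)
        d : ℚ
        d = delCount y (suc (pad R)) j (T′ ∷ [])
      total≡ : ∑ D C ≡ ι n * (ι H * Γ)
      total≡ = begin
        ∑ D C
          ≡⟨ ∑-harmonic (closed sub) C (value j ∘ removeV R) (cascadeValue-leaf V R (value j) e)
               (λ v → cascadeValue-inner V R (value j) e v) [] 0 T0 T0-located (λ ℓ → ι n * γ ℓ) βγ ⟩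
        ι H * ∑ (leavesL R [] 0 T0) (λ ℓ → ι n * γ ℓ)
          ≡⟨ cong (ι H *_) (∑-*ˡ (ι n) (leavesL R [] 0 T0) γ) ⟩
        ι H * (ι n * Γ)
          ≡⟨ solve 3 (λ n h g → h :* (n :* g) := n :* (h :* g)) refl (ι n) (ι H) Γ ⟩
        ι n * (ι H * Γ) ∎
      root≡ : C [] ≡ ι H * Γ
      root≡ = ι-cancelʳ (suc c) (begin
        C [] * ι (suc c)        ≡⟨ ℚP.*-comm (C []) _ ⟩
        ι (suc c) * C []        ≡⟨ cascadeValue-inner V R (value j) e []
                                     (≡.trans (cong length (strictDesc-root sub)) (≡.trans (sym (sizeL-induceL (closed sub) [] 0 T0)) n≡)) ⟩
        ∑ (strictDesc V R []) C ≡⟨ cong (λ E → ∑ E C) (strictDesc-root sub) ⟩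
        ∑ D C                   ≡⟨ total≡ ⟩
        ι n * (ι H * Γ)         ≡⟨ cong (λ s → ι s * (ι H * Γ)) n≡ ⟩
        ι (suc c) * (ι H * Γ)   ≡⟨ ℚP.*-comm (ι (suc c)) _ ⟩
        ι H * Γ * ι (suc c)     ∎)
      deletions : delCount y (pad R) (suc j) (T ∷ []) ≡
        ∑[ ℓ ∈ leavesL R [] 0 T0 ] delCount y (suc (pad R)) j (induce T0 (removeV R ℓ) ∷ [])
      deletions = begin
        delCount y (pad R) (suc j) (T ∷ [])
          ≡⟨ delCount-tree y (pad R) j T n≡ ⟩
        ∑[ T′ ∈ delL T ] delCount y (suc (pad R)) j (T′ ∷ [])
          ≡⟨ cong (λ L → ∑[ T′ ∈ L ] delCount y (suc (pad R)) j (T′ ∷ [])) (delL-induceL R [] 0 T0) ⟩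
        ∑[ T′ ∈ map (λ ℓ → induceL (removeV R ℓ) [] 0 T0) (leavesL R [] 0 T0) ] delCount y (suc (pad R)) j (T′ ∷ [])
          ≡⟨ ∑-map (λ ℓ → induceL (removeV R ℓ) [] 0 T0) (leavesL R [] 0 T0) _ ⟩
        ∑[ ℓ ∈ leavesL R [] 0 T0 ] delCount y (suc (pad R)) j (induce T0 (removeV R ℓ) ∷ []) ∎

    reachedEx : Config → List Addr → ℚ
    reachedEx c σ = Ex (fireSeq V σ c) (reached ∘ proj₁)

    -- The boss is never fired, which matches the deletion of the last vertex of the tree: it
    -- leaves an isolated root as well.
    firing-value-alone : ∀ {R} → IsRootedSubtree T0 R → count R ≡ 1 → ∀ j e x →
      (fireEmp V (R , e) x ≡ (1ℚ , (R , e)) ∷ []) →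
      ∑arrangements (suc j) (x ∷ []) (reachedEx (R , e)) ≡ value (suc j) R
    firing-value-alone {R} sub cnt zero e x stay = begin
      Ex (bindD (fireEmp V (R , e) x) (fireSeq V [])) (reached ∘ proj₁) + 0ℚ
        ≡⟨ ℚP.+-identityʳ _ ⟩
      Ex (bindD (fireEmp V (R , e) x) (fireSeq V [])) (reached ∘ proj₁)
        ≡⟨ Ex-bind (fireEmp V (R , e) x) (fireSeq V []) (reached ∘ proj₁) ⟩
      Ex (fireEmp V (R , e) x) (λ c → reachedEx c [])
        ≡⟨ cong (λ d → Ex d (λ c → reachedEx c [])) stay ⟩
      Ex {A = Config} ((1ℚ , (R , e)) ∷ []) (λ c → reachedEx c [])
        ≡⟨ Ex-return {A = Config} (R , e) (λ c → reachedEx c []) ⟩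
      reachedEx (R , e) []
        ≡⟨ Ex-return {A = Config} (R , e) (reached ∘ proj₁) ⟩
      reached R
        ≡⟨ value-zero sub ⟨
      κ * ι (hooks R) * delCount y (pad R) 0 (induce T0 R ∷ [])
        ≡⟨ cong (λ T → κ * ι (hooks R) * delCount y (pad R) 0 (T ∷ [])) T≡[] ⟩
      κ * ι (hooks R) * (𝟙 (isoF y (bullets (pad R) ++ [] ∷ [])) + 0ℚ)
        ≡⟨ cong (λ z → κ * ι (hooks R) * (𝟙 (isoF y z) + 0ℚ)) (bullets-snoc (pad R) []) ⟩
      κ * ι (hooks R) * (𝟙 (isoF y (bullets (suc (pad R)) ++ [])) + 0ℚ)
        ≡⟨ cong (λ T → κ * ι (hooks R) * delCount y (pad R) 1 (T ∷ [])) T≡[] ⟨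
      value 1 R ∎
      where
      T≡[] : induce T0 R ≡ []
      T≡[] = sizeL≡0⇒[] (induce T0 R) (ℕP.suc-injective (≡.trans (sym (count-size sub)) cnt))
        where
        sizeL≡0⇒[] : ∀ (T : RTree k) → sizeL T ≡ 0 → T ≡ []
        sizeL≡0⇒[] [] _ = refl
        sizeL≡0⇒[] (node _ _ ∷ _) ()
    firing-value-alone {R} sub cnt (suc j) e x stay = begin
      0ℚ + 0ℚ
        ≡⟨ ℚP.+-identityʳ 0ℚ ⟩
      0ℚ
        ≡⟨ ℚP.*-zeroʳ (κ * ι (hooks R)) ⟨
      κ * ι (hooks R) * 0ℚ
        ≡⟨ cong (κ * ι (hooks R) *_) (∑-seqDel-overfull (suc (suc j)) (induce T0 R ∷ []) _
             (ℕP.≤-trans (ℕP.≤-reflexive (cong suc (≡.trans (sizeF-tree sub) cnt))) (s≤s (s≤s z≤n)))) ⟨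
      value (suc (suc j)) R ∎

    -- A cascade changes both the assignment `e` and the list of those who may still be fired. The
    -- induction on `j` therefore keeps only what survives: `xs` lists, in some order, the employees
    -- at the occupied positions.
    firing-value : ∀ j {R} → IsRootedSubtree T0 R → ∀ e xs → Unique xs → map e (members V R) ↭ xs →
      ∑arrangements j xs (reachedEx (R , e)) ≡ value j R
    firing-value zero    {R} sub e xs uxs e↭ = ≡.trans (Ex-return {A = Config} (R , e) (reached ∘ proj₁)) (sym (value-zero sub))
    firing-value (suc j) {R} sub e xs uxs e↭ = byCount (count R) refl
      where
      uniq : Unique (map e (members V R))
      uniq = Unique-resp-↭ (↭-sym e↭) uxs
      len : length xs ≡ count R
      len = ≡.trans (sym (↭P.↭-length e↭)) (ListP.length-map e (members V R))
      at : ∀ {v} → v ∈ members V R → fireEmp V (R , e) (e v) ≡ fireAt V (R , e) v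
      at = fireEmp-fireAt V R e uniq
      employee : ∀ {x} → x ∈ xs → ∃[ v ] (v ∈ members V R × x ≡ e v)
      employee x∈ = ∈-map⁻ e (↭P.∈-resp-↭ (↭-sym e↭) x∈)
      alone : ∀ xs → xs ↭ map e (members V R) → length xs ≡ 1 → count R ≡ 1 → ∑arrangements (suc j) xs (reachedEx (R , e)) ≡ value (suc j) R
      alone (x ∷ []) xs↭ _ cnt with ∈-map⁻ e (↭P.∈-resp-↭ xs↭ (here refl))
      ... | v , v∈ , refl = firing-value-alone sub cnt j e (e v) (≡.trans (at v∈) (fireAt-alone V R e v cnt))
      fired : ∀ {c} → count R ≡ suc (suc c) → ∀ {p} → p ∈ picks xs →
        ∑arrangements j (proj₂ p) (λ σ → reachedEx (R , e) (proj₁ p ∷ σ)) ≡ Ex (fireEmp V (R , e) (proj₁ p)) (value j ∘ proj₁)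
      fired cnt {x , rest} p∈ with employee (↭P.∈-resp-↭ (↭-sym (picks-↭ p∈)) (here refl))
      ... | v , v∈ , refl = begin
        ∑arrangements j rest (λ σ → reachedEx (R , e) (e v ∷ σ))
          ≡⟨ ∑arrangements-cong j rest (λ σ → Ex-bind d (fireSeq V σ) (reached ∘ proj₁)) ⟩
        ∑arrangements j rest (λ σ → Ex d (λ c → reachedEx c σ))
          ≡⟨ ∑arrangements-∑ j rest d proj₁ (λ p → reachedEx (proj₂ p)) ⟩
        Ex d (λ c → ∑arrangements j rest (reachedEx c))
          ≡⟨ Ex-cong d outcome ⟩
        Ex d (value j ∘ proj₁) ∎
        where
        d : Dist Config
        d = fireEmp V (R , e) (e v)
        v∈V : v ∈ V
        v∈V = proj₁ (∈-members⁻ {V} {R} v∈)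
        Rv : R v ≡ true
        Rv = proj₂ (∈-members⁻ {V} {R} v∈)
        xs↭ : xs ↭ e v ∷ rest
        xs↭ = picks-↭ p∈
        rest↭ : map e (members V (removeV R v)) ↭ rest
        rest↭ = ↭P.drop-∷ (trans (↭-sym (↭P.map⁺ e (members-removeV-↭ {S = R} V-unique v∈V Rv))) (trans e↭ xs↭))
        unique-rest : ∀ {x} {xs : List Addr} → Unique (x ∷ xs) → Unique xs
        unique-rest (_ ∷ u) = u
        outcome : ∀ {q} → q ∈ d → ∑arrangements j rest (reachedEx (proj₂ q)) ≡ value j (proj₁ (proj₂ q))
        outcome {q} q∈ = firing-value j
          (subst (IsRootedSubtree T0) (sym (Outcome.set≡ out))
            (removeV-subtree sub (nonleaf-root sub cnt (Outcome.is-leaf out)) (Outcome.is-leaf out)))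
          (proj₂ (proj₂ q)) rest (unique-rest (Unique-resp-↭ xs↭ uxs)) (trans (Outcome.employees out) rest↭)
          where
          out : Outcome V R e v (proj₂ q)
          out = cascade-outcome V-unique (length V) e v v∈V Rv (strictDesc V R v) refl
            (subst (q ∈_) (≡.trans (at v∈) (fireAt-cascade V R e v cnt)) q∈)
      byCount : ∀ c → count R ≡ c → ∑arrangements (suc j) xs (reachedEx (R , e)) ≡ value (suc j) R
      byCount zero          cnt = contradiction (≡.trans (sym cnt) (count-size sub)) (λ ())
      byCount (suc zero)    cnt = alone xs (↭-sym e↭) (≡.trans len cnt) cnt
      byCount (suc (suc c)) cnt = begin
        ∑[ p ∈ picks xs ] ∑arrangements j (proj₂ p) (λ σ → reachedEx (R , e) (proj₁ p ∷ σ))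
          ≡⟨ ∑-cong (picks xs) (fired cnt) ⟩
        ∑[ p ∈ picks xs ] Ex (fireEmp V (R , e) (proj₁ p)) (value j ∘ proj₁)
          ≡⟨ ∑-picks-proj₁ xs (λ x → Ex (fireEmp V (R , e) x) (value j ∘ proj₁)) ⟩
        ∑[ x ∈ xs ] Ex (fireEmp V (R , e) x) (value j ∘ proj₁)
          -- From employees to positions: each remaining employee holds exactly one vertex of the
          -- tree.
          ≡⟨ ∑-↭ (↭-sym e↭) _ ⟩
        ∑[ x ∈ map e (members V R) ] Ex (fireEmp V (R , e) x) (value j ∘ proj₁)
          ≡⟨ ∑-map e (members V R) _ ⟩
        ∑[ v ∈ members V R ] Ex (fireEmp V (R , e) (e v)) (value j ∘ proj₁)
          ≡⟨ ∑-cong (members V R) (λ {v} v∈ → cong (λ d → Ex d (value j ∘ proj₁)) (≡.trans (at v∈) (fireAt-cascade V R e v cnt))) ⟩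
        ∑[ v ∈ members V R ] cascadeValue V R (value j) e v
          ≡⟨ cascade-step sub cnt j e ⟩
        value (suc j) R ∎

-- The chain stays among the forests `embed T0 S`

-- Once the last vertex of the tree has been deleted, only isolated roots remain; that forest is the
-- one embedded from the one-vertex subtree.
onlyRoot : VSet
onlyRoot a = a ==ₐ []

onlyRoot-subtree : ∀ {k} (T0 : RTree k) → IsRootedSubtree T0 onlyRoot
onlyRoot-subtree T0 = record { root∈ = refl ; ⊆T0 = ⊆ ; closed = λ _ _ () }
  where
  ⊆ : ∀ a → onlyRoot a ≡ true → a ∈ᵥ addrsR T0 ≡ true
  ⊆ [] _ = refl

induceL-onlyRoot : ∀ {k} p i (ts : List (LTree k)) → induceL onlyRoot p i ts ≡ []
induceL-onlyRoot p i []               = refl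
induceL-onlyRoot p i (node a cs ∷ ts) = induceL-onlyRoot p (suc i) ts

bullets-++ : ∀ {k} r n (x : Forest k) → bullets r ++ bullets n ++ x ≡ bullets (r ℕ.+ n) ++ x
bullets-++ zero    n x = refl
bullets-++ (suc r) n x = cong ([] ∷_) (bullets-++ r n x)

embed-onlyRoot : ∀ {k} (T0 : RTree k) → embed T0 onlyRoot ≡ bullets (sizeR T0)
embed-onlyRoot T0 = begin
  bullets (pad T0 onlyRoot) ++ induce T0 onlyRoot ∷ []
    ≡⟨ cong (λ T → bullets (pad T0 onlyRoot) ++ T ∷ []) (induceL-onlyRoot [] 0 T0) ⟩
  bullets (pad T0 onlyRoot) ++ bullets 1
    ≡⟨ cong (bullets (pad T0 onlyRoot) ++_) (ListP.++-identityʳ (bullets 1)) ⟨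
  bullets (pad T0 onlyRoot) ++ bullets 1 ++ []
    ≡⟨ bullets-++ (pad T0 onlyRoot) 1 [] ⟩
  bullets (pad T0 onlyRoot ℕ.+ 1) ++ []
    ≡⟨ ListP.++-identityʳ _ ⟩
  bullets (pad T0 onlyRoot ℕ.+ 1)
    ≡⟨ cong (λ n → bullets (pad T0 onlyRoot ℕ.+ n)) count≡1 ⟨
  bullets (pad T0 onlyRoot ℕ.+ count T0 onlyRoot)
    ≡⟨ cong bullets (pad+count T0 (onlyRoot-subtree T0)) ⟩
  bullets (sizeR T0) ∎
  where
  count≡1 : count T0 onlyRoot ≡ 1
  count≡1 = ≡.trans (count-size T0 (onlyRoot-subtree T0)) (cong sizeR (induceL-onlyRoot [] 0 T0))

-- The forests met between the deletions, before the new isolated roots are joined. They have `c`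
-- vertices, possibly fewer than `T0`, and the tree itself may be gone, which is the case `none`.
data Remnant {k} (T0 : RTree k) : ℕ → Forest k → Set where
  none   : Remnant T0 0 []
  tree   : ∀ {R} → IsRootedSubtree T0 R → Remnant T0 (count T0 R) (induce T0 R ∷ [])
  bullet : ∀ {c x} → Remnant T0 c x → Remnant T0 (suc c) ([] ∷ x)

module _ {k : ℕ} {T0 : RTree k} where

  remnant-bullets : ∀ n {c x} → Remnant T0 c x → Remnant T0 (n ℕ.+ c) (bullets n ++ x)
  remnant-bullets zero    r = r
  remnant-bullets (suc n) r = bullet (remnant-bullets n r)

  remnant-embed : ∀ {S} → IsRootedSubtree T0 S → Remnant T0 (sizeR T0) (embed T0 S)
  remnant-embed {S} sub = subst (λ c → Remnant T0 c (embed T0 S)) (pad+count T0 sub) (remnant-bullets (pad T0 S) (tree sub))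

  embed-remnant : ∀ {c x} → Remnant T0 c x → ∀ r → r ℕ.+ c ≡ sizeR T0 →
    ∃[ S ] (IsRootedSubtree T0 S × bullets r ++ x ≡ embed T0 S)
  embed-remnant none r eq = onlyRoot , onlyRoot-subtree T0 , (begin
    bullets r ++ []      ≡⟨ ListP.++-identityʳ _ ⟩
    bullets r            ≡⟨ cong bullets (≡.trans (sym (ℕP.+-identityʳ r)) eq) ⟩
    bullets (sizeR T0)   ≡⟨ embed-onlyRoot T0 ⟨
    embed T0 onlyRoot    ∎)
  embed-remnant (tree {R} sub) r eq = R , sub , cong (λ n → bullets n ++ induce T0 R ∷ [])
    (ℕP.+-cancelʳ-≡ (count T0 R) _ _ (≡.trans eq (sym (pad+count T0 sub))))
  embed-remnant (bullet {c} {x} rem) r eq with embed-remnant rem (suc r) (≡.trans (sym (ℕP.+-suc r c)) eq)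
  ... | S , sub , eq′ = S , sub , ≡.trans (bullets-snoc r x) eq′

  -- The tree is a separate argument with an equation, so that a match on its shape lets `delF`
  -- distinguish a bare root from a root with children.
  remnant-delTree : ∀ {R} → IsRootedSubtree T0 R → ∀ T → T ≡ induce T0 R → ∀ {z} → z ∈ delF (T ∷ []) →
    ∃[ c ] (count T0 R ≡ suc c × Remnant T0 c z)
  remnant-delTree {R} sub []         T≡ (here refl) = 0 , ≡.trans (count-size T0 sub) (cong sizeR (sym T≡)) , none
  remnant-delTree {R} sub T@(_ ∷ Ts) T≡ {z} z∈
    with ∈-map⁻ (_∷ []) (subst (z ∈_) (ListP.++-identityʳ (map (_∷ []) (delL T))) z∈)
  ... | T′ , T′∈ , refl
    with ∈-map⁻ (λ ℓ → induceL (removeV R ℓ) [] 0 T0) (subst (T′ ∈_) (≡.trans (cong delL T≡) (delL-induceL R [] 0 T0)) T′∈)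
  ...   | ℓ , ℓ∈ , refl = count T0 (removeV R ℓ) , cnt , tree (removeV-subtree T0 sub ℓ≢[] noDesc)
    where
    noDesc : strictDesc (addrsR T0) R ℓ ≡ []
    noDesc = leavesL-strictDesc (closed sub) [] 0 T0 (T0-located T0) ℓ∈
    ℓ≢[] : ℓ ≢ []
    ℓ≢[] refl with ∈-addrsL [] 0 T0 (proj₁ (leavesL-⊆ [] 0 T0 ℓ∈))
    ... | _ , _ , ()
    cnt : count T0 R ≡ suc (count T0 (removeV R ℓ))
    cnt = count-removeV T0 sub (proj₁ (leaf-∈ T0 sub ℓ∈)) (proj₂ (leaf-∈ T0 sub ℓ∈))

  remnant-del : ∀ {c x} → Remnant T0 c x → ∀ {z} → z ∈ delF x → ∃[ c′ ] (c ≡ suc c′ × Remnant T0 c′ z)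
  remnant-del (tree {R} sub) z∈ = remnant-delTree sub (induce T0 R) refl z∈
  remnant-del (bullet {c} rem) (here refl) = c , refl , rem
  remnant-del (bullet rem) (there z∈) with ∈-map⁻ ([] ∷_) z∈
  ... | z , z∈′ , refl with remnant-del rem z∈′
  ...   | c′ , refl , rem′ = suc c′ , refl , bullet rem′

  remnant-seqDel : ∀ r {c x} → Remnant T0 c x → ∀ {z} → z ∈ seqDel r x → ∃[ c′ ] (c ≡ r ℕ.+ c′ × Remnant T0 c′ z)
  remnant-seqDel zero    {c} rem (here refl) = c , refl , rem
  remnant-seqDel (suc r) {x = x} rem z∈ with ∈-concatMap⁻′ (delF x) z∈
    where
    ∈-concatMap⁻′ : ∀ xs {z} → z ∈ concatMap (seqDel r) xs → ∃[ u ] (u ∈ xs × z ∈ seqDel r u)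
    ∈-concatMap⁻′ (u ∷ us) z∈ with ∈-++⁻ (seqDel r u) z∈
    ... | inj₁ q = u , here refl , q
    ... | inj₂ q with ∈-concatMap⁻′ us q
    ...   | u′ , u′∈ , q′ = u′ , there u′∈ , q′
  ... | u , u∈ , z∈u with remnant-del rem u∈
  ...   | c₁ , refl , rem₁ with remnant-seqDel r rem₁ z∈u
  ...     | c₂ , refl , rem₂ = c₂ , refl , rem₂

  -- A nonzero coefficient means that some deletion sequence ends in a forest isomorphic to `y`.
  -- Following the sequence through the remnants exhibits the subtree.
  stays : ∀ {S} → IsRootedSubtree T0 S → ∀ y r → coeff y (mΔ r (embed T0 S)) ≢ 0 →
    ∃[ S′ ] (IsRootedSubtree T0 S′ × isoF y (embed T0 S′) ≡ true)
  stays {S} sub y r nonzero with filterᵇ (λ z → isoF y z) (mΔ r (embed T0 S)) in eq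
  ... | [] = contradiction refl nonzero
  ... | z ∷ _ with ∈-filterᵇ⁻ (λ z → isoF y z) (mΔ r (embed T0 S)) (subst (z ∈_) (sym eq) (here refl))
  ...   | z∈ , iso with ∈-map⁻ (λ z → bullets r ++ z) z∈
  ...     | u , u∈ , refl with remnant-seqDel r (remnant-embed sub) u∈
  ...       | c , m≡ , rem with embed-remnant rem r (sym m≡)
  ...         | S′ , sub′ , z≡ = S′ , sub′ , subst (λ z → isoF y z ≡ true) z≡ iso

binSum-nonzero : ∀ {k} m q (x y : Forest k) n → binSum m q x y n ≢ 0ℚ → ∃[ r ] (coeff y (mΔ r x) ≢ 0)
binSum-nonzero m q x y zero nz = 0 , λ c≡0 → nz
  (≡.trans (cong (λ c → frac c 1 * (q ^ℚ m)) c≡0) (ℚP.*-zeroˡ (q ^ℚ m)))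
binSum-nonzero m q x y (suc n) nz with coeff y (mΔ (suc n) x) ℕ.≟ 0
... | no c≢0  = suc n , c≢0
... | yes c≡0 = binSum-nonzero m q x y n (λ earlier≡0 → nz (begin
  binSum m q x y n + w * frac (coeff y (mΔ (suc n) x)) 1
    ≡⟨ cong₂ (λ s c → s + w * frac c 1) earlier≡0 c≡0 ⟩
  0ℚ + w * 0ℚ
    ≡⟨ cong (_+_ 0ℚ) (ℚP.*-zeroʳ w) ⟩
  0ℚ ∎))
  where
  w : ℚ
  w = frac 1 (suc n !) * ((1ℚ - q) ^ℚ suc n) * (q ^ℚ (m ∸ suc n))

-- The chains are the single and the binomial model

module _ {k : ℕ} (T0 : RTree k) (uL : Unique (labelsL T0)) {S S′ : VSet}
         (sub : IsRootedSubtree T0 S) (sub′ : IsRootedSubtree T0 S′) where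

  private
    V : List Addr
    V = addrsR T0
    m n N : ℕ
    m = sizeR T0
    n = count T0 S
    N = pad T0 S
    y : Forest k
    y = embed T0 S′
    tree-part : Forest k
    tree-part = induce T0 S ∷ []
    scale : ℚ
    scale = κ T0 sub′ uL * ι (hooks T0 S)
    members-unique : Unique (members V S)
    members-unique = filterᵇ-unique S (V-unique T0)

  arrangements : ∀ j → ∑arrangements j (members V S) (reachedEx T0 sub′ uL (S , idEmp)) ≡ value T0 sub′ uL j S
  arrangements j = firing-value T0 sub′ uL j sub idEmp (members V S) members-unique
    (↭-reflexive (ListP.map-id (members V S)))

  -- At the start of a step employees are named by their positions, so firing at `v` is firing the
  -- employee `v`: the arrangements of length one.
  single-firings : ∑[ v ∈ members V S ] Ex (fireAt V (S , idEmp) v) (reached T0 sub′ uL ∘ proj₁) ≡ value T0 sub′ uL 1 S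
  single-firings = begin
    ∑[ v ∈ members V S ] Ex (fireAt V (S , idEmp) v) φ
      ≡⟨ ∑-cong (members V S) firing ⟩
    ∑[ v ∈ members V S ] reachedEx T0 sub′ uL (S , idEmp) (v ∷ [])
      ≡⟨ ∑-picks-proj₁ (members V S) _ ⟨
    ∑arrangements 1 (members V S) (reachedEx T0 sub′ uL (S , idEmp))
      ≡⟨ arrangements 1 ⟩
    value T0 sub′ uL 1 S ∎
    where
    φ : Config → ℚ
    φ = reached T0 sub′ uL ∘ proj₁
    firing : ∀ {v} → v ∈ members V S → Ex (fireAt V (S , idEmp) v) φ ≡ reachedEx T0 sub′ uL (S , idEmp) (v ∷ [])
    firing {v} v∈ = begin
      Ex (fireAt V (S , idEmp) v) φ
        ≡⟨ cong (λ d → Ex d φ) (fireEmp-fireAt V S idEmp (subst Unique (sym (ListP.map-id (members V S))) members-unique) v∈) ⟨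
      Ex (fireEmp V (S , idEmp) v) φ
        ≡⟨ Ex-cong (fireEmp V (S , idEmp) v) (λ {p} _ → sym (Ex-return (proj₂ p) φ)) ⟩
      Ex (fireEmp V (S , idEmp) v) (λ c → Ex (fireSeq V [] c) φ)
        ≡⟨ Ex-bind (fireEmp V (S , idEmp) v) (fireSeq V []) φ ⟨
      reachedEx T0 sub′ uL (S , idEmp) (v ∷ []) ∎

  -- The two summands of `delCount-bullets-one` are the two branches of the model: `N` of the `m`
  -- choices rest, and in the others the `n` of the firing probability cancels the `1 / n` of the
  -- uniform choice.
  T2R-single : K-T2R m (embed T0 S) y ≡ singleModel T0 S S′
  T2R-single = begin
    frac (η y) (η (embed T0 S)) * (frac 1 m * frac (coeff y (mΔ 1 (embed T0 S))) 1)
      ≡⟨ cong₂ (λ e c → e * (frac 1 m * c)) (frac-η T0 sub′ uL sub)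
           (≡.trans (frac-coeff y 1 (embed T0 S)) (delCount-bullets-one y N 0 tree-part)) ⟩
    scale * (frac 1 m * (delCount y (N ℕ.+ 0) 1 tree-part + ι N * delCount y (N ℕ.+ 0) 0 tree-part))
      ≡⟨ cong (λ b → scale * (frac 1 m * (delCount y b 1 tree-part + ι N * delCount y b 0 tree-part))) (ℕP.+-identityʳ N) ⟩
    scale * (frac 1 m * (delCount y N 1 tree-part + ι N * delCount y N 0 tree-part))
      ≡⟨ solve 5 (λ s f d₁ i d₀ → s :* (f :* (d₁ :+ i :* d₀)) := i :* f :* (s :* d₀) :+ f :* (s :* d₁)) refl
           scale (frac 1 m) (delCount y N 1 tree-part) (ι N) (delCount y N 0 tree-part) ⟩
    ι N * frac 1 m * value T0 sub′ uL 0 S + frac 1 m * value T0 sub′ uL 1 S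
      ≡⟨ cong₂ (λ f r → f * r + frac 1 m * value T0 sub′ uL 1 S) (sym (frac-split N m)) (value-zero T0 sub′ uL sub) ⟩
    frac N m * reached T0 sub′ uL S + frac 1 m * value T0 sub′ uL 1 S
      ≡⟨ cong (_+_ (frac N m * reached T0 sub′ uL S)) moves ⟨
    frac N m * φ (S , idEmp) + Ex (scaleD (frac n m) (bindD (uniform (members V S)) (fireAt V (S , idEmp)))) φ
      ≡⟨ probTo-Ex V (singleStep T0 S) S′ ⟨
    singleModel T0 S S′ ∎
    where
    φ : Config → ℚ
    φ c = 𝟙 (sameSet V (proj₁ c) S′)
    n≢0 : ℕ.NonZero n
    n≢0 = subst ℕ.NonZero (sym (count-size T0 sub)) _
    moves : Ex (scaleD (frac n m) (bindD (uniform (members V S)) (fireAt V (S , idEmp)))) φ ≡ frac 1 m * value T0 sub′ uL 1 S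
    moves = begin
      Ex (scaleD (frac n m) (bindD (uniform (members V S)) (fireAt V (S , idEmp)))) φ
        ≡⟨ Ex-scale (frac n m) (bindD (uniform (members V S)) (fireAt V (S , idEmp))) φ ⟩
      frac n m * Ex (bindD (uniform (members V S)) (fireAt V (S , idEmp))) φ
        ≡⟨ cong (frac n m *_) (≡.trans (Ex-bind (uniform (members V S)) (fireAt V (S , idEmp)) φ) (Ex-uniform (members V S) _)) ⟩
      frac n m * (frac 1 n * ∑[ v ∈ members V S ] Ex (fireAt V (S , idEmp) v) φ)
        ≡⟨ cong₂ (λ f s → f * (frac 1 n * s)) (frac-split n m) single-firings ⟩
      ι n * frac 1 m * (frac 1 n * value T0 sub′ uL 1 S)
        ≡⟨ solve 4 (λ i f g v → i :* f :* (g :* v) := g :* i :* (f :* v)) refl (ι n) (frac 1 m) (frac 1 n) (value T0 sub′ uL 1 S) ⟩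
      frac 1 n * ι n * (frac 1 m * value T0 sub′ uL 1 S)
        ≡⟨ cong (_* (frac 1 m * value T0 sub′ uL 1 S)) (frac-inverse n {{n≢0}}) ⟩
      1ℚ * (frac 1 m * value T0 sub′ uL 1 S)
        ≡⟨ ℚP.*-identityˡ _ ⟩
      frac 1 m * value T0 sub′ uL 1 S ∎

  -- Both sides become sums over the number `j` of firings with the weight
  -- `p ^ j * q ^ (n - j) / j !`: on the side of the chain once the isolated roots have been summed
  -- out and `m` is replaced by `n`, on the side of the model because a set of size `j` has `j !`
  -- orders.
  BinT2R-binomial : ∀ q → K-BinT2R m q (embed T0 S) y ≡ binomialModel T0 q S S′
  BinT2R-binomial q = begin
    frac (η y) (η (embed T0 S)) * binSum m q (embed T0 S) y m
      ≡⟨ cong₂ _*_ (frac-η T0 sub′ uL sub) chain ⟩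
    scale * ∑≤ n (λ j → weight p q n j * delCount y N j tree-part)
      ≡⟨ ∑≤-*ˡ scale n _ ⟨
    ∑≤ n (λ j → scale * (weight p q n j * delCount y N j tree-part))
      ≡⟨ ∑≤-cong n (λ j _ → ≡.trans
           (solve 3 (λ s w d → s :* (w :* d) := w :* (s :* d)) refl scale (weight p q n j) (delCount y N j tree-part))
           (cong (weight p q n j *_) (sym (arrangements j)))) ⟩
    ∑≤ n (λ j → weight p q n j * ∑arrangements j (members V S) P)
      ≡⟨ ∑-sublists-perms n (members V S) refl (weight p q n) P ⟨
    ∑[ F ∈ sublists (members V S) ] (weight p q n (length F) * ∑ (perms F) P)
      ≡⟨ ∑-cong (sublists (members V S)) (λ {F} _ → firing F) ⟨
    ∑[ F ∈ sublists (members V S) ] Ex (stepFor F) φ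
      ≡⟨ ∑-concatMap stepFor (sublists (members V S)) _ ⟨
    Ex (binomialStep T0 q S) φ
      ≡⟨ probTo-Ex V (binomialStep T0 q S) S′ ⟨
    binomialModel T0 q S S′ ∎
    where
    p : ℚ
    p = 1ℚ - q
    p+q : p + q ≡ 1ℚ
    p+q = ≡.trans (ℚP.+-assoc 1ℚ (- q) q) (≡.trans (cong (_+_ 1ℚ) (ℚP.+-inverseˡ q)) (ℚP.+-identityʳ 1ℚ))
    φ : Config → ℚ
    φ c = 𝟙 (sameSet V (proj₁ c) S′)
    P : List Addr → ℚ
    P = reachedEx T0 sub′ uL (S , idEmp)
    stepFor : List Addr → Dist Config
    stepFor F = scaleD ((p ^ℚ length F) * (q ^ℚ (n ∸ length F))) (bindD (uniform (perms F)) (λ σ → fireSeq V σ (S , idEmp)))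
    m≡ : N ℕ.+ sizeF tree-part ≡ m
    m≡ = ≡.trans (cong (N ℕ.+_) (sizeF-tree T0 sub)) (pad+count T0 sub)
    chain : binSum m q (embed T0 S) y m ≡ ∑≤ n (λ j → weight p q n j * delCount y N j tree-part)
    chain = begin
      binSum m q (embed T0 S) y m
        ≡⟨ binSum-∑≤ m q (embed T0 S) y m ⟩
      ∑≤ m (λ j → weight p q m j * delCount y 0 j (embed T0 S))
        ≡⟨ cong (λ l → ∑≤ l (λ j → weight p q l j * delCount y 0 j (embed T0 S))) m≡ ⟨
      ∑≤ (N ℕ.+ sizeF tree-part) (λ j → weight p q (N ℕ.+ sizeF tree-part) j * delCount y 0 j (embed T0 S))
        ≡⟨ ∑≤-weight-bullets p q p+q y N 0 tree-part ⟩
      ∑≤ (sizeF tree-part) (λ j → weight p q (sizeF tree-part) j * delCount y (N ℕ.+ 0) j tree-part)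
        ≡⟨ cong₂ (λ l b → ∑≤ l (λ j → weight p q l j * delCount y b j tree-part)) (sizeF-tree T0 sub) (ℕP.+-identityʳ N) ⟩
      ∑≤ n (λ j → weight p q n j * delCount y N j tree-part) ∎
    firing : ∀ F → Ex (stepFor F) φ ≡ weight p q n (length F) * ∑ (perms F) P
    firing F = begin
      Ex (stepFor F) φ
        ≡⟨ Ex-scale c (bindD (uniform (perms F)) (λ σ → fireSeq V σ (S , idEmp))) φ ⟩
      c * Ex (bindD (uniform (perms F)) (λ σ → fireSeq V σ (S , idEmp))) φ
        ≡⟨ cong (c *_) (≡.trans (Ex-bind (uniform (perms F)) (λ σ → fireSeq V σ (S , idEmp)) φ) (Ex-uniform (perms F) _)) ⟩
      c * (frac 1 (length (perms F)) * ∑ (perms F) P)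
        ≡⟨ cong (λ l → c * (frac 1 l * ∑ (perms F) P)) (length-perms (length F) F refl) ⟩
      c * (frac 1 (length F !) * ∑ (perms F) P)
        ≡⟨ solve 4 (λ a b f s → a :* b :* (f :* s) := f :* a :* b :* s) refl
             (p ^ℚ length F) (q ^ℚ (n ∸ length F)) (frac 1 (length F !)) (∑ (perms F) P) ⟩
      weight p q n (length F) * ∑ (perms F) P ∎
      where
      c : ℚ
      c = (p ^ℚ length F) * (q ^ℚ (n ∸ length F))

theorem5p2 : (k : ℕ) (T0 : RTree k) → Unique (labelsL T0) →
    (q₂ : ℚ) → 0ℚ ≤ q₂ → q₂ ≤ 1ℚ →
    -- the T2R chain stays in the set of forests  •^{n0-n} ⊔ T
    (∀ S → IsRootedSubtree T0 S → ∀ (y : Forest k) →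
      K-T2R (sizeR T0) (embed T0 S) y ≢ 0ℚ →
      ∃[ S' ] (IsRootedSubtree T0 S' × isoF y (embed T0 S') ≡ true))
    -- the BinT2R chain stays in the set of forests  •^{n0-n} ⊔ T
    × (∀ S → IsRootedSubtree T0 S → ∀ (y : Forest k) →
      K-BinT2R (sizeR T0) q₂ (embed T0 S) y ≢ 0ℚ →
      ∃[ S' ] (IsRootedSubtree T0 S' × isoF y (embed T0 S') ≡ true))
    -- the T2R chain is the single model
    × (∀ S S' → IsRootedSubtree T0 S → IsRootedSubtree T0 S' →
      K-T2R (sizeR T0) (embed T0 S) (embed T0 S') ≡ singleModel T0 S S')
    -- the BinT2R chain is the binomial model
    × (∀ S S' → IsRootedSubtree T0 S → IsRootedSubtree T0 S' →
      K-BinT2R (sizeR T0) q₂ (embed T0 S) (embed T0 S') ≡ binomialModel T0 q₂ S S')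
theorem5p2 k T0 uL q₂ _ _ = stays-T2R , stays-BinT2R
  , (λ _ _ sub sub′ → T2R-single T0 uL sub sub′)
  , (λ _ _ sub sub′ → BinT2R-binomial T0 uL sub sub′ q₂)
  where
  m : ℕ
  m = sizeR T0
  stays-T2R : ∀ S → IsRootedSubtree T0 S → ∀ (y : Forest k) → K-T2R m (embed T0 S) y ≢ 0ℚ →
    ∃[ S′ ] (IsRootedSubtree T0 S′ × isoF y (embed T0 S′) ≡ true)
  stays-T2R S sub y nz = stays sub y 1 (λ c≡0 → nz (begin
    ratio * (frac 1 m * frac (coeff y (mΔ 1 (embed T0 S))) 1)
      ≡⟨ cong (λ c → ratio * (frac 1 m * frac c 1)) c≡0 ⟩
    ratio * (frac 1 m * 0ℚ)
      ≡⟨ cong (ratio *_) (ℚP.*-zeroʳ (frac 1 m)) ⟩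
    ratio * 0ℚ
      ≡⟨ ℚP.*-zeroʳ ratio ⟩
    0ℚ ∎))
    where
    ratio : ℚ
    ratio = frac (η y) (η (embed T0 S))
  stays-BinT2R : ∀ S → IsRootedSubtree T0 S → ∀ (y : Forest k) → K-BinT2R m q₂ (embed T0 S) y ≢ 0ℚ →
    ∃[ S′ ] (IsRootedSubtree T0 S′ × isoF y (embed T0 S′) ≡ true)
  stays-BinT2R S sub y nz with binSum-nonzero m q₂ (embed T0 S) y m (λ sum≡0 → nz (begin
    ratio * binSum m q₂ (embed T0 S) y m ≡⟨ cong (ratio *_) sum≡0 ⟩
    ratio * 0ℚ                           ≡⟨ ℚP.*-zeroʳ ratio ⟩
    0ℚ                                   ∎))
    where
    ratio : ℚ
    ratio = frac (η y) (η (embed T0 S))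
  ... | r , c≢0 = stays sub y r c≢0
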